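{- For every $\delta>0$ there exists an integer $n_0$ such that every directed graph $D$ with $n\ge n_0$ vertices satisfies \[\tau_t(D)\le 1.8\,\nu_t(D)+\delta n^2 .\] Equivalently, for $n$-vertex directed graphs $D$, $\tau_t(D)\le 1.8\,\nu_t(D)+o(n^2)$.
   Context: A directed graph has no loops and no parallel arcs, but may contain bigons (a pair of arcs $uv$ and $vu$). A (directed) triangle is a triple of arcs $uv, vw, wu$ on three distinct vertices. $\nu_t(D)$ denotes the maximum number of pairwise arc-disjoint directed triangles in $D$, and $\tau_t(D)$ denotes the minimum number of arcs whose removal leaves no directed triangle. -}

module Defs where

open import Data.Nat using (ℕ)
open import Data.Fin using (Fin)
open import Data.Bool using (Bool; true; false)
open import Data.Product using (_×_; _,_; ∃; Σ)
open import Data.List using (List; _∷_; [])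
open import Data.List.Membership.Propositional using (_∈_)
open import Data.List.Relation.Unary.Any using (Any)
open import Data.Empty using (⊥)
open import Relation.Nullary using (¬_)
open import Relation.Binary.PropositionalEquality using (_≡_; _≢_)
open import Data.Integer using (+_)
open import Data.Rational using (ℚ; _/_)

-- A directed graph on vertex set Fin n: an adjacency relation with no loops.
-- (Parallel arcs are impossible; bigons u→v, v→u are allowed.)
record Digraph (n : ℕ) : Set where
  field
    adj      : Fin n → Fin n → Bool
    loopless : ∀ u → adj u u ≡ false

open Digraph public

Arc : ∀ {n} → Digraph n → Fin n → Fin n → Set
Arc D u v = adj D u v ≡ true

record Triangle {n : ℕ} (D : Digraph n) : Set where
  field
    a b c : Fin n
    a≢b : a ≢ b
    b≢c : b ≢ c
    c≢a : c ≢ a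
    ab : Arc D a b
    bc : Arc D b c
    ca : Arc D c a

open Triangle public

arcsOf : ∀ {n} {D : Digraph n} → Triangle D → List (Fin n × Fin n)
arcsOf t = (a t , b t) ∷ (b t , c t) ∷ (c t , a t) ∷ []

ArcDisjoint : ∀ {n} {D : Digraph n} → Triangle D → Triangle D → Set
ArcDisjoint t s = ∀ e → e ∈ arcsOf t → e ∈ arcsOf s → ⊥

Packing : ∀ {n} → Digraph n → ℕ → Set
Packing D k = Σ (Fin k → Triangle _) λ T →
  ∀ i j → i ≢ j → ArcDisjoint {D = D} (T i) (T j)

Cover : ∀ {n} → Digraph n → ℕ → Set
Cover {n} D k = Σ (Fin k → Fin n × Fin n) λ F →
  (∀ i → Arc D (Data.Product.proj₁ (F i)) (Data.Product.proj₂ (F i))) ×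
  (∀ (t : Triangle D) → ∃ λ i → F i ∈ arcsOf t)

IsNu : ∀ {n} → Digraph n → ℕ → Set
IsNu D m = Packing D m × (∀ k → Packing D k → k Data.Nat.≤ m)

IsTau : ∀ {n} → Digraph n → ℕ → Set
IsTau D m = Cover D m × (∀ k → Cover D k → m Data.Nat.≤ k)

ℕ→ℚ : ℕ → ℚ
ℕ→ℚ k = (+ k) / 1

{-# OPTIONS --safe #-}
module Submission where

-- Let S be a random set of arcs containing each arc independently with probability p, and let w(e) be
-- the expected increase of the packing number ν(S) when the arc e is added to S. By Russo's formula
-- Σ w(e) is the derivative of E ν(S) in p, so for some p bounded away from 0 and 1 it is at most about
-- ν(D). Adding the three arcs of a triangle T one by one to S ∖ T increases ν by at least 1. Forcing two
-- of the arcs of T to be in or out of S noticeably changes the expected increase at the third arc for only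
-- boundedly many T through that arc, by Bessel's inequality: apart from the arc they share, these triangles
-- are disjoint, so the deviations of the forced events are orthogonal. Hence w(T) ≥ 1 - 1/184 for all but
-- O(n²) triangles T, that is, w is nearly a fractional cover.
--
-- To round w, give the vertices random labels φ in a short interval and delete the arc uv if
-- w(uv) ≥ 1/3 + φ(u) - φ(v), up to discretisation. An arc is deleted with probability at most 1.7902 w(uv),
-- and the remaining triangles have w(T) < 1 - 1/184, so there are only O(n²) of them. The triangle removal
-- lemma destroys these with o(n²) further arcs.
--
-- The removal lemma needs only a one-sided regularity. As long as many pairs of classes contain a large
-- rectangle of small density, all these rectangles are cut out and declared dead. Their edges are few, and
-- the dead area grows by a fixed proportion of n² in each round.

open import Data.Nat using (zero; suc)
open import Data.Fin using (Fin; zero; suc)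
open import Data.Product using (_×_; _,_; ∃; proj₁; proj₂)
open import Data.Sum using (_⊎_; inj₁; inj₂) renaming ([_,_]′ to either)
open import Data.Bool using (Bool; true; false; T; _∧_; _∨_; not) renaming (_≟_ to _≟ᵇ_)
open import Data.Vec using (Vec; []; _∷_; lookup; tabulate; replicate; _[_]≔_)
open import Data.List as List using (List; []; _∷_; length)
open import Data.List.Membership.Propositional using (_∈_; _∉_)
open import Data.List.Membership.Propositional.Properties using (∈-lookup)
open import Data.List.Relation.Unary.Any using (here; there; any?)
open import Data.List.Relation.Unary.All as All using (All; []; _∷_; all?)
open import Data.List.Relation.Unary.AllPairs as AllPairs using (AllPairs; []; _∷_)
open import Data.Empty using (⊥; ⊥-elim)
open import Function using (_∘_)
open import Relation.Nullary using (Dec; yes; no; ¬_; _×-dec_)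
open import Relation.Nullary.Decidable using (⌊_⌋; dec⇒maybe; from-yes)
open import Relation.Binary using (Rel; Reflexive; Transitive; Total; DecidableEquality)
open import Relation.Binary.PropositionalEquality

-- The function w takes the place of an optimal fractional cover, but its total is compared with the
-- integral packing number directly. The price is that triangles with a noticeable correlation may
-- stay uncovered. Forcing two arcs has probability at least α² once p lies in [α, 1 - α]; a small
-- correlation then means a small change. Giving up both ends of the unit interval, with α = 1/400,
-- costs a factor 400/398. The integral over p is replaced by a sum over steps of length about α/N²,
-- where N = n² is the number of ordered pairs, so that the second-order errors add up to at most 1.
-- The labels φ cancel around a cycle, so a triangle that keeps its three arcs has total weight
-- below 3 · 1/3. With φ uniform on [0, 1/3] the ratio of cutting probability to weight would be at
-- most 6 - 3√2, about 1.757, attained at weight √2/3. The grid of 11 labels raises it to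
-- 17112/9559, and the factor 400/398 still leaves it below 1.8.

argmin : ∀ {a r} {A : Set a} {_≲_ : Rel A r} → Reflexive _≲_ → Transitive _≲_ → Total _≲_ →
  ∀ {n} (f : Fin (suc n) → A) → ∃ λ i → ∀ j → f i ≲ f j
argmin ≲-refl ≲-trans total {zero}  f = zero , λ { zero → ≲-refl }
argmin ≲-refl ≲-trans total {suc n} f with argmin ≲-refl ≲-trans total (λ i → f (suc i))
... | i , least with total (f zero) (f (suc i))
...   | inj₁ f0≲fi = zero , λ { zero → ≲-refl ; (suc j) → ≲-trans f0≲fi (least j) }
...   | inj₂ fi≲f0 = suc i , λ { zero → fi≲f0 ; (suc j) → least j }

-- Maximum packings in a hypergraph; its vertices will be arcs and its edges triangles.

module Packings where

  open import Data.Nat using (ℕ; zero; suc; _≤_; _⊔_; z≤n; s≤s)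
  open import Data.Nat.Properties using (≤-trans; ≤-refl; m≤m⊔n; m≤n⊔m; ⊔-lub; ⊔-sel)

  module MaximumPacking {A X : Set} (_≟_ : DecidableEquality X) (verts : A → List X) where

    _∈?_ : ∀ (x : X) xs → Dec (x ∈ xs)
    x ∈? xs = any? (x ≟_) xs

    _∖_ : (X → Bool) → List X → X → Bool
    (S ∖ e) x = S x ∧ not ⌊ x ∈? e ⌋

    Contains : (X → Bool) → List X → Set
    Contains S = All (λ x → S x ≡ true)

    contains? : ∀ S e → Dec (Contains S e)
    contains? S = all? (λ x → S x ≟ᵇ true)

    -- Taking a hyperedge deletes its vertices from `S`, so disjointness needs no record. The
    -- comparisons below are inductions along this choice between skipping and taking.
    maxPacking : List A → (X → Bool) → ℕ
    maxPacking []       S = 0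
    maxPacking (t ∷ ts) S with contains? S (verts t)
    ... | yes _ = maxPacking ts S ⊔ suc (maxPacking ts (S ∖ verts t))
    ... | no  _ = maxPacking ts S

    _⊑_ : (X → Bool) → (X → Bool) → Set
    S ⊑ S′ = ∀ x → S x ≡ true → S′ x ≡ true

    ∖-elim : ∀ S e x → (S ∖ e) x ≡ true → S x ≡ true × x ∉ e
    ∖-elim S e x eq with S x | x ∈? e
    ∖-elim S e x () | false | _
    ∖-elim S e x () | true  | yes _
    ... | true | no x∉e = refl , x∉e

    ∖-intro : ∀ S e x → S x ≡ true → x ∉ e → (S ∖ e) x ≡ true
    ∖-intro S e x Sx x∉e with S x | x ∈? e
    ... | true | yes x∈e = ⊥-elim (x∉e x∈e)
    ... | true | no _    = refl

    ∖-mono : ∀ {S S′} e → S ⊑ S′ → (S ∖ e) ⊑ (S′ ∖ e)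
    ∖-mono {S} {S′} e S⊑S′ x h with ∖-elim S e x h
    ... | Sx , x∉e = ∖-intro S′ e x (S⊑S′ x Sx) x∉e

    contains-mono : ∀ {S S′ e} → S ⊑ S′ → Contains S e → Contains S′ e
    contains-mono S⊑S′ = All.map (λ {x} → S⊑S′ x)

    maxPacking-skip : ∀ t ts S → maxPacking ts S ≤ maxPacking (t ∷ ts) S
    maxPacking-skip t ts S with contains? S (verts t)
    ... | yes _ = m≤m⊔n _ _
    ... | no  _ = ≤-refl

    maxPacking-take : ∀ t ts S → Contains S (verts t) →
      suc (maxPacking ts (S ∖ verts t)) ≤ maxPacking (t ∷ ts) S
    maxPacking-take t ts S S⊇t with contains? S (verts t)
    ... | yes _ = m≤n⊔m _ _
    ... | no ¬c = ⊥-elim (¬c S⊇t)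

    maxPacking-mono : ∀ ts {S S′} → S ⊑ S′ → maxPacking ts S ≤ maxPacking ts S′
    maxPacking-mono []       S⊑S′ = z≤n
    maxPacking-mono (t ∷ ts) {S} {S′} S⊑S′ with contains? S (verts t)
    ... | no  _  = ≤-trans (maxPacking-mono ts S⊑S′) (maxPacking-skip t ts S′)
    ... | yes S⊇t = ⊔-lub (≤-trans (maxPacking-mono ts S⊑S′) (maxPacking-skip t ts S′))
      (≤-trans (s≤s (maxPacking-mono ts (∖-mono (verts t) S⊑S′)))
               (maxPacking-take t ts S′ (contains-mono S⊑S′ S⊇t)))

    -- The extra vertex `v` lies in at most one hyperedge of a packing; giving up that one leaves a
    -- packing inside `S`.
    maxPacking-lipschitz : ∀ ts v {S S′} → (∀ x → S′ x ≡ true → x ≢ v → S x ≡ true) →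
      maxPacking ts S′ ≤ suc (maxPacking ts S)
    maxPacking-lipschitz [] v _ = z≤n
    maxPacking-lipschitz (t ∷ ts) v {S} {S′} sub with contains? S′ (verts t)
    ... | no _ = ≤-trans (maxPacking-lipschitz ts v sub) (s≤s (maxPacking-skip t ts S))
    ... | yes S′⊇t = ⊔-lub (≤-trans (maxPacking-lipschitz ts v sub) (s≤s (maxPacking-skip t ts S))) (s≤s used)
      where
      used : maxPacking ts (S′ ∖ verts t) ≤ maxPacking (t ∷ ts) S
      used with v ∈? verts t
      -- This `t` is the hyperedge to give up: once its vertices are gone, nothing outside `S` is
      -- left.
      ... | yes v∈t = ≤-trans (maxPacking-mono ts without) (maxPacking-skip t ts S)
        where
        without : (S′ ∖ verts t) ⊑ S
        without x h with ∖-elim S′ (verts t) x h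
        ... | S′x , x∉t = sub x S′x (λ { refl → x∉t v∈t })
      ... | no v∉t = ≤-trans (maxPacking-lipschitz ts v sub′) (maxPacking-take t ts S S⊇t)
        where
        sub′ : ∀ x → (S′ ∖ verts t) x ≡ true → x ≢ v → (S ∖ verts t) x ≡ true
        sub′ x h x≢v with ∖-elim S′ (verts t) x h
        ... | S′x , x∉t = ∖-intro S (verts t) x (sub x S′x x≢v) x∉t
        S⊇t : Contains S (verts t)
        S⊇t = All.tabulate (λ {x} x∈t → sub x (All.lookup S′⊇t x∈t) (λ { refl → v∉t x∈t }))

    -- A packing inside `S` misses `t` entirely, so `t` can be added to it. The vertex `x` makes `t`
    -- nonempty; an empty hyperedge could already be counted inside `S`.
    maxPacking-add : ∀ {ts t x S S′} → t ∈ ts → x ∈ verts t →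
      S ⊑ S′ → Contains S′ (verts t) → All (λ y → S y ≢ true) (verts t) →
      suc (maxPacking ts S) ≤ maxPacking ts S′
    maxPacking-add {t ∷ ts} {.t} {x} {S} {S′} (here refl) x∈t S⊑S′ S′⊇t S#t with contains? S (verts t)
    ... | yes S⊇t = ⊥-elim (All.lookup S#t x∈t (All.lookup S⊇t x∈t))
    ... | no  _   = ≤-trans (s≤s (maxPacking-mono ts without)) (maxPacking-take t ts S′ S′⊇t)
      where
      without : S ⊑ (S′ ∖ verts t)
      without y Sy = ∖-intro S′ (verts t) y (S⊑S′ y Sy) (λ y∈t → All.lookup S#t y∈t Sy)
    maxPacking-add {u ∷ ts} {t} {x} {S} {S′} (there t∈ts) x∈t S⊑S′ S′⊇t S#t = step
      where
      skip : suc (maxPacking ts S) ≤ maxPacking (u ∷ ts) S′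
      skip = ≤-trans (maxPacking-add t∈ts x∈t S⊑S′ S′⊇t S#t) (maxPacking-skip u ts S′)
      take : Contains S (verts u) → suc (suc (maxPacking ts (S ∖ verts u))) ≤ maxPacking (u ∷ ts) S′
      -- The vertices of `u` lie in `S` and those of `t` do not, so deleting `u` from `S′` leaves
      -- `t` intact.
      take S⊇u = ≤-trans
        (s≤s (maxPacking-add t∈ts x∈t (∖-mono (verts u) S⊑S′)
          (All.tabulate (λ {y} y∈t → ∖-intro S′ (verts u) y (All.lookup S′⊇t y∈t)
            (λ y∈u → All.lookup S#t y∈t (All.lookup S⊇u y∈u))))
          (All.map (λ {y} Sy≢ h → Sy≢ (proj₁ (∖-elim S (verts u) y h))) S#t)))
        (maxPacking-take u ts S′ (contains-mono S⊑S′ S⊇u))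
      step : suc (maxPacking (u ∷ ts) S) ≤ maxPacking (u ∷ ts) S′
      step with contains? S (verts u)
      ... | no  _   = skip
      ... | yes S⊇u with ⊔-sel (maxPacking ts S) (suc (maxPacking ts (S ∖ verts u)))
      ...   | inj₁ eq rewrite eq = skip
      ...   | inj₂ eq rewrite eq = take S⊇u

    VertexDisjoint : A → A → Set
    VertexDisjoint t u = ∀ x → x ∈ verts t → x ∈ verts u → ⊥

    maxPacking-attained : ∀ ts S → ∃ λ us → length us ≡ maxPacking ts S
      × AllPairs VertexDisjoint us × All (λ u → Contains S (verts u)) us
    maxPacking-attained [] S = [] , refl , [] , []
    maxPacking-attained (t ∷ ts) S with contains? S (verts t)
    ... | no _ = maxPacking-attained ts S
    ... | yes S⊇t with ⊔-sel (maxPacking ts S) (suc (maxPacking ts (S ∖ verts t)))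
    ...   | inj₁ eq rewrite eq = maxPacking-attained ts S
    ...   | inj₂ eq rewrite eq with maxPacking-attained ts (S ∖ verts t)
    ...     | us , len , disj , inside = t ∷ us , cong suc len
      , All.map (λ {u} c x x∈t x∈u → proj₂ (∖-elim S (verts t) x (All.lookup c x∈u)) x∈t) inside ∷ disj
      , S⊇t ∷ All.map (All.map (λ {x} h → proj₁ (∖-elim S (verts t) x h))) inside

  AllPairs-lookup : ∀ {A : Set} {R : A → A → Set} → (∀ {x y} → R x y → R y x) →
    ∀ {xs} → AllPairs R xs → ∀ i j → i ≢ j → R (List.lookup xs i) (List.lookup xs j)
  AllPairs-lookup flip (_ ∷ _)   zero    zero    i≢j = ⊥-elim (i≢j refl)
  AllPairs-lookup flip (rs ∷ _)  zero    (suc j) _   = All.lookup rs (∈-lookup j)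
  AllPairs-lookup flip (rs ∷ _)  (suc i) zero    _   = flip (All.lookup rs (∈-lookup i))
  AllPairs-lookup flip (_ ∷ rss) (suc i) (suc j) i≢j = AllPairs-lookup flip rss i j (λ e → i≢j (cong suc e))

-- Finite sums, fibers of a partition and edge counts.

module Counting where

  open import Data.Nat
  open import Data.Nat.Properties
  open import Data.Nat.Tactic.RingSolver using (solve-∀)
  open import Data.Fin using (toℕ; fromℕ<; combine; remQuot; funToFin; finToFun)
  open import Data.Fin.Properties using (nonZeroIndex; toℕ-fromℕ<; remQuot-combine; finToFun-funToFin)
    renaming (_≟_ to _≟ᶠ_; all? to allFin?)
  open import Data.Fin.Subset using (Subset)
  open import Data.Fin.Subset.Properties using (anySubset?)
  open import Data.Vec.Properties using (lookup∘tabulate)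
  open import Algebra.Properties.Semiring.Sum +-*-semiring using ()
    renaming (sum to ∑; ∑-distrib-+ to ∑-+; *-distribˡ-sum to *-∑; *-distribʳ-sum to ∑-*; sum-cong-≗ to ∑-cong; ∑-comm to ∑-swap) public

  bit : Bool → ℕ
  bit true  = 1
  bit false = 0

  bit-∧ : ∀ x y → bit (x ∧ y) ≡ bit x * bit y
  bit-∧ true  y = sym (+-identityʳ (bit y))
  bit-∧ false y = refl

  bit-∨ : ∀ x y → bit (x ∨ y) ≤ bit x + bit y
  bit-∨ true  y = m≤m+n 1 (bit y)
  bit-∨ false y = ≤-refl

  bit≤1 : ∀ x → bit x ≤ 1
  bit≤1 true  = ≤-refl
  bit≤1 false = z≤n

  ∑-mono : ∀ {n} {f g : Fin n → ℕ} → (∀ i → f i ≤ g i) → ∑ f ≤ ∑ g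
  ∑-mono {zero}  f≤g = z≤n
  ∑-mono {suc n} f≤g = +-mono-≤ (f≤g zero) (∑-mono (λ i → f≤g (suc i)))

  ∑-const : ∀ n x → ∑ {n} (λ _ → x) ≡ n * x
  ∑-const zero    x = refl
  ∑-const (suc n) x = cong (x +_) (∑-const n x)

  ∑∑-mono : ∀ {m n} {f g : Fin m → Fin n → ℕ} → (∀ i j → f i j ≤ g i j) →
    ∑ (λ i → ∑ (f i)) ≤ ∑ (λ i → ∑ (g i))
  ∑∑-mono f≤g = ∑-mono (λ i → ∑-mono (f≤g i))

  ∑∑-cong : ∀ {m n} {f g : Fin m → Fin n → ℕ} → (∀ i j → f i j ≡ g i j) →
    ∑ (λ i → ∑ (f i)) ≡ ∑ (λ i → ∑ (g i))
  ∑∑-cong f≡g = ∑-cong (λ i → ∑-cong (f≡g i))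

  ∑∑-+ : ∀ {m n} (f g : Fin m → Fin n → ℕ) →
    ∑ (λ i → ∑ (λ j → f i j + g i j)) ≡ ∑ (λ i → ∑ (f i)) + ∑ (λ i → ∑ (g i))
  ∑∑-+ f g = trans (∑-cong (λ i → ∑-+ (f i) (g i))) (∑-+ (λ i → ∑ (f i)) (λ i → ∑ (g i)))

  *-∑∑ : ∀ {m n} x (f : Fin m → Fin n → ℕ) →
    x * ∑ (λ i → ∑ (f i)) ≡ ∑ (λ i → ∑ (λ j → x * f i j))
  *-∑∑ x f = trans (*-∑ x (λ i → ∑ (f i))) (∑-cong (λ i → *-∑ x (f i)))

  ∑-*-∑ : ∀ {m n} (f : Fin m → ℕ) (g : Fin n → ℕ) → ∑ f * ∑ g ≡ ∑ (λ i → ∑ (λ j → f i * g j))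
  ∑-*-∑ f g = trans (∑-* (∑ g) f) (∑-cong (λ i → *-∑ (f i) g))

  ∑-delta : ∀ {n} (i : Fin n) (f : Fin n → ℕ) → ∑ (λ j → bit ⌊ i ≟ᶠ j ⌋ * f j) ≡ f i
  ∑-delta {suc n} zero f = begin
    f zero + 0 + ∑ {n} (λ _ → 0)  ≡⟨ cong₂ _+_ (+-identityʳ (f zero)) (trans (∑-const n 0) (*-zeroʳ n)) ⟩
    f zero + 0                    ≡⟨ +-identityʳ (f zero) ⟩
    f zero                        ∎
    where open ≡-Reasoning
  ∑-delta {suc n} (suc i) f = trans (∑-cong (λ j → cong (λ b → bit b * f (suc j)) (suc-≟ i j))) (∑-delta i (λ j → f (suc j)))
    where
    suc-≟ : ∀ {n} (i j : Fin n) → ⌊ suc i ≟ᶠ suc j ⌋ ≡ ⌊ i ≟ᶠ j ⌋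
    suc-≟ i j with i ≟ᶠ j
    ... | yes _ = refl
    ... | no  _ = refl

  fiber : ∀ {n K} → (Fin n → Fin K) → Fin K → Fin n → Bool
  fiber β j b = ⌊ β b ≟ᶠ j ⌋

  -- Turns a summand that depends on the class of `b` into sums over one fixed class, from which
  -- factors depending on the class alone can be pulled out.
  ∑-fibers : ∀ {n K} (β : Fin n → Fin K) (f : Fin K → Fin n → ℕ) →
    ∑ (λ b → f (β b) b) ≡ ∑ (λ j → ∑ (λ b → bit (fiber β j b) * f j b))
  ∑-fibers β f = trans (∑-cong (λ b → sym (∑-delta (β b) (λ j → f j b)))) (∑-swap (λ b j → bit (fiber β j b) * f j b))

  ∑-fibers₂ : ∀ {m n K L} (β : Fin m → Fin K) (γ : Fin n → Fin L) (f : Fin K → Fin L → Fin m → Fin n → ℕ) →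
    ∑ (λ b → ∑ (λ c → f (β b) (γ c) b c))
    ≡ ∑ (λ j → ∑ (λ k → ∑ (λ b → ∑ (λ c → bit (fiber β j b) * bit (fiber γ k c) * f j k b c))))
  ∑-fibers₂ β γ f = begin
    ∑ (λ b → ∑ (λ c → f (β b) (γ c) b c))
      ≡⟨ ∑-fibers β (λ j b → ∑ (λ c → f j (γ c) b c)) ⟩
    ∑ (λ j → ∑ (λ b → bit (fiber β j b) * ∑ (λ c → f j (γ c) b c)))
      ≡⟨ ∑∑-cong (λ j b → trans (cong (bit (fiber β j b) *_) (∑-fibers γ (λ k c → f j k b c)))
           (trans (*-∑∑ (bit (fiber β j b)) (λ k c → bit (fiber γ k c) * f j k b c))
             (∑∑-cong (λ k c → sym (*-assoc (bit (fiber β j b)) (bit (fiber γ k c)) (f j k b c)))))) ⟩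
    ∑ (λ j → ∑ (λ b → ∑ (λ k → ∑ (λ c → bit (fiber β j b) * bit (fiber γ k c) * f j k b c))))
      ≡⟨ ∑-cong (λ j → ∑-swap (λ b k → ∑ (λ c → bit (fiber β j b) * bit (fiber γ k c) * f j k b c))) ⟩
    ∑ (λ j → ∑ (λ k → ∑ (λ b → ∑ (λ c → bit (fiber β j b) * bit (fiber γ k c) * f j k b c)))) ∎
    where open ≡-Reasoning

  ∣_∣ : ∀ {n} → (Fin n → Bool) → ℕ
  ∣ X ∣ = ∑ (λ b → bit (X b))

  _∩_ : ∀ {n} → (Fin n → Bool) → (Fin n → Bool) → Fin n → Bool
  (X ∩ Y) b = X b ∧ Y b

  edges : ∀ {m n} → (Fin m → Fin n → Bool) → (Fin m → Bool) → (Fin n → Bool) → ℕ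
  edges G X Y = ∑ (λ b → ∑ (λ c → bit (X b) * bit (Y c) * bit (G b c)))

  ∑-fiber-sizes : ∀ {n K} (β : Fin n → Fin K) → ∑ (λ j → ∣ fiber β j ∣) ≡ n
  ∑-fiber-sizes {n} β = begin
    ∑ (λ j → ∣ fiber β j ∣)                       ≡⟨ ∑∑-cong (λ j b → *-identityʳ (bit (fiber β j b))) ⟨
    ∑ (λ j → ∑ (λ b → bit (fiber β j b) * 1))     ≡⟨ ∑-fibers β (λ _ _ → 1) ⟨
    ∑ {n} (λ _ → 1)                               ≡⟨ trans (∑-const n 1) (*-identityʳ n) ⟩
    n                                             ∎
    where open ≡-Reasoning

  -- One-sided regularity: partitions in which few alive pairs contain a large sparse rectangle.

  toFin2 : Bool → Fin 2
  toFin2 true  = zero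
  toFin2 false = suc zero

  fromFin2 : Fin 2 → Bool
  fromFin2 zero    = true
  fromFin2 (suc _) = false

  -- A refined class remembers one bit for each opposite class; the coding keeps classes indexed by
  -- some `Fin`.
  bits : ∀ {K} → (Fin K → Bool) → Fin (2 ^ K)
  bits g = funToFin (λ k → toFin2 (g k))

  unbits : ∀ {K} → Fin (2 ^ K) → Fin K → Bool
  unbits x k = fromFin2 (finToFun x k)

  unbits-bits : ∀ {K} (g : Fin K → Bool) k → unbits (bits g) k ≡ g k
  unbits-bits g k = trans (cong fromFin2 (finToFun-funToFin (λ k → toFin2 (g k)) k)) (inverse (g k))
    where
    inverse : ∀ b → fromFin2 (toFin2 b) ≡ b
    inverse true  = refl
    inverse false = refl

  -- Each of `s` further rounds splits every class by `K` subsets. The maximum makes the bound valid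
  -- for an early stop as well, without a monotonicity argument.
  cellBound : ℕ → ℕ → ℕ
  cellBound zero    K = K
  cellBound (suc s) K = K ⊔ cellBound s (K * 2 ^ K)

  module _ {n : ℕ} (G : Fin n → Fin n → Bool) (t : ℕ) where

    -- The obstruction to one-sided regularity: a rectangle with a share of at least 1/t of either
    -- side and density at most 1/t. Its sides are `Subset`s so that `anySubset?` can search for
    -- them.
    SparseIn : (U V : Fin n → Bool) → Subset n → Subset n → Set
    SparseIn U V X Y = ∣ U ∣ ≤ t * ∣ U ∩ lookup X ∣ × ∣ V ∣ ≤ t * ∣ V ∩ lookup Y ∣
      × t * edges G (U ∩ lookup X) (V ∩ lookup Y) ≤ ∣ U ∩ lookup X ∣ * ∣ V ∩ lookup Y ∣

    Sparse : (U V : Fin n → Bool) → Set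
    Sparse U V = ∃ λ X → ∃ λ Y → SparseIn U V X Y

    sparse? : ∀ U V → Dec (Sparse U V)
    sparse? U V = anySubset? (λ X → anySubset? (λ Y →
      (∣ U ∣ ≤? t * ∣ U ∩ lookup X ∣) ×-dec ((∣ V ∣ ≤? t * ∣ V ∩ lookup Y ∣)
        ×-dec (t * edges G (U ∩ lookup X) (V ∩ lookup Y) ≤? ∣ U ∩ lookup X ∣ * ∣ V ∩ lookup Y ∣))))

    -- The relation is treated as a bipartite graph, with `β` partitioning the tails and `γ` the
    -- heads. Nothing is asked of the structure of a dead pair: its edges will simply be removed,
    -- which is affordable as their density is at most 1/t overall.
    record Cells (K : ℕ) : Set where
      field
        β γ   : Fin n → Fin K
        alive : Fin K → Fin K → Bool

      dead : Fin n → Fin n → ℕ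
      dead b c = bit (not (alive (β b) (γ c)))

      deadArea : ℕ
      deadArea = ∑ (λ b → ∑ (dead b))

      field
        deadEdges≤ : t * ∑ (λ b → ∑ (λ c → dead b c * bit (G b c))) ≤ deadArea

      bad : Fin K → Fin K → Bool
      bad j k = alive j k ∧ ⌊ sparse? (fiber β j) (fiber γ k) ⌋

      badArea : ℕ
      badArea = ∑ (λ b → ∑ (λ c → bit (bad (β b) (γ c))))

      deadArea≤ : deadArea ≤ n * n
      deadArea≤ = ≤-trans (∑∑-mono (λ b c → bit≤1 (not (alive (β b) (γ c)))))
        (≤-reflexive (trans (∑-cong {n} (λ _ → trans (∑-const n 1) (*-identityʳ n))) (∑-const n n)))

    open Cells

    one-cell : Cells 1
    one-cell = record
      { β = λ _ → zero ; γ = λ _ → zero ; alive = λ _ _ → true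
      ; deadEdges≤ = ≤-reflexive (trans (cong (t *_) zeros) (trans (*-zeroʳ t) (sym zeros))) }
      where
      zeros : ∑ {n} (λ _ → ∑ {n} (λ _ → 0)) ≡ 0
      zeros = trans (∑-cong {n} (λ _ → trans (∑-const n 0) (*-zeroʳ n))) (trans (∑-const n 0) (*-zeroʳ n))

    pick : ∀ {U V} → Dec (Sparse U V) → Subset n × Subset n
    pick (yes (X , Y , _)) = X , Y
    -- Without a sparse rectangle the empty sets are chosen, which split no class.
    pick (no _)            = replicate n false , replicate n false

    pick-sparse : ∀ {U V} (d : Dec (Sparse U V)) → ⌊ d ⌋ ≡ true → SparseIn U V (proj₁ (pick d)) (proj₂ (pick d))
    pick-sparse (yes (X , Y , sp)) _ = sp

    module Refine {K : ℕ} (s : Cells K) where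

      open Cells s renaming (β to β₀; γ to γ₀; alive to alive₀; dead to dead₀; deadArea to deadArea₀;
        deadEdges≤ to deadEdges₀≤; bad to bad₀; badArea to badArea₀) using ()

      B C : Fin K → Fin n → Bool
      B = fiber β₀
      C = fiber γ₀

      X Y : Fin K → Fin K → Fin n → Bool
      X j k = lookup (proj₁ (pick (sparse? (B j) (C k))))
      Y j k = lookup (proj₂ (pick (sparse? (B j) (C k))))

      Code : Set
      Code = Fin K × Fin (2 ^ K)

      live : Code → Code → Bool
      live (j , x) (k , y) = alive₀ j k ∧ not (bad₀ j k ∧ (unbits x k ∧ unbits y j))

      -- The new class of a vertex is its old class together with the set of opposite classes whose
      -- chosen rectangle contains it on this side. Every rectangle `X j k` × `Y j k` within a pair
      -- is thus a union of pairs of new classes and can be killed exactly.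
      β′ γ′ : Fin n → Fin (K * 2 ^ K)
      β′ b = combine (β₀ b) (bits (λ k → X (β₀ b) k b))
      γ′ c = combine (γ₀ c) (bits (λ j → Y j (γ₀ c) c))

      alive′ : Fin (K * 2 ^ K) → Fin (K * 2 ^ K) → Bool
      alive′ j k = live (remQuot (2 ^ K) j) (remQuot (2 ^ K) k)

      alive′≡ : ∀ b c → alive′ (β′ b) (γ′ c)
        ≡ alive₀ (β₀ b) (γ₀ c) ∧ not (bad₀ (β₀ b) (γ₀ c) ∧ (X (β₀ b) (γ₀ c) b ∧ Y (β₀ b) (γ₀ c) c))
      alive′≡ b c = trans
        (cong₂ live (remQuot-combine (β₀ b) (bits (λ k → X (β₀ b) k b))) (remQuot-combine (γ₀ c) (bits (λ j → Y j (γ₀ c) c))))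
        (cong₂ (λ x y → alive₀ (β₀ b) (γ₀ c) ∧ not (bad₀ (β₀ b) (γ₀ c) ∧ (x ∧ y)))
          (unbits-bits (λ k → X (β₀ b) k b) (γ₀ c)) (unbits-bits (λ j → Y j (γ₀ c) c) (β₀ b)))

      killed : Fin K → Fin K → Fin n → Fin n → ℕ
      killed j k b c = bit (bad₀ j k) * (bit (X j k b) * bit (Y j k c))

      kill : Fin n → Fin n → ℕ
      kill b c = killed (β₀ b) (γ₀ c) b c

      -- Only alive pairs are bad, so what is newly killed is disjoint from what was dead before and
      -- the two counts add up.
      dead′≡ : ∀ b c → bit (not (alive′ (β′ b) (γ′ c))) ≡ dead₀ b c + kill b c
      dead′≡ b c = trans (cong (λ x → bit (not x)) (alive′≡ b c))
        (cases (alive₀ (β₀ b) (γ₀ c)) ⌊ sparse? (B (β₀ b)) (C (γ₀ c)) ⌋ (X (β₀ b) (γ₀ c) b) (Y (β₀ b) (γ₀ c) c))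
        where
        cases : ∀ a s x y → bit (not (a ∧ not ((a ∧ s) ∧ (x ∧ y)))) ≡ bit (not a) + bit (a ∧ s) * (bit x * bit y)
        cases false s     x     y     = refl
        cases true  false x     y     = refl
        cases true  true  false y     = refl
        cases true  true  true  false = refl
        cases true  true  true  true  = refl

      killArea killEdges : ℕ
      killArea  = ∑ (λ b → ∑ (kill b))
      killEdges = ∑ (λ b → ∑ (λ c → kill b c * bit (G b c)))

      killArea≡ : killArea ≡ ∑ (λ j → ∑ (λ k → bit (bad₀ j k) * (∣ B j ∩ X j k ∣ * ∣ C k ∩ Y j k ∣)))
      killArea≡ = trans (∑-fibers₂ β₀ γ₀ killed) (∑∑-cong (λ j k → sym (trans
        (cong (bit (bad₀ j k) *_) (∑-*-∑ (λ b → bit ((B j ∩ X j k) b)) (λ c → bit ((C k ∩ Y j k) c))))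
        (trans (*-∑∑ (bit (bad₀ j k)) (λ b c → bit ((B j ∩ X j k) b) * bit ((C k ∩ Y j k) c)))
          (∑∑-cong (λ b c → trans (cong₂ (λ x y → bit (bad₀ j k) * (x * y)) (bit-∧ (B j b) (X j k b)) (bit-∧ (C k c) (Y j k c)))
            (ring (bit (bad₀ j k)) (bit (B j b)) (bit (X j k b)) (bit (C k c)) (bit (Y j k c)))))))))
        where
        ring : ∀ d u x v y → d * ((u * x) * (v * y)) ≡ u * v * (d * (x * y))
        ring = solve-∀

      killEdges≡ : killEdges ≡ ∑ (λ j → ∑ (λ k → bit (bad₀ j k) * edges G (B j ∩ X j k) (C k ∩ Y j k)))
      killEdges≡ = trans (∑-fibers₂ β₀ γ₀ (λ j k b c → killed j k b c * bit (G b c))) (∑∑-cong (λ j k → sym (trans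
        (*-∑∑ (bit (bad₀ j k)) (λ b c → bit ((B j ∩ X j k) b) * bit ((C k ∩ Y j k) c) * bit (G b c)))
          (∑∑-cong (λ b c → trans (cong₂ (λ x y → bit (bad₀ j k) * (x * y * bit (G b c))) (bit-∧ (B j b) (X j k b)) (bit-∧ (C k c) (Y j k c)))
            (ring (bit (bad₀ j k)) (bit (B j b)) (bit (X j k b)) (bit (C k c)) (bit (Y j k c)) (bit (G b c))))))))
        where
        ring : ∀ d u x v y g → d * ((u * x) * (v * y) * g) ≡ u * v * (d * (x * y) * g)
        ring = solve-∀

      badArea≡ : badArea₀ ≡ ∑ (λ j → ∑ (λ k → bit (bad₀ j k) * (∣ B j ∣ * ∣ C k ∣)))
      badArea≡ = trans (∑-fibers₂ β₀ γ₀ (λ j k b c → bit (bad₀ j k))) (∑∑-cong (λ j k → sym (trans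
        (cong (bit (bad₀ j k) *_) (∑-*-∑ (λ b → bit (B j b)) (λ c → bit (C k c))))
        (trans (*-∑∑ (bit (bad₀ j k)) (λ b c → bit (B j b) * bit (C k c)))
          (∑∑-cong (λ b c → *-comm (bit (bad₀ j k)) (bit (B j b) * bit (C k c))))))))

      bad-sparse : ∀ j k → bad₀ j k ≡ true →
        SparseIn (B j) (C k) (proj₁ (pick (sparse? (B j) (C k)))) (proj₂ (pick (sparse? (B j) (C k))))
      bad-sparse j k eq with alive₀ j k
      ... | true = pick-sparse (sparse? (B j) (C k)) eq

      bit-mono : ∀ {x y} b → (b ≡ true → x ≤ y) → bit b * x ≤ bit b * y
      bit-mono true  le = *-monoʳ-≤ 1 (le refl)
      bit-mono false le = z≤n

      killEdges≤ : t * killEdges ≤ killArea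
      killEdges≤ = begin
        t * killEdges ≡⟨ trans (cong (t *_) killEdges≡) (*-∑∑ t (λ j k → bit (bad₀ j k) * edges G (B j ∩ X j k) (C k ∩ Y j k))) ⟩
        ∑ (λ j → ∑ (λ k → t * (bit (bad₀ j k) * edges G (B j ∩ X j k) (C k ∩ Y j k))))
          ≤⟨ ∑∑-mono (λ j k → subst (_≤ bit (bad₀ j k) * (∣ B j ∩ X j k ∣ * ∣ C k ∩ Y j k ∣))
               (ring t (bit (bad₀ j k)) (edges G (B j ∩ X j k) (C k ∩ Y j k)))
               (bit-mono (bad₀ j k) (λ eq → proj₂ (proj₂ (bad-sparse j k eq))))) ⟩
        ∑ (λ j → ∑ (λ k → bit (bad₀ j k) * (∣ B j ∩ X j k ∣ * ∣ C k ∩ Y j k ∣))) ≡⟨ killArea≡ ⟨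
        killArea ∎
        where
        open ≤-Reasoning
        ring : ∀ t d e → d * (t * e) ≡ t * (d * e)
        ring = solve-∀

      -- A chosen rectangle has a share of at least 1/t on either side, hence at least 1/t² of the
      -- area of its pair.
      badArea≤ : badArea₀ ≤ t * t * killArea
      badArea≤ = begin
        badArea₀ ≡⟨ badArea≡ ⟩
        ∑ (λ j → ∑ (λ k → bit (bad₀ j k) * (∣ B j ∣ * ∣ C k ∣)))
          ≤⟨ ∑∑-mono (λ j k → subst (bit (bad₀ j k) * (∣ B j ∣ * ∣ C k ∣) ≤_)
               (ring t (bit (bad₀ j k)) (∣ B j ∩ X j k ∣) (∣ C k ∩ Y j k ∣))
               (bit-mono (bad₀ j k) (λ eq → *-mono-≤ (proj₁ (bad-sparse j k eq)) (proj₁ (proj₂ (bad-sparse j k eq)))))) ⟩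
        ∑ (λ j → ∑ (λ k → t * t * (bit (bad₀ j k) * (∣ B j ∩ X j k ∣ * ∣ C k ∩ Y j k ∣))))
          ≡⟨ trans (cong (t * t *_) killArea≡) (*-∑∑ (t * t) (λ j k → bit (bad₀ j k) * (∣ B j ∩ X j k ∣ * ∣ C k ∩ Y j k ∣))) ⟨
        t * t * killArea ∎
        where
        open ≤-Reasoning
        ring : ∀ t d x y → d * ((t * x) * (t * y)) ≡ t * t * (d * (x * y))
        ring = solve-∀

      deadArea′≡ : ∑ (λ b → ∑ (λ c → bit (not (alive′ (β′ b) (γ′ c))))) ≡ deadArea₀ + killArea
      deadArea′≡ = trans (∑∑-cong dead′≡) (∑∑-+ dead₀ kill)

      refined : Cells (K * 2 ^ K)
      refined = record { β = β′ ; γ = γ′ ; alive = alive′ ; deadEdges≤ = begin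
        t * ∑ (λ b → ∑ (λ c → bit (not (alive′ (β′ b) (γ′ c))) * bit (G b c)))
          ≡⟨ cong (t *_) (trans (∑∑-cong (λ b c → trans (cong (_* bit (G b c)) (dead′≡ b c)) (*-distribʳ-+ (bit (G b c)) (dead₀ b c) (kill b c))))
               (∑∑-+ (λ b c → dead₀ b c * bit (G b c)) (λ b c → kill b c * bit (G b c)))) ⟩
        t * (∑ (λ b → ∑ (λ c → dead₀ b c * bit (G b c))) + killEdges)
          ≡⟨ *-distribˡ-+ t (∑ (λ b → ∑ (λ c → dead₀ b c * bit (G b c)))) killEdges ⟩
        t * ∑ (λ b → ∑ (λ c → dead₀ b c * bit (G b c))) + t * killEdges
          ≤⟨ +-mono-≤ deadEdges₀≤ killEdges≤ ⟩
        deadArea₀ + killArea ≡⟨ deadArea′≡ ⟨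
        ∑ (λ b → ∑ (λ c → bit (not (alive′ (β′ b) (γ′ c))))) ∎ }
        where open ≤-Reasoning

      refined-gain : t * t * deadArea₀ + badArea₀ ≤ t * t * deadArea refined
      refined-gain = begin
        t * t * deadArea₀ + badArea₀          ≤⟨ +-monoʳ-≤ (t * t * deadArea₀) badArea≤ ⟩
        t * t * deadArea₀ + t * t * killArea  ≡⟨ *-distribˡ-+ (t * t) deadArea₀ killArea ⟨
        t * t * (deadArea₀ + killArea)        ≡⟨ cong (t * t *_) deadArea′≡ ⟨
        t * t * deadArea refined              ∎
        where open ≤-Reasoning

    Regular : ℕ → Set
    Regular bound = ∃ λ K → K ≤ bound × ∃ λ (s : Cells K) → t * badArea s ≤ n * n

    -- Without regularity the bad area exceeds n²/t, and refining kills at least a share 1/t² of it.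
    -- The potential, t³ times the dead area, never exceeds t³ n², so the number of rounds is at
    -- most t³.
    potential-gain : ∀ {K} (s : Cells K) → ¬ (t * badArea s ≤ n * n) →
      t * t * t * deadArea s + n * n < t * t * t * deadArea (Refine.refined s)
    potential-gain s ¬reg = begin-strict
      t * t * t * deadArea s + n * n                <⟨ +-monoʳ-< (t * t * t * deadArea s) (≰⇒> ¬reg) ⟩
      t * t * t * deadArea s + t * badArea s        ≡⟨ ring t (deadArea s) (badArea s) ⟩
      t * (t * t * deadArea s + badArea s)          ≤⟨ *-monoʳ-≤ t (Refine.refined-gain s) ⟩
      t * (t * t * deadArea (Refine.refined s))     ≡⟨ ring′ t (deadArea (Refine.refined s)) ⟩
      t * t * t * deadArea (Refine.refined s)       ∎
      where
      open ≤-Reasoning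
      ring : ∀ t d b → t * t * t * d + t * b ≡ t * (t * t * d + b)
      ring = solve-∀
      ring′ : ∀ t d → t * (t * t * d) ≡ t * t * t * d
      ring′ = solve-∀

    -- Here `x` is the potential, `y` is n² and `z` the largest possible potential; as variables
    -- tied by equations they keep the arithmetic symbolic. The invariant says that `suc fuel`
    -- further rounds would overshoot `z`.
    iterate : ∀ fuel {K} (s : Cells K) x y z → x ≡ t * t * t * deadArea s → y ≡ n * n → z ≡ t * t * t * y →
      z < x + suc fuel * y → Regular (cellBound fuel K)
    continue : ∀ fuel {K} (s : Cells K) x y z → x ≡ t * t * t * deadArea s → y ≡ n * n → z ≡ t * t * t * y →
      z < x + suc fuel * y → Dec (t * badArea s ≤ n * n) → Regular (cellBound fuel K)
    iterate fuel s x y z x≡ y≡ z≡ enough = continue fuel s x y z x≡ y≡ z≡ enough (t * badArea s ≤? n * n)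
    continue zero    {K} s x y z x≡ y≡ z≡ enough (yes reg) = K , ≤-refl , s , reg
    continue (suc f) {K} s x y z x≡ y≡ z≡ enough (yes reg) = K , m≤m⊔n K (cellBound f (K * 2 ^ K)) , s , reg
    -- The fuel is spent, and one more refinement would lift the potential above its maximum.
    continue zero {K} s x y z x≡ y≡ z≡ enough (no ¬reg) = ⊥-elim (<⇒≱ (<-trans enough x+y<) dead≤)
      where
      x+y< : x + 1 * y < t * t * t * deadArea (Refine.refined s)
      x+y< = subst₂ (λ u v → u + v < t * t * t * deadArea (Refine.refined s)) (sym x≡)
        (sym (trans (*-identityˡ y) y≡)) (potential-gain s ¬reg)
      dead≤ : t * t * t * deadArea (Refine.refined s) ≤ z
      dead≤ = ≤-trans (*-monoʳ-≤ (t * t * t) (deadArea≤ (Refine.refined s))) (≤-reflexive (sym (trans z≡ (cong (t * t * t *_) y≡))))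
    continue (suc f) {K} s x y z x≡ y≡ z≡ enough (no ¬reg) = K′ , ≤-trans K′≤ (m≤n⊔m K (cellBound f (K * 2 ^ K))) , rest
      where
      x′ : ℕ
      x′ = t * t * t * deadArea (Refine.refined s)
      x+y< : x + y < x′
      x+y< = subst₂ (λ u v → u + v < x′) (sym x≡) (sym y≡) (potential-gain s ¬reg)
      further : Regular (cellBound f (K * 2 ^ K))
      further = iterate f (Refine.refined s) x′ y z refl y≡ z≡
        (<-trans (subst (z <_) (sym (+-assoc x y (suc f * y))) enough) (+-monoˡ-< (suc f * y) x+y<))
      K′ : ℕ
      K′ = proj₁ further
      K′≤ : K′ ≤ cellBound f (K * 2 ^ K)
      K′≤ = proj₁ (proj₂ further)
      rest : ∃ λ (s : Cells K′) → t * badArea s ≤ n * n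
      rest = proj₂ (proj₂ further)

    regularCells : 0 < n → Regular (cellBound (t * t * t) 1)
    regularCells 0<n = iterate (t * t * t) one-cell (t * t * t * deadArea one-cell) (n * n) (t * t * t * (n * n)) refl refl refl
      (≤-trans (+-monoˡ-≤ (t * t * t * (n * n)) (*-mono-≤ 0<n 0<n)) (m≤n+m (suc (t * t * t) * (n * n)) (t * t * t * deadArea one-cell)))

  -- Triangle removal for graphs with O(n²) triangles.

  ⌊⌋-bound : ∀ {P : Set} (d : Dec P) {x y} → (P → x ≤ y) → bit ⌊ d ⌋ * x ≤ y
  ⌊⌋-bound (yes p) {x} le = ≤-trans (≤-reflexive (*-identityˡ x)) (le p)
  ⌊⌋-bound (no _)  le = z≤n

  ⌊⌋-false : ∀ {P : Set} (d : Dec P) → ⌊ d ⌋ ≡ false → ¬ P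
  ⌊⌋-false (no ¬p) _ = ¬p

  lowDegree : ∀ {n K} t (β : Fin n → Fin K) (N : Fin n → Bool) (j : Fin K) → Dec (t * ∣ fiber β j ∩ N ∣ ≤ ∣ fiber β j ∣)
  lowDegree t β N j = t * ∣ fiber β j ∩ N ∣ ≤? ∣ fiber β j ∣

  -- `N` meets each low class in at most a share 1/t of that class, and the classes partition the n
  -- vertices.
  ∑-lowDegree : ∀ {n K} t (β : Fin n → Fin K) (N : Fin n → Bool) →
    t * ∑ (λ v → bit (N v) * bit ⌊ lowDegree t β N (β v) ⌋) ≤ n
  ∑-lowDegree {n} t β N = begin
    t * ∑ (λ v → bit (N v) * bit ⌊ lowDegree t β N (β v) ⌋)
      ≡⟨ cong (t *_) (∑-fibers β (λ j v → bit (N v) * bit ⌊ lowDegree t β N j ⌋)) ⟩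
    t * ∑ (λ j → ∑ (λ v → bit (fiber β j v) * (bit (N v) * bit ⌊ lowDegree t β N j ⌋)))
      ≡⟨ cong (t *_) (∑-cong (λ j → trans
           (∑-cong (λ v → trans (ring (bit (fiber β j v)) (bit (N v)) (bit ⌊ lowDegree t β N j ⌋))
             (cong (bit ⌊ lowDegree t β N j ⌋ *_) (sym (bit-∧ (fiber β j v) (N v))))))
           (sym (*-∑ (bit ⌊ lowDegree t β N j ⌋) (λ v → bit ((fiber β j ∩ N) v)))))) ⟩
    t * ∑ (λ j → bit ⌊ lowDegree t β N j ⌋ * ∣ fiber β j ∩ N ∣)
      ≡⟨ *-∑ t (λ j → bit ⌊ lowDegree t β N j ⌋ * ∣ fiber β j ∩ N ∣) ⟩
    ∑ (λ j → t * (bit ⌊ lowDegree t β N j ⌋ * ∣ fiber β j ∩ N ∣))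
      ≤⟨ ∑-mono (λ j → subst (_≤ ∣ fiber β j ∣) (ring′ (bit ⌊ lowDegree t β N j ⌋) t ∣ fiber β j ∩ N ∣)
           (⌊⌋-bound (lowDegree t β N j) (λ le → le))) ⟩
    ∑ (λ j → ∣ fiber β j ∣) ≡⟨ ∑-fiber-sizes β ⟩
    n ∎
    where
    open ≤-Reasoning
    ring : ∀ f g l → f * (g * l) ≡ l * (f * g)
    ring = solve-∀
    ring′ : ∀ l t x → l * (t * x) ≡ t * (l * x)
    ring′ = solve-∀

  smallClass : ∀ {n K} t (β : Fin n → Fin K) (j : Fin K) → Dec (t * (K * ∣ fiber β j ∣) ≤ n)
  smallClass {n} {K} t β j = t * (K * ∣ fiber β j ∣) ≤? n

  -- There are `K` classes, and a small one has at most n/(tK) members.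
  ∑-smallClass : ∀ {n K} .{{_ : NonZero K}} t (β : Fin n → Fin K) → t * ∑ (λ b → bit ⌊ smallClass t β (β b) ⌋) ≤ n
  ∑-smallClass {n} {K} t β = *-cancelˡ-≤ K (begin
    K * (t * ∑ (λ b → bit ⌊ smallClass t β (β b) ⌋))
      ≡⟨ cong (λ x → K * (t * x)) (trans (∑-fibers β (λ j b → bit ⌊ smallClass t β j ⌋))
           (∑-cong (λ j → sym (∑-* (bit ⌊ smallClass t β j ⌋) (λ b → bit (fiber β j b)))))) ⟩
    K * (t * ∑ (λ j → ∣ fiber β j ∣ * bit ⌊ smallClass t β j ⌋))
      ≡⟨ trans (sym (*-assoc K t _)) (*-∑ (K * t) (λ j → ∣ fiber β j ∣ * bit ⌊ smallClass t β j ⌋)) ⟩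
    ∑ (λ j → K * t * (∣ fiber β j ∣ * bit ⌊ smallClass t β j ⌋))
      ≤⟨ ∑-mono (λ j → subst (_≤ n) (ring K t ∣ fiber β j ∣ (bit ⌊ smallClass t β j ⌋)) (⌊⌋-bound (smallClass t β j) (λ le → le))) ⟩
    ∑ {K} (λ j → n) ≡⟨ ∑-const K n ⟩
    K * n ∎)
    where
    open ≤-Reasoning
    ring : ∀ K t x b → b * (t * (K * x)) ≡ K * t * (x * b)
    ring = solve-∀

  -- The closed walks a → b → c → a appear as edges from the out-neighbours to the in-neighbours of
  -- `a`, the form in which regularity counts them.
  triangles : ∀ {n} → (Fin n → Fin n → Bool) → Fin n → ℕ
  triangles G a = edges G (G a) (λ c → G c a)

  edges-mono : ∀ {n} (G : Fin n → Fin n → Bool) (U X V Y : Fin n → Bool) → edges G (U ∩ X) (V ∩ Y) ≤ edges G X Y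
  edges-mono G U X V Y = ∑∑-mono (λ b c → *-monoˡ-≤ (bit (G b c)) (*-mono-≤ (le (U b) (X b)) (le (V c) (Y c))))
    where
    le : ∀ u x → bit (u ∧ x) ≤ bit x
    le true  x = ≤-refl
    le false x = z≤n

  edges-cong : ∀ {n} (G : Fin n → Fin n → Bool) {X X′ Y Y′ : Fin n → Bool} → (∀ b → X b ≡ X′ b) → (∀ c → Y c ≡ Y′ c) →
    edges G X Y ≡ edges G X′ Y′
  edges-cong G X≡ Y≡ = ∑∑-cong (λ b c → cong₂ (λ x y → bit x * bit y * bit (G b c)) (X≡ b) (Y≡ c))

  size-cong : ∀ {n} {X Y : Fin n → Bool} → (∀ b → X b ≡ Y b) → ∣ X ∣ ≡ ∣ Y ∣
  size-cong X≡Y = ∑-cong (λ b → cong bit (X≡Y b))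

  -- A union bound. The factor `bit g` survives only in the terms that are later bounded by counting
  -- edges rather than all pairs: dead pairs and the two degree conditions.
  cleaning-bits : ∀ g h a b d e l m → bit (g ∧ (h ∨ (a ∨ (b ∨ (d ∨ (e ∨ (l ∨ m)))))))
    ≤ bit h + (bit a + (bit b + (bit d * bit g + (bit e + (bit g * bit l + bit g * bit m)))))
  cleaning-bits false h a b d e l m = z≤n
  cleaning-bits true  h a b d e l m =
    or h (or a (or b (≤-trans (or d (or e (≤-trans (bit-∨ l m)
      (≤-reflexive (cong₂ _+_ (sym (*-identityˡ (bit l))) (sym (*-identityˡ (bit m))))))))
      (≤-reflexive (cong (_+ (bit e + (1 * bit l + 1 * bit m))) (sym (*-identityʳ (bit d))))))))
    where
    or : ∀ x {y z} → bit y ≤ z → bit (x ∨ y) ≤ bit x + z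
    or x {y} y≤z = ≤-trans (bit-∨ x y) (+-monoʳ-≤ (bit x) y≤z)

  module Cleaning {n t : ℕ} (G : Fin n → Fin n → Bool) {K : ℕ} (s : Cells G t K) (Q : ℕ) where

    open Cells s

    heavy? : ∀ u → Dec (n * n ≤ Q * triangles G u)
    heavy? u = n * n ≤? Q * triangles G u

    -- In a triangle a → b → c → a the three arcs have different tasks. If ab stays, then `a` is
    -- light and has many out-neighbours in the class of b. If bc stays, then both classes are large
    -- and their pair has no sparse rectangle. If ca stays, then `a` has many in-neighbours in the
    -- class of c.
    removed : Fin n → Fin n → Bool
    removed u v = G u v ∧ (⌊ heavy? u ⌋ ∨ (⌊ smallClass t β (β u) ⌋ ∨ (⌊ smallClass t γ (γ v) ⌋
      ∨ (not (alive (β u) (γ v)) ∨ (bad (β u) (γ v)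
      ∨ (⌊ lowDegree t β (G u) (β v) ⌋ ∨ ⌊ lowDegree t γ (λ w → G w v) (γ u) ⌋))))))

    ∑-row : (f : Fin n → ℕ) → t * ∑ f ≤ n → t * ∑ (λ u → ∑ {n} (λ _ → f u)) ≤ n * n
    ∑-row f le = begin
      t * ∑ (λ u → ∑ {n} (λ _ → f u))  ≡⟨ cong (t *_) (trans (∑-cong (λ u → ∑-const n (f u))) (sym (*-∑ n f))) ⟩
      t * (n * ∑ f)                    ≡⟨ ring t n (∑ f) ⟩
      n * (t * ∑ f)                    ≤⟨ *-monoʳ-≤ n le ⟩
      n * n                            ∎
      where
      open ≤-Reasoning
      ring : ∀ t n x → t * (n * x) ≡ n * (t * x)
      ring = solve-∀

    ∑-rows : (f : Fin n → Fin n → ℕ) → (∀ u → t * ∑ (f u) ≤ n) → t * ∑ (λ u → ∑ (f u)) ≤ n * n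
    ∑-rows f le = begin
      t * ∑ (λ u → ∑ (f u))    ≡⟨ *-∑ t (λ u → ∑ (f u)) ⟩
      ∑ (λ u → t * ∑ (f u))    ≤⟨ ∑-mono le ⟩
      ∑ {n} (λ _ → n)          ≡⟨ ∑-const n n ⟩
      n * n                    ∎
      where open ≤-Reasoning

    -- Each of the seven reasons for removal accounts for at most n²/t arcs.
    removed-few : .{{_ : NonZero K}} → t * ∑ (λ u → bit ⌊ heavy? u ⌋) ≤ n → t * badArea ≤ n * n →
      t * ∑ (λ u → ∑ (λ v → bit (removed u v))) ≤ 7 * (n * n)
    removed-few heavy≤ badArea≤ = begin
      t * ∑ (λ u → ∑ (λ v → bit (removed u v)))
        ≤⟨ *-monoʳ-≤ t (∑∑-mono (λ u v → cleaning-bits (G u v) ⌊ heavy? u ⌋ ⌊ smallClass t β (β u) ⌋ ⌊ smallClass t γ (γ v) ⌋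
             (not (alive (β u) (γ v))) (bad (β u) (γ v)) ⌊ lowDegree t β (G u) (β v) ⌋ ⌊ lowDegree t γ (λ w → G w v) (γ u) ⌋)) ⟩
      t * ∑ (λ u → ∑ (λ v → f₁ u v + (f₂ u v + (f₃ u v + (f₄ u v + (f₅ u v + (f₆ u v + f₇ u v)))))))
        ≤⟨ plus f₁ _ le₁ (plus f₂ _ le₂ (plus f₃ _ le₃ (plus f₄ _ le₄ (plus f₅ _ badArea≤ (plus f₆ f₇ le₆ le₇))))) ⟩
      n * n + (n * n + (n * n + (n * n + (n * n + (n * n + n * n))))) ≡⟨ ring (n * n) ⟩
      7 * (n * n) ∎
      where
      open ≤-Reasoning
      f₁ f₂ f₃ f₄ f₅ f₆ f₇ : Fin n → Fin n → ℕ
      f₁ u v = bit ⌊ heavy? u ⌋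
      f₂ u v = bit ⌊ smallClass t β (β u) ⌋
      f₃ u v = bit ⌊ smallClass t γ (γ v) ⌋
      f₄ u v = dead u v * bit (G u v)
      f₅ u v = bit (bad (β u) (γ v))
      f₆ u v = bit (G u v) * bit ⌊ lowDegree t β (G u) (β v) ⌋
      f₇ u v = bit (G u v) * bit ⌊ lowDegree t γ (λ w → G w v) (γ u) ⌋
      plus : ∀ (f g : Fin n → Fin n → ℕ) {x y} → t * ∑ (λ u → ∑ (f u)) ≤ x → t * ∑ (λ u → ∑ (g u)) ≤ y →
        t * ∑ (λ u → ∑ (λ v → f u v + g u v)) ≤ x + y
      plus f g le le′ = ≤-trans (≤-reflexive (trans (cong (t *_) (∑∑-+ f g)) (*-distribˡ-+ t (∑ (λ u → ∑ (f u))) (∑ (λ u → ∑ (g u))))))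
        (+-mono-≤ le le′)
      swap : ∀ (f : Fin n → Fin n → ℕ) {x} → t * ∑ (λ v → ∑ (λ u → f u v)) ≤ x → t * ∑ (λ u → ∑ (λ v → f u v)) ≤ x
      swap f = subst (λ y → t * y ≤ _) (sym (∑-swap f))
      le₁ : t * ∑ (λ u → ∑ (f₁ u)) ≤ n * n
      le₁ = ∑-row (λ u → bit ⌊ heavy? u ⌋) heavy≤
      le₂ : t * ∑ (λ u → ∑ (f₂ u)) ≤ n * n
      le₂ = ∑-row (λ u → bit ⌊ smallClass t β (β u) ⌋) (∑-smallClass t β)
      le₃ : t * ∑ (λ u → ∑ (f₃ u)) ≤ n * n
      le₃ = swap f₃ (∑-row (λ v → bit ⌊ smallClass t γ (γ v) ⌋) (∑-smallClass t γ))
      le₄ : t * ∑ (λ u → ∑ (f₄ u)) ≤ n * n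
      le₄ = ≤-trans deadEdges≤ deadArea≤
      le₆ : t * ∑ (λ u → ∑ (f₆ u)) ≤ n * n
      le₆ = ∑-rows f₆ (λ u → ∑-lowDegree t β (G u))
      le₇ : t * ∑ (λ u → ∑ (f₇ u)) ≤ n * n
      le₇ = swap f₇ (∑-rows (λ v u → f₇ u v) (λ v → ∑-lowDegree t γ (λ w → G w v)))
      ring : ∀ x → x + (x + (x + (x + (x + (x + x))))) ≡ 7 * x
      ring = solve-∀

    ∨-false : ∀ x {y} → x ∨ y ≡ false → x ≡ false × y ≡ false
    ∨-false false eq = refl , eq

    survivor : ∀ {u v} → G u v ≡ true → removed u v ≡ false →
      ¬ (n * n ≤ Q * triangles G u) × ¬ (t * (K * ∣ fiber β (β u) ∣) ≤ n) × ¬ (t * (K * ∣ fiber γ (γ v) ∣) ≤ n)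
      × ¬ Sparse G t (fiber β (β u)) (fiber γ (γ v))
      × ¬ (t * ∣ fiber β (β v) ∩ G u ∣ ≤ ∣ fiber β (β v) ∣)
      × ¬ (t * ∣ fiber γ (γ u) ∩ (λ w → G w v) ∣ ≤ ∣ fiber γ (γ u) ∣)
    survivor {u} {v} uv kept with G u v
    survivor {u} {v} refl kept | true with ∨-false ⌊ heavy? u ⌋ kept
    ... | h , kept₁ with ∨-false ⌊ smallClass t β (β u) ⌋ kept₁
    ...   | a , kept₂ with ∨-false ⌊ smallClass t γ (γ v) ⌋ kept₂
    ...     | b , kept₃ with ∨-false (not (alive (β u) (γ v))) kept₃
    ...       | d , kept₄ with ∨-false (bad (β u) (γ v)) kept₄
    ...         | e , kept₅ with ∨-false ⌊ lowDegree t β (G u) (β v) ⌋ kept₅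
    ...           | l , m = ⌊⌋-false (heavy? u) h , ⌊⌋-false (smallClass t β (β u)) a , ⌊⌋-false (smallClass t γ (γ v)) b
      , ⌊⌋-false (sparse? G t (fiber β (β u)) (fiber γ (γ v))) (notBad (alive (β u) (γ v)) _ d e)
      , ⌊⌋-false (lowDegree t β (G u) (β v)) l , ⌊⌋-false (lowDegree t γ (λ w → G w v) (γ u)) m
      where
      notBad : ∀ x y → not x ≡ false → x ∧ y ≡ false → y ≡ false
      notBad true y _ eq = eq

    -- If the inequality failed, the two neighbourhoods of `a` would themselves form a sparse
    -- rectangle in `U` × `V`.
    dense-triangles : ∀ {a} U V → ¬ Sparse G t U V → ∣ U ∣ ≤ t * ∣ U ∩ G a ∣ → ∣ V ∣ ≤ t * ∣ V ∩ (λ w → G w a) ∣ →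
      ∣ U ∩ G a ∣ * ∣ V ∩ (λ w → G w a) ∣ ≤ t * triangles G a
    dense-triangles {a} U V ¬sp U≤ V≤ with ∣ U ∩ G a ∣ * ∣ V ∩ (λ w → G w a) ∣ ≤? t * triangles G a
    ... | yes le = le
    ... | no ¬le = ⊥-elim (¬sp (tabulate (G a) , tabulate (λ w → G w a)
      , subst (λ x → ∣ U ∣ ≤ t * x) (sym ∣X∣) U≤ , subst (λ x → ∣ V ∣ ≤ t * x) (sym ∣Y∣) V≤
      , ≤-trans (*-monoʳ-≤ t (≤-trans (≤-reflexive (edges-cong G X≡ Y≡)) (edges-mono G U (G a) V (λ w → G w a))))
        (≤-trans (<⇒≤ (≰⇒> ¬le)) (≤-reflexive (sym (cong₂ _*_ ∣X∣ ∣Y∣))))))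
      where
      X≡ : ∀ b → (U ∩ lookup (tabulate (G a))) b ≡ (U ∩ G a) b
      X≡ b = cong (U b ∧_) (lookup∘tabulate (G a) b)
      Y≡ : ∀ c → (V ∩ lookup (tabulate (λ w → G w a))) c ≡ (V ∩ (λ w → G w a)) c
      Y≡ c = cong (V c ∧_) (lookup∘tabulate (λ w → G w a) c)
      ∣X∣ : ∣ U ∩ lookup (tabulate (G a)) ∣ ≡ ∣ U ∩ G a ∣
      ∣X∣ = size-cong X≡
      ∣Y∣ : ∣ V ∩ lookup (tabulate (λ w → G w a)) ∣ ≡ ∣ V ∩ (λ w → G w a) ∣
      ∣Y∣ = size-cong Y≡

    -- Were all three arcs kept, the pair of classes of b and c would give `a` at least n²/Q
    -- triangles, so `a` would be heavy and ab removed. The lower bound on `Q` collects a factor tKt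
    -- for each side, from class size and degree, and a factor t from the density.
    removed-hits : (t * K * t) * (t * K * t) * t ≤ Q → ∀ {a b c} → G a b ≡ true → G b c ≡ true → G c a ≡ true →
      removed a b ≡ true ⊎ removed b c ≡ true ⊎ removed c a ≡ true
    removed-hits Q≥ {a} {b} {c} ab bc ca with removed a b in eq₁ | removed b c in eq₂ | removed c a in eq₃
    ... | true  | _     | _     = inj₁ refl
    ... | false | true  | _     = inj₂ (inj₁ refl)
    ... | false | false | true  = inj₂ (inj₂ refl)
    ... | false | false | false with survivor ab eq₁ | survivor bc eq₂ | survivor ca eq₃
    ...   | light , _ , _ , _ , highOut , _ | _ , bigU , bigV , ¬sp , _ , _ | _ , _ , _ , _ , _ , highIn =
      ⊥-elim (light (begin
        n * n                                       ≤⟨ *-mono-≤ (<⇒≤ (≰⇒> bigU)) (<⇒≤ (≰⇒> bigV)) ⟩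
        t * (K * u) * (t * (K * v))                 ≤⟨ *-mono-≤ (*-monoʳ-≤ t (*-monoʳ-≤ K U≤)) (*-monoʳ-≤ t (*-monoʳ-≤ K V≤)) ⟩
        t * (K * (t * x)) * (t * (K * (t * y)))     ≡⟨ ring t K x y ⟩
        (t * K * t) * (t * K * t) * (x * y)         ≤⟨ *-monoʳ-≤ ((t * K * t) * (t * K * t)) (dense-triangles (fiber β (β b)) (fiber γ (γ c)) ¬sp U≤ V≤) ⟩
        (t * K * t) * (t * K * t) * (t * triangles G a)  ≡⟨ *-assoc ((t * K * t) * (t * K * t)) t (triangles G a) ⟨
        (t * K * t) * (t * K * t) * t * triangles G a    ≤⟨ *-monoˡ-≤ (triangles G a) Q≥ ⟩
        Q * triangles G a                           ∎))
      where
      open ≤-Reasoning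
      u v x y : ℕ
      u = ∣ fiber β (β b) ∣
      v = ∣ fiber γ (γ c) ∣
      x = ∣ fiber β (β b) ∩ G a ∣
      y = ∣ fiber γ (γ c) ∩ (λ w → G w a) ∣
      U≤ : u ≤ t * x
      U≤ = <⇒≤ (≰⇒> highOut)
      V≤ : v ≤ t * y
      V≤ = <⇒≤ (≰⇒> highIn)
      ring : ∀ t K x y → t * (K * (t * x)) * (t * (K * (t * y))) ≡ (t * K * t) * (t * K * t) * (x * y)
      ring = solve-∀

    -- As there are only O(n²) triangles, the number of vertices on n²/Q of them is bounded
    -- independently of n.
    heavy-few : .{{_ : NonZero (n * n)}} → ∀ C → ∑ (triangles G) ≤ C * (n * n) → ∑ (λ u → bit ⌊ heavy? u ⌋) ≤ Q * C
    heavy-few C tri≤ = *-cancelʳ-≤ _ (Q * C) (n * n) (begin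
      ∑ (λ u → bit ⌊ heavy? u ⌋) * (n * n)      ≡⟨ ∑-* (n * n) (λ u → bit ⌊ heavy? u ⌋) ⟩
      ∑ (λ u → bit ⌊ heavy? u ⌋ * (n * n))      ≤⟨ ∑-mono (λ u → ⌊⌋-bound (heavy? u) (λ le → le)) ⟩
      ∑ (λ u → Q * triangles G u)               ≡⟨ *-∑ Q (triangles G) ⟨
      Q * ∑ (triangles G)                       ≤⟨ *-monoʳ-≤ Q tri≤ ⟩
      Q * (C * (n * n))                         ≡⟨ *-assoc Q C (n * n) ⟨
      Q * C * (n * n)                           ∎)
      where open ≤-Reasoning

  TriangleCover : ∀ {n} → (Fin n → Fin n → Bool) → ℕ → ℕ → Set
  TriangleCover {n} G t x = ∃ λ (R : Fin n → Fin n → Bool) → (∀ {u v} → R u v ≡ true → G u v ≡ true)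
    × t * ∑ (λ u → ∑ (λ v → bit (R u v))) ≤ x
    × (∀ {a b c} → G a b ≡ true → G b c ≡ true → G c a ≡ true → R a b ≡ true ⊎ R b c ≡ true ⊎ R c a ≡ true)

  abstract
    -- `Q` has to be fixed before the partition is known, hence it is computed from the bound `L` on
    -- the number of classes. The at most QC heavy vertices are a share 1/t of all vertices once n
    -- is at least tQC; the extra one makes n positive.
    triangle-removal : ∀ t C → ∃ λ n₀ → ∀ {n} → n₀ ≤ n → (G : Fin n → Fin n → Bool) →
      ∑ (triangles G) ≤ C * (n * n) → TriangleCover G t (7 * (n * n))
    triangle-removal t C = suc (t * (Q * C)) , cover
      where
      L Q : ℕ
      L = cellBound (t * t * t) 1
      Q = (t * L * t) * (t * L * t) * t
      cover : ∀ {n} → suc (t * (Q * C)) ≤ n → (G : Fin n → Fin n → Bool) →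
        ∑ (triangles G) ≤ C * (n * n) → TriangleCover G t (7 * (n * n))
      cover {suc m} n₀≤n G tri≤ = clean (regularCells G t z<s)
        where
        clean : Regular G t L → TriangleCover G t (7 * (suc m * suc m))
        -- The number of classes is nonzero because the first vertex has a class.
        clean (K , K≤L , s , regular) = removed , (λ {u} {v} → inside (G u v)) , removed-few {{nonZeroIndex (Cells.β s zero)}} few regular
          , removed-hits (*-monoˡ-≤ t (*-mono-≤ tKt≤ tKt≤))
          where
          open Cleaning G s Q
          inside : ∀ x {y} → x ∧ y ≡ true → x ≡ true
          inside true _ = refl
          tKt≤ : t * K * t ≤ t * L * t
          tKt≤ = *-monoˡ-≤ t (*-monoʳ-≤ t K≤L)
          few : t * ∑ (λ u → bit ⌊ heavy? u ⌋) ≤ suc m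
          few = ≤-trans (*-monoʳ-≤ t (heavy-few C tri≤)) (≤-trans (n≤1+n _) n₀≤n)

  -- Averaging over random labellings, with totals over all labellings in place of probabilities,
  -- and the rounding constant.

  module _ {m : ℕ} where

    total : ∀ {n} → (Vec (Fin m) n → ℕ) → ℕ
    total {zero}  f = f []
    total {suc n} f = ∑ (λ x → total (λ l → f (x ∷ l)))

    total-cong : ∀ {n} {f g : Vec (Fin m) n → ℕ} → (∀ l → f l ≡ g l) → total f ≡ total g
    total-cong {zero}  f≡g = f≡g []
    total-cong {suc n} f≡g = ∑-cong (λ x → total-cong (λ l → f≡g (x ∷ l)))

    total-∑ : ∀ {n k} (f : Fin k → Vec (Fin m) n → ℕ) → total (λ l → ∑ (λ i → f i l)) ≡ ∑ (λ i → total (f i))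
    total-∑ {zero}  f = refl
    total-∑ {suc n} f = trans (∑-cong (λ x → total-∑ (λ i l → f i (x ∷ l)))) (∑-swap (λ x i → total (λ l → f i (x ∷ l))))

    total-const : ∀ n c → total {n} (λ _ → c) ≡ m ^ n * c
    total-const zero    c = sym (*-identityˡ c)
    total-const (suc n) c = trans (∑-cong {m} (λ _ → total-const n c))
      (trans (∑-const m (m ^ n * c)) (sym (*-assoc m (m ^ n) c)))

    total-coordinate : ∀ {n} (u : Fin n) (g : Fin m → ℕ) → m * total {n} (λ l → g (lookup l u)) ≡ m ^ n * ∑ g
    total-coordinate {suc n} zero g = begin
      m * ∑ (λ x → total {n} (λ _ → g x))   ≡⟨ cong (m *_) (trans (∑-cong (λ x → total-const n (g x))) (sym (*-∑ (m ^ n) g))) ⟩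
      m * (m ^ n * ∑ g)                     ≡⟨ *-assoc m (m ^ n) (∑ g) ⟨
      m ^ suc n * ∑ g                       ∎
      where open ≡-Reasoning
    total-coordinate {suc n} (suc u) g = begin
      m * ∑ {m} (λ _ → total {n} (λ l → g (lookup l u)))   ≡⟨ cong (m *_) (∑-const m (total {n} (λ l → g (lookup l u)))) ⟩
      m * (m * total {n} (λ l → g (lookup l u)))           ≡⟨ cong (m *_) (total-coordinate u g) ⟩
      m * (m ^ n * ∑ g)                                    ≡⟨ *-assoc m (m ^ n) (∑ g) ⟨
      m ^ suc n * ∑ g                                      ∎
      where open ≡-Reasoning

    total-coordinates : ∀ {n} (u v : Fin n) → u ≢ v → (g : Fin m → Fin m → ℕ) →
      m * m * total {n} (λ l → g (lookup l u) (lookup l v)) ≡ m ^ n * ∑ (λ x → ∑ (g x))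
    total-coordinates zero zero u≢v g = ⊥-elim (u≢v refl)
    total-coordinates {suc n} zero (suc v) u≢v g = begin
      m * m * ∑ (λ x → total {n} (λ l → g x (lookup l v)))      ≡⟨ trans (*-assoc m m (∑ (λ x → total {n} (λ l → g x (lookup l v)))))
                                                                     (cong (m *_) (*-∑ m (λ x → total {n} (λ l → g x (lookup l v))))) ⟩
      m * ∑ (λ x → m * total {n} (λ l → g x (lookup l v)))      ≡⟨ cong (m *_) (∑-cong (λ x → total-coordinate v (g x))) ⟩
      m * ∑ (λ x → m ^ n * ∑ (g x))                             ≡⟨ cong (m *_) (*-∑ (m ^ n) (λ x → ∑ (g x))) ⟨
      m * (m ^ n * ∑ (λ x → ∑ (g x)))                           ≡⟨ *-assoc m (m ^ n) (∑ (λ x → ∑ (g x))) ⟨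
      m ^ suc n * ∑ (λ x → ∑ (g x))                             ∎
      where open ≡-Reasoning
    total-coordinates {suc n} (suc u) zero u≢v g =
      trans (total-coordinates {suc n} zero (suc u) (λ ()) (λ y x → g x y)) (cong (m ^ suc n *_) (∑-swap (λ y x → g x y)))
    total-coordinates {suc n} (suc u) (suc v) u≢v g = begin
      m * m * ∑ {m} (λ _ → total {n} (λ l → g (lookup l u) (lookup l v)))   ≡⟨ cong (m * m *_) (∑-const m (total {n} (λ l → g (lookup l u) (lookup l v)))) ⟩
      m * m * (m * total {n} (λ l → g (lookup l u) (lookup l v)))           ≡⟨ ring m (total {n} (λ l → g (lookup l u) (lookup l v))) ⟩
      m * (m * m * total {n} (λ l → g (lookup l u) (lookup l v)))           ≡⟨ cong (m *_) (total-coordinates u v (λ e → u≢v (cong suc e)) g) ⟩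
      m * (m ^ n * ∑ (λ x → ∑ (g x)))                                       ≡⟨ *-assoc m (m ^ n) (∑ (λ x → ∑ (g x))) ⟨
      m ^ suc n * ∑ (λ x → ∑ (g x))                                         ∎
      where
      open ≡-Reasoning
      ring : ∀ m t → m * m * (m * t) ≡ m * (m * m * t)
      ring = solve-∀

  -- The method of conditional expectations: the labels are fixed one at a time, each minimising the
  -- total over the remaining ones.
  ∃-≤-total : ∀ {m n} (f : Vec (Fin (suc m)) n → ℕ) → ∃ λ l → suc m ^ n * f l ≤ total f
  ∃-≤-total {m} {zero}  f = [] , ≤-reflexive (*-identityˡ (f []))
  ∃-≤-total {m} {suc n} f = x ∷ l , (begin
    suc m ^ suc n * f (x ∷ l)                     ≡⟨ *-assoc (suc m) (suc m ^ n) (f (x ∷ l)) ⟩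
    suc m * (suc m ^ n * f (x ∷ l))               ≤⟨ *-monoʳ-≤ (suc m) below ⟩
    suc m * g x                                   ≡⟨ ∑-const (suc m) (g x) ⟨
    ∑ {suc m} (λ _ → g x)                         ≤⟨ ∑-mono least ⟩
    ∑ g                                           ∎)
    where
    open ≤-Reasoning
    g : Fin (suc m) → ℕ
    g x = total (λ l → f (x ∷ l))
    x : Fin (suc m)
    x = proj₁ (argmin ≤-refl ≤-trans ≤-total g)
    least : ∀ y → g x ≤ g y
    least = proj₂ (argmin ≤-refl ≤-trans ≤-total g)
    l : Vec (Fin (suc m)) n
    l = proj₁ (∃-≤-total (λ l → f (x ∷ l)))
    below : suc m ^ n * f (x ∷ l) ≤ g x
    below = proj₂ (∃-≤-total (λ l → f (x ∷ l)))

  -- Labels of distinct vertices are independent and uniform, so each cost averages over M² pairs of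
  -- labels. On the diagonal the two labels coincide, hence the hypothesis that costs vanish there.
  ∃-labelling : ∀ M .{{_ : NonZero M}} {n} (c : Fin n → Fin n → Fin M → Fin M → ℕ) → (∀ u x y → c u u x y ≡ 0) →
    ∃ λ (l : Vec (Fin M) n) → M * M * ∑ (λ u → ∑ (λ v → c u v (lookup l u) (lookup l v)))
      ≤ ∑ (λ u → ∑ (λ v → ∑ (λ x → ∑ (c u v x))))
  ∃-labelling M@(suc _) {n} c diagonal = l , *-cancelˡ-≤ (M ^ n) {{m^n≢0 M n}} (begin
    M ^ n * (M * M * F l)       ≡⟨ ring (M ^ n) (M * M) (F l) ⟩
    M * M * (M ^ n * F l)       ≤⟨ *-monoʳ-≤ (M * M) below ⟩
    M * M * total F             ≡⟨ cong (M * M *_) (trans (total-∑ (λ u l → ∑ (λ v → c u v (lookup l u) (lookup l v))))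
                                     (∑-cong (λ u → total-∑ (λ v l → c u v (lookup l u) (lookup l v))))) ⟩
    M * M * ∑ (λ u → ∑ (λ v → total (λ l → c u v (lookup l u) (lookup l v))))
                                ≡⟨ *-∑∑ (M * M) (λ u v → total (λ l → c u v (lookup l u) (lookup l v))) ⟩
    ∑ (λ u → ∑ (λ v → M * M * total (λ l → c u v (lookup l u) (lookup l v))))
                                ≤⟨ ∑∑-mono each ⟩
    ∑ (λ u → ∑ (λ v → M ^ n * ∑ (λ x → ∑ (c u v x))))
                                ≡⟨ *-∑∑ (M ^ n) (λ u v → ∑ (λ x → ∑ (c u v x))) ⟨
    M ^ n * ∑ (λ u → ∑ (λ v → ∑ (λ x → ∑ (c u v x)))) ∎)
    where
    open ≤-Reasoning
    F : Vec (Fin M) n → ℕ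
    F l = ∑ (λ u → ∑ (λ v → c u v (lookup l u) (lookup l v)))
    l : Vec (Fin M) n
    l = proj₁ (∃-≤-total F)
    below : M ^ n * F l ≤ total F
    below = proj₂ (∃-≤-total F)
    ring : ∀ a b x → a * (b * x) ≡ b * (a * x)
    ring = solve-∀
    each : ∀ u v → M * M * total (λ l → c u v (lookup l u) (lookup l v)) ≤ M ^ n * ∑ (λ x → ∑ (c u v x))
    each u v with u ≟ᶠ v
    ... | no  u≢v  = ≤-reflexive (total-coordinates u v u≢v (c u v))
    ... | yes refl = ≤-trans (≤-reflexive (trans (cong (M * M *_)
        (trans (total-cong (λ l → diagonal u (lookup l u) (lookup l u))) (trans (total-const n 0) (*-zeroʳ (M ^ n)))))
        (*-zeroʳ (M * M)))) z≤n

  -- Weights are measured in units of 1/184 and the label x stands for the potential 6 x / 184. The numbers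
  -- are chosen such that 3 · 61 < 184 and that the best constant in cuts≤ is below 1.8 · 121 / 184.
  cut : ℕ → Fin 11 → Fin 11 → Bool
  cut ℓ x y = 61 + 6 * toℕ x ≤ᵇ ℓ + 6 * toℕ y

  cuts : ℕ → ℕ
  cuts ℓ = ∑ {11} (λ x → ∑ {11} (λ y → bit (cut ℓ x y)))

  -- Equality holds at ℓ = 79, where exactly the pairs with x - y at most 3 are cut, 121 - 28 = 93
  -- of them. At ℓ = 0 nothing may be cut, and nothing is, because the largest potential 6 · 10 is
  -- below 61.
  cuts≤ : ∀ ℓ → 79 * cuts ℓ ≤ 93 * ℓ
  -- 103 is the least level at which the trivial bound by all 121 pairs suffices; smaller levels are
  -- checked one by one.
  cuts≤ ℓ with ℓ <? 103
  ... | yes ℓ<103 = subst (λ k → 79 * cuts k ≤ 93 * k) (toℕ-fromℕ< ℓ<103) (small (fromℕ< ℓ<103))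
    where
    small : ∀ (i : Fin 103) → 79 * cuts (toℕ i) ≤ 93 * toℕ i
    small = from-yes (allFin? {103} (λ i → 79 * cuts (toℕ i) ≤? 93 * toℕ i))
  ... | no ℓ≮103 = begin
    79 * cuts ℓ   ≤⟨ *-monoʳ-≤ 79 (∑∑-mono {11} {11} (λ x y → bit≤1 (cut ℓ x y))) ⟩
    79 * 121      ≤⟨ from-yes (79 * 121 ≤? 93 * 103) ⟩
    93 * 103      ≤⟨ *-monoʳ-≤ 93 (≮⇒≥ ℓ≮103) ⟩
    93 * ℓ        ∎
    where open ≤-Reasoning

-- Rational arithmetic and expectations over a random subset.

module Expectation where

  open import Defs using (ℕ→ℚ)
  open import Data.Nat as ℕ using (ℕ; zero; suc)
  import Data.Nat.Properties as ℕₚ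
  open import Data.Integer as ℤ using (+_)
  import Data.Integer.Properties as ℤₚ
  open import Data.Rational
  open import Data.Rational.Properties
  import Data.Rational.Unnormalised as ℚᵘ
  import Data.Rational.Unnormalised.Properties as ℚᵘₚ
  open import Data.Fin using (toℕ)
  import Data.Fin.Properties as Finₚ
  open import Data.Vec.Properties using (lookup∘update; lookup∘update′; []≔-commutes)
  open import Algebra.Bundles using (CommutativeRing)
  open import Algebra.Properties.Semiring.Sum (CommutativeRing.semiring +-*-commutativeRing) using ()
    renaming (sum to ∑ℚ; ∑-distrib-+ to ∑ℚ-distrib-+; *-distribˡ-sum to ∑ℚ-distribˡ; sum-cong-≗ to ∑ℚ-cong) public
  open import Level using (0ℓ)
  open import Tactic.RingSolver using (solve-∀)
  open import Tactic.RingSolver.Core.AlmostCommutativeRing using (AlmostCommutativeRing; fromCommutativeRing)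

  ℚ-ring : AlmostCommutativeRing 0ℓ 0ℓ
  ℚ-ring = fromCommutativeRing +-*-commutativeRing (λ x → dec⇒maybe (0ℚ ≟ x))

  -- The pattern for inequalities over ℚ: the difference is exhibited as a visibly nonnegative
  -- expression, and the ring solver checks the identity.
  ≤-by-slack : ∀ {x y} s → 0ℚ ≤ s → y ≡ x + s → x ≤ y
  ≤-by-slack {x} s 0≤s refl = subst (_≤ x + s) (+-identityʳ x) (+-monoʳ-≤ x 0≤s)

  slack : ∀ {x y} → x ≤ y → 0ℚ ≤ y - x
  slack {x} {y} x≤y = subst (_≤ y - x) (+-inverseʳ x) (+-monoˡ-≤ (- x) x≤y)

  0≤+ : ∀ {x y} → 0ℚ ≤ x → 0ℚ ≤ y → 0ℚ ≤ x + y
  0≤+ = +-mono-≤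

  0≤* : ∀ {x y} → 0ℚ ≤ x → 0ℚ ≤ y → 0ℚ ≤ x * y
  0≤* {x} {y} 0≤x 0≤y =
    nonNegative⁻¹ (x * y) {{nonNeg*nonNeg⇒nonNeg x {{nonNegative 0≤x}} y {{nonNegative 0≤y}}}}

  *-monoˡ : ∀ {r x y} → 0ℚ ≤ r → x ≤ y → r * x ≤ r * y
  *-monoˡ {r} 0≤r = *-monoˡ-≤-nonNeg r {{nonNegative 0≤r}}

  *-mono-nonNeg : ∀ {a b x y} → 0ℚ ≤ a → a ≤ b → 0ℚ ≤ x → x ≤ y → a * x ≤ b * y
  *-mono-nonNeg {a} {b} {x} {y} 0≤a a≤b 0≤x x≤y =
    ≤-trans (*-monoʳ-≤-nonNeg x {{nonNegative 0≤x}} a≤b) (*-monoˡ (≤-trans 0≤a a≤b) x≤y)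

  0≤1 : 0ℚ ≤ 1ℚ
  0≤1 = nonNegative⁻¹ 1ℚ

  0≤square : ∀ x → 0ℚ ≤ x * x
  0≤square x with ≤-total 0ℚ x
  ... | inj₁ 0≤x = 0≤* 0≤x 0≤x
  ... | inj₂ x≤0 = subst (0ℚ ≤_) (neg² x) (0≤* 0≤-x 0≤-x)
    where
    neg² : ∀ y → (- y) * (- y) ≡ y * y
    neg² = solve-∀ ℚ-ring
    0≤-x : 0ℚ ≤ - x
    0≤-x = neg-antimono-≤ x≤0

  -- Abstract, so that the gcd in the normal form of a rational is never computed.
  abstract
    fromℕ : ℕ → ℚ
    fromℕ = ℕ→ℚ

    fromℕ≡ℕ→ℚ : ∀ n → fromℕ n ≡ ℕ→ℚ n
    fromℕ≡ℕ→ℚ n = refl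

    fromℕ-0 : fromℕ 0 ≡ 0ℚ
    fromℕ-0 = refl

    fromℕ-1 : fromℕ 1 ≡ 1ℚ
    fromℕ-1 = refl

    fromℕ-toℚᵘ : ∀ m → toℚᵘ (fromℕ m) ℚᵘ.≃ ℚᵘ.mkℚᵘ (+ m) 0
    fromℕ-toℚᵘ m = toℚᵘ-fromℚᵘ (ℚᵘ.mkℚᵘ (+ m) 0)

    fromℕ-+ : ∀ m n → fromℕ (m ℕ.+ n) ≡ fromℕ m + fromℕ n
    fromℕ-+ m n = toℚᵘ-injective (begin
      toℚᵘ (fromℕ (m ℕ.+ n))                       ≈⟨ fromℕ-toℚᵘ (m ℕ.+ n) ⟩
      ℚᵘ.mkℚᵘ (+ (m ℕ.+ n)) 0                    ≈⟨ ℚᵘ.*≡* (cong₂ ℤ._*_ (sym (cong₂ ℤ._+_ (ℤₚ.*-identityʳ (+ m)) (ℤₚ.*-identityʳ (+ n)))) refl) ⟩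
      ℚᵘ.mkℚᵘ (+ m) 0 ℚᵘ.+ ℚᵘ.mkℚᵘ (+ n) 0       ≈⟨ ℚᵘₚ.+-cong (fromℕ-toℚᵘ m) (fromℕ-toℚᵘ n) ⟨
      toℚᵘ (fromℕ m) ℚᵘ.+ toℚᵘ (fromℕ n)             ≈⟨ toℚᵘ-homo-+ (fromℕ m) (fromℕ n) ⟨
      toℚᵘ (fromℕ m + fromℕ n)                       ∎)
      where open import Relation.Binary.Reasoning.Setoid ℚᵘₚ.≃-setoid

    fromℕ-* : ∀ m n → fromℕ (m ℕ.* n) ≡ fromℕ m * fromℕ n
    fromℕ-* m n = toℚᵘ-injective (begin
      toℚᵘ (fromℕ (m ℕ.* n))                       ≈⟨ fromℕ-toℚᵘ (m ℕ.* n) ⟩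
      ℚᵘ.mkℚᵘ (+ (m ℕ.* n)) 0                    ≈⟨ ℚᵘ.*≡* (cong₂ ℤ._*_ (ℤₚ.pos-* m n) refl) ⟩
      ℚᵘ.mkℚᵘ (+ m) 0 ℚᵘ.* ℚᵘ.mkℚᵘ (+ n) 0       ≈⟨ ℚᵘₚ.*-cong (fromℕ-toℚᵘ m) (fromℕ-toℚᵘ n) ⟨
      toℚᵘ (fromℕ m) ℚᵘ.* toℚᵘ (fromℕ n)             ≈⟨ toℚᵘ-homo-* (fromℕ m) (fromℕ n) ⟨
      toℚᵘ (fromℕ m * fromℕ n)                       ∎)
      where open import Relation.Binary.Reasoning.Setoid ℚᵘₚ.≃-setoid

    fromℕ-mono : ∀ {m n} → m ℕ.≤ n → fromℕ m ≤ fromℕ n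
    fromℕ-mono {m} {n} m≤n = toℚᵘ-cancel-≤
      (ℚᵘₚ.≤-trans (ℚᵘₚ.≤-reflexive (fromℕ-toℚᵘ m))
      (ℚᵘₚ.≤-trans (ℚᵘ.*≤* (ℤₚ.*-monoʳ-≤-nonNeg (+ 1) (ℤ.+≤+ m≤n)))
                   (ℚᵘₚ.≤-reflexive (ℚᵘₚ.≃-sym (fromℕ-toℚᵘ n)))))

    fromℕ-cancel : ∀ {m n} → fromℕ m ≤ fromℕ n → m ℕ.≤ n
    fromℕ-cancel {m} {n} le with ℚᵘₚ.≤-trans (ℚᵘₚ.≤-reflexive (ℚᵘₚ.≃-sym (fromℕ-toℚᵘ m)))
      (ℚᵘₚ.≤-trans (toℚᵘ-mono-≤ le) (ℚᵘₚ.≤-reflexive (fromℕ-toℚᵘ n)))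
    ... | ℚᵘ.*≤* h = ℤₚ.drop‿+≤+ (subst₂ ℤ._≤_ (ℤₚ.*-identityʳ (+ m)) (ℤₚ.*-identityʳ (+ n)) h)

  fromℕ-suc : ∀ n → fromℕ (suc n) ≡ 1ℚ + fromℕ n
  fromℕ-suc n = trans (fromℕ-+ 1 n) (cong (λ x → x + fromℕ n) fromℕ-1)

  0≤fromℕ : ∀ n → 0ℚ ≤ fromℕ n
  0≤fromℕ n = subst (_≤ fromℕ n) fromℕ-0 (fromℕ-mono {0} {n} ℕ.z≤n)

  ∑ℚ-mono : ∀ {n} {f g : Fin n → ℚ} → (∀ i → f i ≤ g i) → ∑ℚ f ≤ ∑ℚ g
  ∑ℚ-mono {zero}  f≤g = ≤-refl
  ∑ℚ-mono {suc n} f≤g = +-mono-≤ (f≤g zero) (∑ℚ-mono (λ i → f≤g (suc i)))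

  ∑ℚ-const : ∀ n x → ∑ℚ {n} (λ _ → x) ≡ fromℕ n * x
  ∑ℚ-const zero    x = sym (trans (cong (_* x) fromℕ-0) (*-zeroˡ x))
  ∑ℚ-const (suc n) x = begin
    x + ∑ℚ {n} (λ _ → x)    ≡⟨ cong (λ y → x + y) (∑ℚ-const n x) ⟩
    x + fromℕ n * x           ≡⟨ ring x (fromℕ n) ⟩
    (1ℚ + fromℕ n) * x        ≡⟨ cong (_* x) (fromℕ-suc n) ⟨
    fromℕ (suc n) * x         ∎
    where
    open ≡-Reasoning
    ring : ∀ x y → x + y * x ≡ (1ℚ + y) * x
    ring = solve-∀ ℚ-ring

  -- The product Bernoulli measure, by conditioning on the first coordinate. It is a polynomial in
  -- p, so its identities hold for all rational p and only inequalities ask for p in [0, 1].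
  E : ∀ {N} → ℚ → (Vec Bool N → ℚ) → ℚ
  E {zero}  p f = f []
  E {suc N} p f = p * E p (λ S → f (true ∷ S)) + (1ℚ - p) * E p (λ S → f (false ∷ S))

  E-cong : ∀ {N} p {f g : Vec Bool N → ℚ} → (∀ S → f S ≡ g S) → E p f ≡ E p g
  E-cong {zero}  p f≗g = f≗g []
  E-cong {suc N} p f≗g = cong₂ (λ x y → p * x + (1ℚ - p) * y)
    (E-cong p (λ S → f≗g (true ∷ S))) (E-cong p (λ S → f≗g (false ∷ S)))

  E-mono : ∀ {N p} → 0ℚ ≤ p → p ≤ 1ℚ → {f g : Vec Bool N → ℚ} → (∀ S → f S ≤ g S) → E p f ≤ E p g
  E-mono {zero}  0≤p p≤1 f≤g = f≤g []
  E-mono {suc N} 0≤p p≤1 f≤g = +-mono-≤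
    (*-monoˡ 0≤p (E-mono 0≤p p≤1 (λ S → f≤g (true ∷ S))))
    (*-monoˡ (slack p≤1) (E-mono 0≤p p≤1 (λ S → f≤g (false ∷ S))))

  E-linear : ∀ {N} p a b (f g : Vec Bool N → ℚ) →
    E p (λ S → a * f S + b * g S) ≡ a * E p f + b * E p g
  E-linear {zero}  p a b f g = refl
  E-linear {suc N} p a b f g = trans
    (cong₂ (λ x y → p * x + (1ℚ - p) * y) (E-linear p a b (λ S → f (true ∷ S)) (λ S → g (true ∷ S))) (E-linear p a b (λ S → f (false ∷ S)) (λ S → g (false ∷ S))))
    (ring p a b (E p (λ S → f (true ∷ S))) (E p (λ S → g (true ∷ S))) (E p (λ S → f (false ∷ S))) (E p (λ S → g (false ∷ S))))
    where
    ring : ∀ p a b x y z w → p * (a * x + b * y) + (1ℚ - p) * (a * z + b * w)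
      ≡ a * (p * x + (1ℚ - p) * z) + b * (p * y + (1ℚ - p) * w)
    ring = solve-∀ ℚ-ring

  E-const : ∀ {N} p x → E {N} p (λ _ → x) ≡ x
  E-const {zero}  p x = refl
  E-const {suc N} p x = trans (cong₂ (λ y z → p * y + (1ℚ - p) * z) (E-const {N} p x) (E-const {N} p x)) (ring p x)
    where
    ring : ∀ p x → p * x + (1ℚ - p) * x ≡ x
    ring = solve-∀ ℚ-ring

  E-scale : ∀ {N} p a (f : Vec Bool N → ℚ) → E p (λ S → a * f S) ≡ a * E p f
  E-scale p a f = trans (E-cong p (λ S → sym (ring a (f S)))) (trans (E-linear p a 0ℚ f f) (ring a (E p f)))
    where
    ring : ∀ a x → a * x + 0ℚ * x ≡ a * x
    ring = solve-∀ ℚ-ring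

  E-+ : ∀ {N} p (f g : Vec Bool N → ℚ) → E p (λ S → f S + g S) ≡ E p f + E p g
  E-+ p f g = trans (E-cong p (λ S → sym (ring (f S) (g S)))) (trans (E-linear p 1ℚ 1ℚ f g) (ring (E p f) (E p g)))
    where
    ring : ∀ x y → 1ℚ * x + 1ℚ * y ≡ x + y
    ring = solve-∀ ℚ-ring

  E-minus : ∀ {N} p (f g : Vec Bool N → ℚ) → E p (λ S → f S - g S) ≡ E p f - E p g
  E-minus p f g = trans (E-cong p (λ S → sym (ring (f S) (g S)))) (trans (E-linear p 1ℚ (- 1ℚ) f g) (ring (E p f) (E p g)))
    where
    ring : ∀ x y → 1ℚ * x + (- 1ℚ) * y ≡ x - y
    ring = solve-∀ ℚ-ring

  E-nonNeg : ∀ {N p} → 0ℚ ≤ p → p ≤ 1ℚ → {f : Vec Bool N → ℚ} → (∀ S → 0ℚ ≤ f S) → 0ℚ ≤ E p f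
  E-nonNeg {N} {p} 0≤p p≤1 {f} 0≤f = subst (_≤ E p f) (E-const {N} p 0ℚ) (E-mono 0≤p p≤1 0≤f)

  E-≤ : ∀ {N p} → 0ℚ ≤ p → p ≤ 1ℚ → {f : Vec Bool N → ℚ} {x : ℚ} → (∀ S → f S ≤ x) → E p f ≤ x
  E-≤ {N} {p} 0≤p p≤1 {f} {x} f≤x = subst (E p f ≤_) (E-const {N} p x) (E-mono 0≤p p≤1 f≤x)

  -- Discrete derivatives and Russo's formula with an explicit error.

  ∂ : ∀ {N} → Fin N → (Vec Bool N → ℚ) → Vec Bool N → ℚ
  ∂ v f S = f (S [ v ]≔ true) - f (S [ v ]≔ false)

  E-resample : ∀ {N} p (v : Fin N) (f : Vec Bool N → ℚ) →
    E p f ≡ p * E p (λ S → f (S [ v ]≔ true)) + (1ℚ - p) * E p (λ S → f (S [ v ]≔ false))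
  E-resample p zero f = ring p _ _
    where
    ring : ∀ p x y → p * x + (1ℚ - p) * y
      ≡ p * (p * x + (1ℚ - p) * x) + (1ℚ - p) * (p * y + (1ℚ - p) * y)
    ring = solve-∀ ℚ-ring
  E-resample p (suc v) f = trans
    (cong₂ (λ x y → p * x + (1ℚ - p) * y) (E-resample p v _) (E-resample p v _))
    (ring p _ _ _ _)
    where
    ring : ∀ p x y z w → p * (p * x + (1ℚ - p) * y) + (1ℚ - p) * (p * z + (1ℚ - p) * w)
      ≡ p * (p * x + (1ℚ - p) * z) + (1ℚ - p) * (p * y + (1ℚ - p) * w)
    ring = solve-∀ ℚ-ring

  -- A first-order Taylor bound in p. Conditioning on the first coordinate produces the cross term
  -- h² (D - F) of the two halves, which is at least -h² N since derivatives lie in [0, 1]. The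
  -- growth of N² to (N + 1)² leaves room for h² (2N + 1).
  E-increment : ∀ {N p h} → 0ℚ ≤ p → p ≤ 1ℚ → 0ℚ ≤ h → p + h ≤ 1ℚ → (f : Vec Bool N → ℚ) →
    (∀ v S → 0ℚ ≤ ∂ v f S) → (∀ v S → ∂ v f S ≤ 1ℚ) →
    E p f + h * ∑ℚ (λ v → E p (∂ v f)) - h * h * (fromℕ N * fromℕ N) ≤ E (p + h) f
  E-increment {zero} {p} {h} _ _ _ _ f _ _ = ≤-reflexive (trans (cong (λ x → f [] + h * 0ℚ - h * h * (x * x)) fromℕ-0) (ring (f []) h))
    where
    ring : ∀ x h → x + h * 0ℚ - h * h * (0ℚ * 0ℚ) ≡ x
    ring = solve-∀ ℚ-ring
  E-increment {suc N} {p} {h} 0≤p p≤1 0≤h p+h≤1 f 0≤∂ ∂≤1 = ≤-trans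
    (≤-by-slack _ 0≤gap (trans (ring p h A B D F M) (cong₂ (λ x y → x - h * h * (y * y) + gap) expand (sym (fromℕ-suc N)))))
    (+-mono-≤ (*-monoˡ (0≤+ 0≤p 0≤h) IH₁) (*-monoˡ (slack p+h≤1) IH₀))
    where
    f₁ f₀ : Vec Bool N → ℚ
    f₁ S = f (true ∷ S)
    f₀ S = f (false ∷ S)
    A B D F M : ℚ
    A = E p f₁
    B = E p f₀
    D = ∑ℚ (λ v → E p (∂ v f₁))
    F = ∑ℚ (λ v → E p (∂ v f₀))
    M = fromℕ N
    IH₁ : A + h * D - h * h * (M * M) ≤ E (p + h) f₁
    IH₁ = E-increment 0≤p p≤1 0≤h p+h≤1 f₁ (λ v S → 0≤∂ (suc v) (true ∷ S)) (λ v S → ∂≤1 (suc v) (true ∷ S))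
    IH₀ : B + h * F - h * h * (M * M) ≤ E (p + h) f₀
    IH₀ = E-increment 0≤p p≤1 0≤h p+h≤1 f₀ (λ v S → 0≤∂ (suc v) (false ∷ S)) (λ v S → ∂≤1 (suc v) (false ∷ S))
    gap : ℚ
    gap = h * h * (D + (M - F)) + h * h * (M + 1ℚ)
    0≤D : 0ℚ ≤ D
    0≤D = subst (_≤ D) (trans (∑ℚ-const N 0ℚ) (*-zeroʳ M))
      (∑ℚ-mono (λ v → E-nonNeg 0≤p p≤1 (λ S → 0≤∂ (suc v) (true ∷ S))))
    F≤M : F ≤ M
    F≤M = subst (F ≤_) (trans (∑ℚ-const N 1ℚ) (*-identityʳ M))
      (∑ℚ-mono (λ v → E-≤ 0≤p p≤1 (λ S → ∂≤1 (suc v) (false ∷ S))))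
    0≤gap : 0ℚ ≤ gap
    0≤gap = 0≤+ (0≤* (0≤square h) (0≤+ 0≤D (slack F≤M))) (0≤* (0≤square h) (0≤+ (0≤fromℕ N) 0≤1))
    ring : ∀ p h A B D F M →
      (p + h) * (A + h * D - h * h * (M * M)) + (1ℚ - (p + h)) * (B + h * F - h * h * (M * M))
      ≡ ((p * A + (1ℚ - p) * B) + h * ((A - B) + (p * D + (1ℚ - p) * F)))
        - h * h * ((1ℚ + M) * (1ℚ + M)) + (h * h * (D + (M - F)) + h * h * (M + 1ℚ))
    ring = solve-∀ ℚ-ring
    ringc : ∀ p x → p * x + (1ℚ - p) * x ≡ x
    ringc = solve-∀ ℚ-ring
    expand : (p * A + (1ℚ - p) * B) + h * ((A - B) + (p * D + (1ℚ - p) * F))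
           ≡ E p f + h * ∑ℚ (λ v → E p (∂ v f))
    expand = cong (λ x → (p * A + (1ℚ - p) * B) + h * x) (cong₂ _+_
      (sym (trans (ringc p _) (E-minus p f₁ f₀)))
      (sym (trans (∑ℚ-distrib-+ (λ v → p * E p (∂ v f₁)) (λ v → (1ℚ - p) * E p (∂ v f₀)))
        (cong₂ _+_ (sym (∑ℚ-distribˡ p (λ v → E p (∂ v f₁)))) (sym (∑ℚ-distribˡ (1ℚ - p) (λ v → E p (∂ v f₀))))))))

  -- Forcing two coordinates, orthogonality and Bessel's inequality.

  π : ℚ → Bool → ℚ
  π p true  = p
  π p false = 1ℚ - p

  𝟙ᵇ : Bool → Bool → ℚ
  𝟙ᵇ true  true  = 1ℚ
  𝟙ᵇ false false = 1ℚ
  𝟙ᵇ true  false = 0ℚ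
  𝟙ᵇ false true  = 0ℚ

  E-resample₂ : ∀ {N} p (i j : Fin N) (f : Vec Bool N → ℚ) → E p f ≡
      p * (p * E p (λ S → f ((S [ j ]≔ true) [ i ]≔ true)) + (1ℚ - p) * E p (λ S → f ((S [ j ]≔ false) [ i ]≔ true)))
    + (1ℚ - p) * (p * E p (λ S → f ((S [ j ]≔ true) [ i ]≔ false)) + (1ℚ - p) * E p (λ S → f ((S [ j ]≔ false) [ i ]≔ false)))
  E-resample₂ p i j f = trans (E-resample p i f)
    (cong₂ (λ x y → p * x + (1ℚ - p) * y) (E-resample p j _) (E-resample p j _))

  pattern-of : ∀ {N} → Bool → Bool → Fin N → Fin N → Vec Bool N → ℚ
  pattern-of σ τ i j S = 𝟙ᵇ σ (lookup S i) * 𝟙ᵇ τ (lookup S j)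

  lookup₂ : ∀ {N} (i j : Fin N) → i ≢ j → ∀ b c (S : Vec Bool N) (F : Bool → Bool → ℚ) →
    F (lookup ((S [ j ]≔ c) [ i ]≔ b) i) (lookup ((S [ j ]≔ c) [ i ]≔ b) j) ≡ F b c
  lookup₂ i j i≢j b c S F = cong₂ F (lookup∘update i (S [ j ]≔ c) b)
    (trans (lookup∘update′ (λ e → i≢j (sym e)) (S [ j ]≔ c) b) (lookup∘update j S c))

  E-pattern : ∀ {N} p σ τ (i j : Fin N) → i ≢ j → (f : Vec Bool N → ℚ) →
    E p (λ S → pattern-of σ τ i j S * f S) ≡ π p σ * π p τ * E p (λ S → f ((S [ j ]≔ τ) [ i ]≔ σ))
  E-pattern {N} p σ τ i j i≢j f = trans (E-resample₂ p i j _)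
    (trans (cong₂ (λ x y → p * x + (1ℚ - p) * y)
             (cong₂ (λ x y → p * x + (1ℚ - p) * y) (at true true) (at true false))
             (cong₂ (λ x y → p * x + (1ℚ - p) * y) (at false true) (at false false)))
           (collapse σ τ))
    where
    Ef : Bool → Bool → ℚ
    Ef b c = E p (λ S → f ((S [ j ]≔ c) [ i ]≔ b))
    at : ∀ b c → E p (λ S → pattern-of σ τ i j ((S [ j ]≔ c) [ i ]≔ b) * f ((S [ j ]≔ c) [ i ]≔ b))
       ≡ 𝟙ᵇ σ b * 𝟙ᵇ τ c * Ef b c
    at b c = trans (E-cong p (λ S → cong (_* f ((S [ j ]≔ c) [ i ]≔ b)) (lookup₂ i j i≢j b c S (λ x y → 𝟙ᵇ σ x * 𝟙ᵇ τ y))))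
      (E-scale p (𝟙ᵇ σ b * 𝟙ᵇ τ c) (λ S → f ((S [ j ]≔ c) [ i ]≔ b)))
    ring₁ : ∀ p x y z w → p * (p * (1ℚ * 1ℚ * x) + (1ℚ - p) * (1ℚ * 0ℚ * y)) + (1ℚ - p) * (p * (0ℚ * 1ℚ * z) + (1ℚ - p) * (0ℚ * 0ℚ * w)) ≡ p * p * x
    ring₁ = solve-∀ ℚ-ring
    ring₂ : ∀ p x y z w → p * (p * (1ℚ * 0ℚ * x) + (1ℚ - p) * (1ℚ * 1ℚ * y)) + (1ℚ - p) * (p * (0ℚ * 0ℚ * z) + (1ℚ - p) * (0ℚ * 1ℚ * w)) ≡ p * (1ℚ - p) * y
    ring₂ = solve-∀ ℚ-ring
    ring₃ : ∀ p x y z w → p * (p * (0ℚ * 1ℚ * x) + (1ℚ - p) * (0ℚ * 0ℚ * y)) + (1ℚ - p) * (p * (1ℚ * 1ℚ * z) + (1ℚ - p) * (1ℚ * 0ℚ * w)) ≡ (1ℚ - p) * p * z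
    ring₃ = solve-∀ ℚ-ring
    ring₄ : ∀ p x y z w → p * (p * (0ℚ * 0ℚ * x) + (1ℚ - p) * (0ℚ * 1ℚ * y)) + (1ℚ - p) * (p * (1ℚ * 0ℚ * z) + (1ℚ - p) * (1ℚ * 1ℚ * w)) ≡ (1ℚ - p) * (1ℚ - p) * w
    ring₄ = solve-∀ ℚ-ring
    collapse : ∀ σ τ → p * (p * (𝟙ᵇ σ true * 𝟙ᵇ τ true * Ef true true) + (1ℚ - p) * (𝟙ᵇ σ true * 𝟙ᵇ τ false * Ef true false))
      + (1ℚ - p) * (p * (𝟙ᵇ σ false * 𝟙ᵇ τ true * Ef false true) + (1ℚ - p) * (𝟙ᵇ σ false * 𝟙ᵇ τ false * Ef false false))
      ≡ π p σ * π p τ * Ef σ τ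
    collapse true true = ring₁ p (Ef true true) (Ef true false) (Ef false true) (Ef false false)
    collapse true false = ring₂ p (Ef true true) (Ef true false) (Ef false true) (Ef false false)
    collapse false true = ring₃ p (Ef true true) (Ef true false) (Ef false true) (Ef false false)
    collapse false false = ring₄ p (Ef true true) (Ef true false) (Ef false true) (Ef false false)

  deviation : ∀ {N} → ℚ → Bool → Bool → Fin N × Fin N → Vec Bool N → ℚ
  deviation p σ τ (i , j) S = pattern-of σ τ i j S - π p σ * π p τ

  -- The inner product with the centred indicator is the probability of the event times the change
  -- that forcing makes to the mean of `f`. Noticeable changes thereby become large inner products,
  -- which Bessel's inequality can count.
  E-deviation : ∀ {N} p σ τ (i j : Fin N) → i ≢ j → (f : Vec Bool N → ℚ) →
    E p (λ S → f S * deviation p σ τ (i , j) S)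
    ≡ π p σ * π p τ * E p (λ S → f ((S [ j ]≔ τ) [ i ]≔ σ)) - π p σ * π p τ * E p f
  E-deviation p σ τ i j i≢j f = begin
    E p (λ S → f S * deviation p σ τ (i , j) S)             ≡⟨ E-cong p (λ S → ring (f S) (pattern-of σ τ i j S) P) ⟩
    E p (λ S → pattern-of σ τ i j S * f S - P * f S)        ≡⟨ E-minus p (λ S → pattern-of σ τ i j S * f S) (λ S → P * f S) ⟩
    E p (λ S → pattern-of σ τ i j S * f S) - E p (λ S → P * f S)
      ≡⟨ cong₂ _-_ (E-pattern p σ τ i j i≢j f) (E-scale p P f) ⟩
    P * E p (λ S → f ((S [ j ]≔ τ) [ i ]≔ σ)) - P * E p f   ∎
    where
    open ≡-Reasoning
    P : ℚ
    P = π p σ * π p τ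
    ring : ∀ x y z → x * (y - z) ≡ y * x - z * x
    ring = solve-∀ ℚ-ring

  Ignores : ∀ {N} → (Vec Bool N → ℚ) → Fin N → Set
  Ignores f v = ∀ b S → f (S [ v ]≔ b) ≡ f S

  -- A function that ignores both coordinates is independent of the event; this is the orthogonality
  -- of disjoint pairs.
  E-deviation-ignored : ∀ {N} p σ τ (i j : Fin N) → i ≢ j → (f : Vec Bool N → ℚ) →
    Ignores f i → Ignores f j → E p (λ S → f S * deviation p σ τ (i , j) S) ≡ 0ℚ
  E-deviation-ignored p σ τ i j i≢j f fi fj = trans (E-deviation p σ τ i j i≢j f)
    (trans (cong (λ x → π p σ * π p τ * x - π p σ * π p τ * E p f)
      (E-cong p (λ S → trans (fi σ (S [ j ]≔ τ)) (fj τ S)))) (+-inverseʳ (π p σ * π p τ * E p f)))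

  totalDeviation : ∀ {N} → ℚ → Bool → Bool → List (Fin N × Fin N) → Vec Bool N → ℚ
  totalDeviation p σ τ []       S = 0ℚ
  totalDeviation p σ τ (e ∷ es) S = deviation p σ τ e S + totalDeviation p σ τ es S

  Avoids : ∀ {N} → Fin N → Fin N × Fin N → Set
  Avoids v (i , j) = v ≢ i × v ≢ j

  Disjoint : ∀ {N} → Fin N × Fin N → Fin N × Fin N → Set
  Disjoint (i , j) e = Avoids i e × Avoids j e

  Proper : ∀ {N} → Fin N × Fin N → Set
  Proper (i , j) = i ≢ j

  totalDeviation-ignores : ∀ {N} p σ τ (v : Fin N) es → All (Avoids v) es → Ignores (totalDeviation p σ τ es) v
  totalDeviation-ignores p σ τ v [] _ b S = refl
  totalDeviation-ignores p σ τ v ((i , j) ∷ es) ((v≢i , v≢j) ∷ av) b S = cong₂ _+_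
    (cong₂ (λ x y → 𝟙ᵇ σ x * 𝟙ᵇ τ y - π p σ * π p τ)
      (lookup∘update′ (λ e → v≢i (sym e)) S b) (lookup∘update′ (λ e → v≢j (sym e)) S b))
    (totalDeviation-ignores p σ τ v es av b S)

  module _ {N : ℕ} {p : ℚ} (0≤p : 0ℚ ≤ p) (p≤1 : p ≤ 1ℚ) (σ τ : Bool) where

    private
      D : List (Fin N × Fin N) → Vec Bool N → ℚ
      D = totalDeviation p σ τ
      0≤π : ∀ b → 0ℚ ≤ π p b
      0≤π true  = 0≤p
      0≤π false = slack p≤1
      π≤1 : ∀ b → π p b ≤ 1ℚ
      π≤1 true  = p≤1
      π≤1 false = ≤-by-slack p 0≤p (ring p)
        where
        ring : ∀ p → 1ℚ ≡ (1ℚ - p) + p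
        ring = solve-∀ ℚ-ring
      0≤P : 0ℚ ≤ π p σ * π p τ
      0≤P = 0≤* (0≤π σ) (0≤π τ)
      P≤1 : π p σ * π p τ ≤ 1ℚ
      P≤1 = *-mono-nonNeg (0≤π σ) (π≤1 σ) (0≤π τ) (π≤1 τ)

    deviation²≤1 : ∀ (e : Fin N × Fin N) S → deviation p σ τ e S * deviation p σ τ e S ≤ 1ℚ
    deviation²≤1 (i , j) S = bound σ (lookup S i) τ (lookup S j)
      where
      P = π p σ * π p τ
      ring₁ : ∀ P → 1ℚ ≡ (1ℚ * 1ℚ - P) * (1ℚ * 1ℚ - P) + (P * (1ℚ - P) + P)
      ring₁ = solve-∀ ℚ-ring
      ring₂ : ∀ P x → x ≡ 0ℚ → 1ℚ ≡ (x - P) * (x - P) + ((1ℚ - P) + P * (1ℚ - P))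
      ring₂ P x refl = ring P
        where
        ring : ∀ P → 1ℚ ≡ (0ℚ - P) * (0ℚ - P) + ((1ℚ - P) + P * (1ℚ - P))
        ring = solve-∀ ℚ-ring
      zero-case : ∀ x → x ≡ 0ℚ → (x - P) * (x - P) ≤ 1ℚ
      zero-case x x≡0 = ≤-by-slack _ (0≤+ (slack P≤1) (0≤* 0≤P (slack P≤1))) (ring₂ P x x≡0)
      one-case : (1ℚ * 1ℚ - P) * (1ℚ * 1ℚ - P) ≤ 1ℚ
      one-case = ≤-by-slack _ (0≤+ (0≤* 0≤P (slack P≤1)) 0≤P) (ring₁ P)
      bound : ∀ a b c d → (𝟙ᵇ a b * 𝟙ᵇ c d - P) * (𝟙ᵇ a b * 𝟙ᵇ c d - P) ≤ 1ℚ
      bound true false c d = zero-case _ (*-zeroˡ (𝟙ᵇ c d))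
      bound false true c d = zero-case _ (*-zeroˡ (𝟙ᵇ c d))
      bound a b true false = zero-case _ (*-zeroʳ (𝟙ᵇ a b))
      bound a b false true = zero-case _ (*-zeroʳ (𝟙ᵇ a b))
      bound true true true true = one-case
      bound true true false false = one-case
      bound false false true true = one-case
      bound false false false false = one-case

    -- The cross terms vanish by orthogonality, and each square is at most 1.
    E-totalDeviation² : ∀ es → AllPairs Disjoint es → All Proper es →
      E p (λ S → D es S * D es S) ≤ fromℕ (length es)
    E-totalDeviation² [] _ _ = ≤-reflexive (trans (E-const {N} p (0ℚ * 0ℚ)) (sym fromℕ-0))
    E-totalDeviation² (e@(i , j) ∷ es) (e# ∷ es#) (i≢j ∷ pr) = begin
      E p (λ S → (d S + D es S) * (d S + D es S))
        ≡⟨ E-cong p (λ S → ring (d S) (D es S)) ⟩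
      E p (λ S → d S * d S + (two * (D es S * d S) + D es S * D es S))
        ≡⟨ trans (E-+ p (λ S → d S * d S) (λ S → two * (D es S * d S) + D es S * D es S))
             (cong (λ x → E p (λ S → d S * d S) + x)
               (trans (E-+ p (λ S → two * (D es S * d S)) (λ S → D es S * D es S))
                 (cong (λ x → x + E p (λ S → D es S * D es S)) (E-scale p two (λ S → D es S * d S))))) ⟩
      E p (λ S → d S * d S) + (two * E p (λ S → D es S * d S) + E p (λ S → D es S * D es S))
        ≡⟨ cong (λ x → E p (λ S → d S * d S) + (two * x + E p (λ S → D es S * D es S)))
             (E-deviation-ignored p σ τ i j i≢j (D es)
               (totalDeviation-ignores p σ τ i es (All.map proj₁ e#))
               (totalDeviation-ignores p σ τ j es (All.map proj₂ e#))) ⟩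
      E p (λ S → d S * d S) + (two * 0ℚ + E p (λ S → D es S * D es S))
        ≤⟨ +-mono-≤ (E-≤ 0≤p p≤1 (deviation²≤1 e)) (+-monoʳ-≤ (two * 0ℚ) (E-totalDeviation² es es# pr)) ⟩
      1ℚ + (two * 0ℚ + fromℕ (length es))  ≡⟨ ring₀ (fromℕ (length es)) ⟩
      1ℚ + fromℕ (length es)               ≡⟨ fromℕ-suc (length es) ⟨
      fromℕ (suc (length es))              ∎
      where
      open ≤-Reasoning
      two : ℚ
      two = 1ℚ + 1ℚ
      d : Vec Bool N → ℚ
      d = deviation p σ τ e
      ring : ∀ x y → (x + y) * (x + y) ≡ x * x + ((1ℚ + 1ℚ) * (y * x) + y * y)
      ring = solve-∀ ℚ-ring
      ring₀ : ∀ x → 1ℚ + ((1ℚ + 1ℚ) * 0ℚ + x) ≡ 1ℚ + x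
      ring₀ = solve-∀ ℚ-ring

    E-*-totalDeviation : ∀ {g : Vec Bool N → ℚ} {η} es →
      All (λ e → η ≤ E p (λ S → g S * deviation p σ τ e S)) es →
      fromℕ (length es) * η ≤ E p (λ S → g S * D es S)
    E-*-totalDeviation {g} {η} [] [] = ≤-reflexive (trans (trans (cong (_* η) fromℕ-0) (*-zeroˡ η))
      (sym (trans (E-cong p (λ S → *-zeroʳ (g S))) (E-const {N} p 0ℚ))))
    E-*-totalDeviation {g} {η} (e ∷ es) (η≤ ∷ η≤s) = begin
      fromℕ (suc (length es)) * η                  ≡⟨ trans (cong (_* η) (fromℕ-suc (length es))) (ring (fromℕ (length es)) η) ⟩
      η + fromℕ (length es) * η                    ≤⟨ +-mono-≤ η≤ (E-*-totalDeviation {g} es η≤s) ⟩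
      E p (λ S → g S * deviation p σ τ e S) + E p (λ S → g S * D es S)
        ≡⟨ trans (E-cong p (λ S → *-distribˡ-+ (g S) (deviation p σ τ e S) (D es S))) (E-+ p (λ S → g S * deviation p σ τ e S) (λ S → g S * D es S)) ⟨
      E p (λ S → g S * (deviation p σ τ e S + D es S)) ∎
      where
      open ≤-Reasoning
      ring : ∀ x y → (1ℚ + x) * y ≡ y + x * y
      ring = solve-∀ ℚ-ring

    -- Let D be the total deviation of the l pairs in `es`. Expanding the mean of (g - ηD)², which
    -- is nonnegative, gives 0 ≤ E g² - 2η E gD + η² E D² ≤ 1 - 2η² l + η² l.
    bessel : ∀ {g : Vec Bool N → ℚ} {η} → (∀ S → 0ℚ ≤ g S) → (∀ S → g S ≤ 1ℚ) → 0ℚ ≤ η →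
      ∀ es → AllPairs Disjoint es → All Proper es →
      All (λ e → η ≤ E p (λ S → g S * deviation p σ τ e S)) es →
      η * η * fromℕ (length es) ≤ 1ℚ
    bessel {g} {η} 0≤g g≤1 0≤η es es# pr corr = ≤-by-slack
      (V + ((1ℚ - G) + ((η + η) * (H - fromℕ (length es) * η) + η * η * (fromℕ (length es) - X))))
      (0≤+ 0≤V (0≤+ (slack G≤1) (0≤+ (0≤* (0≤+ 0≤η 0≤η) (slack (E-*-totalDeviation {g} es corr)))
        (0≤* (0≤* 0≤η 0≤η) (slack (E-totalDeviation² es es# pr))))))
      (trans (ring η (fromℕ (length es)) G H X) (cong (λ v → η * η * fromℕ (length es) + (v + ((1ℚ - G) + ((η + η) * (H - fromℕ (length es) * η) + η * η * (fromℕ (length es) - X))))) (sym V≡)))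
      where
      G H X V : ℚ
      G = E p (λ S → g S * g S)
      H = E p (λ S → g S * D es S)
      X = E p (λ S → D es S * D es S)
      V = E p (λ S → (g S - η * D es S) * (g S - η * D es S))
      0≤V : 0ℚ ≤ V
      0≤V = E-nonNeg 0≤p p≤1 (λ S → 0≤square (g S - η * D es S))
      G≤1 : G ≤ 1ℚ
      G≤1 = E-≤ 0≤p p≤1 (λ S → *-mono-nonNeg (0≤g S) (g≤1 S) (0≤g S) (g≤1 S))
      expand : ∀ g η d → (g - η * d) * (g - η * d) ≡ 1ℚ * (g * g) + 1ℚ * ((- (η + η)) * (g * d) + η * η * (d * d))
      expand = solve-∀ ℚ-ring
      V≡ : V ≡ 1ℚ * G + 1ℚ * ((- (η + η)) * H + η * η * X)
      V≡ = trans (E-cong p (λ S → expand (g S) η (D es S)))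
        (trans (E-linear p 1ℚ 1ℚ (λ S → g S * g S) (λ S → (- (η + η)) * (g S * D es S) + η * η * (D es S * D es S)))
          (cong (λ x → 1ℚ * G + 1ℚ * x) (E-linear p (- (η + η)) (η * η) (λ S → g S * D es S) (λ S → D es S * D es S))))
      ring : ∀ η l G H X → 1ℚ ≡ η * η * l + ((1ℚ * G + 1ℚ * ((- (η + η)) * H + η * η * X))
        + ((1ℚ - G) + ((η + η) * (H - l * η) + η * η * (l - X))))
      ring = solve-∀ ℚ-ring

  -- A probability at which the derivative is at most average.

  ∃-≤-average : ∀ {n} (f : Fin (suc n) → ℚ) → ∃ λ i → fromℕ (suc n) * f i ≤ ∑ℚ f
  ∃-≤-average {n} f with argmin ≤-refl ≤-trans ≤-total f
  ... | i , least = i , subst (_≤ ∑ℚ f) (∑ℚ-const (suc n) (f i)) (∑ℚ-mono least)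

  ∑ℚ-telescope : ∀ k (d φ : ℕ → ℚ) → (∀ j → j ℕ.< k → φ j + d j ≤ φ (suc j)) →
    φ 0 + ∑ℚ {k} (λ i → d (toℕ i)) ≤ φ k
  ∑ℚ-telescope zero    d φ step = ≤-reflexive (+-identityʳ (φ 0))
  ∑ℚ-telescope (suc k) d φ step = begin
    φ 0 + (d 0 + ∑ℚ {k} (λ i → d (suc (toℕ i))))  ≡⟨ +-assoc (φ 0) (d 0) (∑ℚ {k} (λ i → d (suc (toℕ i)))) ⟨
    φ 0 + d 0 + ∑ℚ {k} (λ i → d (suc (toℕ i)))    ≤⟨ +-monoˡ-≤ (∑ℚ {k} (λ i → d (suc (toℕ i)))) (step 0 (ℕ.s≤s ℕ.z≤n)) ⟩
    φ 1 + ∑ℚ {k} (λ i → d (suc (toℕ i)))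
      ≤⟨ ∑ℚ-telescope k (λ j → d (suc j)) (λ j → φ (suc j)) (λ j j<k → step (suc j) (ℕ.s≤s j<k)) ⟩
    φ (suc k)                                     ∎
    where open ≤-Reasoning

  -- The increments over the equal steps add up to the change of the mean of `f` between the two
  -- ends; the smallest of the lower bounds from `E-increment` is at most their average.
  ∃-small-derivative : ∀ {N} {p h} k → 0ℚ ≤ p → 0ℚ ≤ h → p + fromℕ (suc k) * h ≤ 1ℚ →
    (f : Vec Bool N → ℚ) → (∀ v S → 0ℚ ≤ ∂ v f S) → (∀ v S → ∂ v f S ≤ 1ℚ) →
    ∃ λ j → j ℕ.< suc k × E p f + fromℕ (suc k) * (h * ∑ℚ (λ v → E (p + fromℕ j * h) (∂ v f)) - h * h * (fromℕ N * fromℕ N))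
      ≤ E (p + fromℕ (suc k) * h) f
  ∃-small-derivative {N} {p} {h} k 0≤p 0≤h p+kh≤1 f 0≤∂ ∂≤1 =
    toℕ i , Finₚ.toℕ<n i , ≤-trans (+-monoʳ-≤ (E p f) below) total
    where
    q φ d : ℕ → ℚ
    q j = p + fromℕ j * h
    φ j = E (q j) f
    d j = h * ∑ℚ (λ v → E (q j) (∂ v f)) - h * h * (fromℕ N * fromℕ N)
    average : ∃ λ i → fromℕ (suc k) * d (toℕ i) ≤ ∑ℚ {suc k} (λ i → d (toℕ i))
    average = ∃-≤-average {k} (λ i → d (toℕ i))
    i : Fin (suc k)
    i = proj₁ average
    below : fromℕ (suc k) * d (toℕ i) ≤ ∑ℚ {suc k} (λ i → d (toℕ i))
    below = proj₂ average
    ring₀ : ∀ p h → p + 0ℚ * h ≡ p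
    ring₀ = solve-∀ ℚ-ring
    φ0 : φ 0 ≡ E p f
    φ0 = cong (λ x → E x f) (trans (cong (λ x → p + x * h) fromℕ-0) (ring₀ p h))
    ring : ∀ p n h → p + n * h + h ≡ p + (1ℚ + n) * h
    ring = solve-∀ ℚ-ring
    q-suc : ∀ j → q j + h ≡ q (suc j)
    q-suc j = trans (ring p (fromℕ j) h) (cong (λ x → p + x * h) (sym (fromℕ-suc j)))
    q≤1 : ∀ {j} → j ℕ.≤ suc k → q j ≤ 1ℚ
    q≤1 {j} j≤k = ≤-trans (+-monoʳ-≤ p (*-monoʳ-≤-nonNeg h {{nonNegative 0≤h}} (fromℕ-mono j≤k))) p+kh≤1
    step : ∀ j → j ℕ.< suc k → φ j + d j ≤ φ (suc j)
    step j j<k = subst₂ _≤_ (+-assoc (φ j) (h * ∑ℚ (λ v → E (q j) (∂ v f))) (- (h * h * (fromℕ N * fromℕ N))))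
      (cong (λ x → E x f) (q-suc j))
      (E-increment (0≤+ 0≤p (0≤* (0≤fromℕ j) 0≤h)) (q≤1 (ℕₚ.<⇒≤ j<k)) 0≤h
        (subst (_≤ 1ℚ) (sym (q-suc j)) (q≤1 j<k)) f 0≤∂ ∂≤1)
    total : E p f + ∑ℚ {suc k} (λ i → d (toℕ i)) ≤ φ (suc k)
    total = subst (λ x → x + ∑ℚ {suc k} (λ i → d (toℕ i)) ≤ φ (suc k)) φ0 (∑ℚ-telescope (suc k) d φ step)

  -- Uncorrelated triangles have weight at least 1 - 3ε.

  module _ {N : ℕ} {p : ℚ} (0≤p : 0ℚ ≤ p) (p≤1 : p ≤ 1ℚ) (f : Vec Bool N → ℚ) {η ε : ℚ}
    (η≤ : ∀ σ τ → η ≤ π p σ * π p τ * ε) (0<P : ∀ σ τ → 0ℚ < π p σ * π p τ) where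

    correlation : Bool → Bool → Fin N → Fin N × Fin N → ℚ
    correlation σ τ v e = E p (λ S → ∂ v f S * deviation p σ τ e S)

    -- By `E-deviation` a correlation below η ≤ Pε bounds P times the change of the mean, where P is
    -- the probability of the forced event; dividing by P gives the bound ε.
    forced-≤ : ∀ σ τ v i j → i ≢ j → ¬ (η ≤ correlation σ τ v (i , j)) →
      E p (λ S → ∂ v f ((S [ j ]≔ τ) [ i ]≔ σ)) ≤ E p (∂ v f) + ε
    forced-≤ σ τ v i j i≢j small = *-cancelˡ-≤-pos P {{positive (0<P σ τ)}}
      (≤-by-slack ((P * ε - η) + (η - c)) (0≤+ (slack (η≤ σ τ)) (slack (<⇒≤ (≰⇒> small))))
        (trans (ring P w ε η x) (cong (λ y → P * x + ((P * ε - η) + (η - y))) (sym (E-deviation p σ τ i j i≢j (∂ v f))))))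
      where
      P w x c : ℚ
      P = π p σ * π p τ
      w = E p (∂ v f)
      x = E p (λ S → ∂ v f ((S [ j ]≔ τ) [ i ]≔ σ))
      c = correlation σ τ v (i , j)
      ring : ∀ P w ε η x → P * (w + ε) ≡ P * x + ((P * ε - η) + (η - (P * x - P * w)))
      ring = solve-∀ ℚ-ring

    -- The three elements of a triangle are added one after the other; each step is a derivative in a forced context.
    telescoped : ∀ i j k → i ≢ j → j ≢ k → k ≢ i → ∀ S →
      f (((S [ k ]≔ false) [ j ]≔ false) [ i ]≔ false) + 1ℚ ≤ f (((S [ j ]≔ true) [ i ]≔ true) [ k ]≔ true) →
      1ℚ ≤ ∂ i f ((S [ k ]≔ false) [ j ]≔ false) + (∂ j f ((S [ i ]≔ true) [ k ]≔ false) + ∂ k f ((S [ j ]≔ true) [ i ]≔ true))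
    telescoped i j k i≢j j≢k k≢i S gain = ≤-by-slack (C₁ - (A₀ + 1ℚ)) (slack gain)
      (trans (cong₂ (λ x y → x - A₀ + (y - B₀ + (C₁ - C₀))) A₁≡B₀ B₁≡C₀) (ring A₀ B₀ C₀ C₁))
      where
      A₀ A₁ B₀ B₁ C₀ C₁ : ℚ
      A₀ = f (((S [ k ]≔ false) [ j ]≔ false) [ i ]≔ false)
      A₁ = f (((S [ k ]≔ false) [ j ]≔ false) [ i ]≔ true)
      B₀ = f (((S [ i ]≔ true) [ k ]≔ false) [ j ]≔ false)
      B₁ = f (((S [ i ]≔ true) [ k ]≔ false) [ j ]≔ true)
      C₀ = f (((S [ j ]≔ true) [ i ]≔ true) [ k ]≔ false)
      C₁ = f (((S [ j ]≔ true) [ i ]≔ true) [ k ]≔ true)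
      -- The updates are nested in the order in which `E-deviation` forces them; after reordering,
      -- the end of one step is the start of the next.
      A₁≡B₀ : A₁ ≡ B₀
      A₁≡B₀ = cong f (trans ([]≔-commutes (S [ k ]≔ false) j i (λ e → i≢j (sym e)))
        (cong (_[ j ]≔ false) ([]≔-commutes S k i k≢i)))
      B₁≡C₀ : B₁ ≡ C₀
      B₁≡C₀ = cong f (trans ([]≔-commutes (S [ i ]≔ true) k j (λ e → j≢k (sym e)))
        (cong (_[ k ]≔ false) ([]≔-commutes S i j i≢j)))
      ring : ∀ a b c d → b - a + (c - b + (d - c)) ≡ 1ℚ + (d - (a + 1ℚ))
      ring = solve-∀ ℚ-ring

    triangle-weight : ∀ i j k → i ≢ j → j ≢ k → k ≢ i →
      (∀ S → f (((S [ k ]≔ false) [ j ]≔ false) [ i ]≔ false) + 1ℚ ≤ f (((S [ j ]≔ true) [ i ]≔ true) [ k ]≔ true)) →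
      ¬ (η ≤ correlation false false i (j , k)) → ¬ (η ≤ correlation false true j (k , i)) →
      ¬ (η ≤ correlation true true k (i , j)) →
      1ℚ ≤ (E p (∂ i f) + ε) + ((E p (∂ j f) + ε) + (E p (∂ k f) + ε))
    triangle-weight i j k i≢j j≢k k≢i gain c₁ c₂ c₃ = begin
      1ℚ ≡⟨ E-const {N} p 1ℚ ⟨
      E {N} p (λ _ → 1ℚ) ≤⟨ E-mono 0≤p p≤1 (λ S → telescoped i j k i≢j j≢k k≢i S (gain S)) ⟩
      E p (λ S → F₁ S + (F₂ S + F₃ S)) ≡⟨ trans (E-+ p F₁ (λ S → F₂ S + F₃ S)) (cong (λ x → E p F₁ + x) (E-+ p F₂ F₃)) ⟩
      E p F₁ + (E p F₂ + E p F₃) ≤⟨ +-mono-≤ (forced-≤ false false i j k j≢k c₁)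
        (+-mono-≤ (forced-≤ false true j k i k≢i c₂) (forced-≤ true true k i j i≢j c₃)) ⟩
      (E p (∂ i f) + ε) + ((E p (∂ j f) + ε) + (E p (∂ k f) + ε)) ∎
      where
      open ≤-Reasoning
      F₁ F₂ F₃ : Vec Bool N → ℚ
      F₁ S = ∂ i f ((S [ k ]≔ false) [ j ]≔ false)
      F₂ S = ∂ j f ((S [ i ]≔ true) [ k ]≔ false)
      F₃ S = ∂ k f ((S [ j ]≔ true) [ i ]≔ true)

module Digraphs where

  open Packings
  open Counting hiding (_∩_)
  open Expectation
  open import Defs
  open import Data.Nat as ℕ using (ℕ; zero; suc; NonZero)
  import Data.Nat.Properties as ℕₚ
  open import Data.Nat.Tactic.RingSolver using () renaming (solve-∀ to solveℕ-∀)
  open import Data.Integer as ℤ using (+_)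
  open import Data.Rational as Rational hiding (_≟_; NonZero; floor)
  open import Data.Rational.Properties hiding (_≟_)
  import Data.Rational.Unnormalised as ℚᵘ
  import Data.Rational.Unnormalised.Properties as ℚᵘₚ
  open import Data.Fin using (combine; remQuot; toℕ; _↑ˡ_; _↑ʳ_)
  open import Data.Fin.Properties using (combine-injective; _≟_)
  import Data.Fin.Properties as Finₚ
  open import Data.Bool.Properties using (∨-zeroʳ)
  open import Data.Vec.Properties using (lookup∘update; lookup∘update′)
  open import Data.List using (_++_; map; concatMap; allFin)
  open import Data.List.Properties using (length-++; length-map)
  open import Data.List.Membership.Propositional.Properties using (∈-concatMap⁺; ∈-allFin; ∈-map⁺; ∈-++⁺ˡ; ∈-++⁺ʳ)
  import Data.List.Relation.Unary.Any as Any
  open import Data.List.Relation.Unary.Any.Properties using (lookup-index)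
  import Data.List.Relation.Unary.All.Properties as Allₚ
  import Data.List.Relation.Unary.AllPairs.Properties as AllPairsₚ
  open import Data.Product.Properties using (≡-dec)
  import Data.Sum as Sum
  open import Tactic.RingSolver using (solve-∀)

  -- Lists of the indices at which a Boolean function is true, and updates of bit vectors.

  support : ∀ {n} → (Fin n → Bool) → List (Fin n)
  support {zero}  g = []
  support {suc n} g with g zero
  ... | true  = zero ∷ map suc (support (g ∘ suc))
  ... | false = map suc (support (g ∘ suc))

  length-support : ∀ {n} (g : Fin n → Bool) → length (support g) ≡ ∑ (λ i → bit (g i))
  length-support {zero}  g = refl
  length-support {suc n} g with g zero
  ... | true  = cong suc (trans (length-map suc (support (g ∘ suc))) (length-support (g ∘ suc)))
  ... | false = trans (length-map suc (support (g ∘ suc))) (length-support (g ∘ suc))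

  support-true : ∀ {n} (g : Fin n → Bool) → All (λ i → g i ≡ true) (support g)
  support-true {zero}  g = []
  support-true {suc n} g with g zero in eq
  ... | true  = eq ∷ Allₚ.map⁺ (support-true (g ∘ suc))
  ... | false = Allₚ.map⁺ (support-true (g ∘ suc))

  support-unique : ∀ {n} (g : Fin n → Bool) → AllPairs _≢_ (support g)
  support-unique {zero}  g = []
  support-unique {suc n} g with g zero
  ... | true  = Allₚ.map⁺ (All.universal (λ _ ()) (support (g ∘ suc))) ∷ tail
    where
    tail : AllPairs _≢_ (map suc (support (g ∘ suc)))
    tail = AllPairsₚ.map⁺ (AllPairs.map (λ i≢j e → i≢j (Finₚ.suc-injective e)) (support-unique (g ∘ suc)))
  ... | false = AllPairsₚ.map⁺ (AllPairs.map (λ i≢j e → i≢j (Finₚ.suc-injective e)) (support-unique (g ∘ suc)))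

  support-complete : ∀ {n} (g : Fin n → Bool) i → g i ≡ true → i ∈ support g
  support-complete {suc n} g zero    gi with g zero
  support-complete {suc n} g zero    refl | true = here refl
  support-complete {suc n} g (suc i) gi with g zero
  ... | true  = there (∈-map⁺ suc (support-complete (g ∘ suc) i gi))
  ... | false = ∈-map⁺ suc (support-complete (g ∘ suc) i gi)

  update-persist : ∀ {m} (S : Vec Bool m) {x} y {β} → lookup S x ≡ β → lookup (S [ y ]≔ β) x ≡ β
  update-persist S {x} y {β} Sx with x ≟ y
  ... | yes refl = lookup∘update x S β
  ... | no  x≢y  = trans (lookup∘update′ x≢y S β) Sx

  update-false : ∀ {m} (S : Vec Bool m) {x} y → lookup (S [ y ]≔ false) x ≡ true → lookup S x ≡ true
  update-false S {x} y h with x ≟ y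
  ... | no  x≢y  = trans (sym (lookup∘update′ x≢y S false)) h
  ... | yes refl with trans (sym h) (lookup∘update x S false)
  ...   | ()

  -- Triangle packings inside a random set of arcs, and the number of light triangles.

  module _ {n : ℕ} (D : Digraph n) where

    arc≢ : ∀ {u v} → Arc D u v → u ≢ v
    arc≢ {u} uv refl with trans (sym uv) (loopless D u)
    ... | ()

    triangle : ∀ {a b c} → Arc D a b → Arc D b c → Arc D c a → Triangle D
    triangle {a} {b} {c} ab bc ca = record
      { a = a ; b = b ; c = c ; a≢b = arc≢ ab ; b≢c = arc≢ bc ; c≢a = arc≢ ca ; ab = ab ; bc = bc ; ca = ca }

    trianglesAt : Fin n → Fin n → Fin n → List (Triangle D)
    trianglesAt a b c with adj D a b ≟ᵇ true | adj D b c ≟ᵇ true | adj D c a ≟ᵇ true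
    ... | yes ab | yes bc | yes ca = triangle ab bc ca ∷ []
    ... | _      | _      | _      = []

    -- Every directed triangle occurs once for each starting vertex; the copies share their arcs, so
    -- a packing takes at most one of them.
    allTriangles : List (Triangle D)
    allTriangles = concatMap (λ a → concatMap (λ b → concatMap (trianglesAt a b) (allFin n)) (allFin n)) (allFin n)

    allTriangles-complete : ∀ {a b c} → Arc D a b → Arc D b c → Arc D c a →
      ∃ λ t → t ∈ allTriangles × arcsOf t ≡ (a , b) ∷ (b , c) ∷ (c , a) ∷ []
    allTriangles-complete {a} {b} {c} ab bc ca with present
      where
      present : ∃ λ t → t ∈ trianglesAt a b c × arcsOf t ≡ (a , b) ∷ (b , c) ∷ (c , a) ∷ []
      present with adj D a b ≟ᵇ true | adj D b c ≟ᵇ true | adj D c a ≟ᵇ true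
      ... | yes ab′ | yes bc′ | yes ca′ = _ , here refl , refl
      ... | no ¬ab  | _       | _       = ⊥-elim (¬ab ab)
      ... | yes _   | no ¬bc  | _       = ⊥-elim (¬bc bc)
      ... | yes _   | yes _   | no ¬ca  = ⊥-elim (¬ca ca)
    ... | t , t∈ , eq = t , at a (at b (at c t∈)) , eq
      where
      at : ∀ {F : Fin n → List (Triangle D)} x → t ∈ F x → t ∈ concatMap F (allFin n)
      at {F} x t∈F = ∈-concatMap⁺ F (Any.map (λ { refl → t∈F }) (∈-allFin x))

    open MaximumPacking (≡-dec _≟_ _≟_) (arcsOf {D = D}) public

    -- The random set is drawn from all n² ordered pairs. A pair that is not an arc lies in no
    -- triangle, so its derivative is zero.
    toSet : Vec Bool (n ℕ.* n) → Fin n × Fin n → Bool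
    toSet S (u , v) = lookup S (combine u v)

    packing : Vec Bool (n ℕ.* n) → ℚ
    packing S = fromℕ (maxPacking allTriangles (toSet S))

    0≤∂packing : ∀ e S → 0ℚ ≤ ∂ e packing S
    0≤∂packing e S = slack (fromℕ-mono (maxPacking-mono allTriangles (λ _ h → update-persist S e (update-false S e h))))

    ∂packing≤1 : ∀ e S → ∂ e packing S ≤ 1ℚ
    ∂packing≤1 e S = ≤-by-slack (1ℚ + x - y) (slack le) (ring y x)
      where
      x y : ℚ
      x = packing (S [ e ]≔ false)
      y = packing (S [ e ]≔ true)
      sub : ∀ z → toSet (S [ e ]≔ true) z ≡ true → z ≢ remQuot n e → toSet (S [ e ]≔ false) z ≡ true
      sub (u , v) h z≢ = trans (lookup∘update′ ≢e S false) (trans (sym (lookup∘update′ ≢e S true)) h)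
        where
        ≢e : combine u v ≢ e
        ≢e refl = z≢ (sym (Finₚ.remQuot-combine u v))
      le : y ≤ 1ℚ + x
      le = subst (y ≤_) (fromℕ-suc (maxPacking allTriangles (toSet (S [ e ]≔ false)))) (fromℕ-mono (maxPacking-lipschitz allTriangles (remQuot n e) sub))
      ring : ∀ y x → 1ℚ ≡ y - x + (1ℚ + x - y)
      ring = solve-∀ ℚ-ring

    packing-gain : ∀ {a b c} → Arc D a b → Arc D b c → Arc D c a → ∀ S →
      packing (((S [ combine c a ]≔ false) [ combine b c ]≔ false) [ combine a b ]≔ false) + 1ℚ
      ≤ packing (((S [ combine b c ]≔ true) [ combine a b ]≔ true) [ combine c a ]≔ true)
    packing-gain {a} {b} {c} ab bc ca S with allTriangles-complete ab bc ca
    ... | t , t∈ , eq = ≤-trans (≤-reflexive (trans (+-comm (packing S₀) 1ℚ) (sym (fromℕ-suc (maxPacking allTriangles (toSet S₀)))))) (fromℕ-mono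
      (maxPacking-add t∈ (subst ((a , b) ∈_) (sym eq) (here refl)) sub
        (subst (All (λ x → toSet S₁ x ≡ true)) (sym eq) (in₁ ∷ in₂ ∷ in₃ ∷ []))
        (subst (All (λ x → toSet S₀ x ≢ true)) (sym eq) (out out₁ ∷ out out₂ ∷ out out₃ ∷ []))))
      where
      i j k : Fin (n ℕ.* n)
      i = combine a b
      j = combine b c
      k = combine c a
      Sₖ Sₖⱼ S₀ Sⱼ Sⱼᵢ S₁ : Vec Bool (n ℕ.* n)
      Sₖ  = S [ k ]≔ false
      Sₖⱼ = Sₖ [ j ]≔ false
      S₀  = Sₖⱼ [ i ]≔ false
      Sⱼ  = S [ j ]≔ true
      Sⱼᵢ = Sⱼ [ i ]≔ true
      S₁  = Sⱼᵢ [ k ]≔ true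
      sub : toSet S₀ ⊑ toSet S₁
      sub (u , v) h = update-persist Sⱼᵢ k (update-persist Sⱼ i (update-persist S j
        (update-false S k (update-false Sₖ j (update-false Sₖⱼ i h)))))
      in₁ : lookup S₁ i ≡ true
      in₁ = update-persist Sⱼᵢ k (lookup∘update i Sⱼ true)
      in₂ : lookup S₁ j ≡ true
      in₂ = update-persist Sⱼᵢ k (update-persist Sⱼ i (lookup∘update j S true))
      in₃ : lookup S₁ k ≡ true
      in₃ = lookup∘update k Sⱼᵢ true
      out₁ : lookup S₀ i ≡ false
      out₁ = lookup∘update i Sₖⱼ false
      out₂ : lookup S₀ j ≡ false
      out₂ = update-persist Sₖⱼ i (lookup∘update j Sₖ false)
      out₃ : lookup S₀ k ≡ false
      out₃ = update-persist Sₖⱼ i (update-persist Sₖ j (lookup∘update k S false))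
      out : ∀ {b} → b ≡ false → b ≢ true
      out refl ()

    packing-attained : Packing D (maxPacking allTriangles (λ _ → true))
    packing-attained with maxPacking-attained allTriangles (λ _ → true)
    ... | us , len , disjoint , _ = subst (Packing D) len
      (List.lookup us , AllPairs-lookup (λ disj e e∈ e∈′ → disj e e∈′ e∈) disjoint)

    packing≤ : ∀ S → packing S ≤ fromℕ (maxPacking allTriangles (λ _ → true))
    packing≤ S = fromℕ-mono (maxPacking-mono allTriangles (λ _ _ → refl))

    module _ {p : ℚ} (0≤p : 0ℚ ≤ p) (p≤1 : p ≤ 1ℚ) {η ε : ℚ} (0≤η : 0ℚ ≤ η) {s : ℕ} (sη≡1 : fromℕ s * η ≡ 1ℚ)
      (η≤ : ∀ σ τ → η ≤ π p σ * π p τ * ε) (0<P : ∀ σ τ → 0ℚ < π p σ * π p τ) where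

      weight : Fin n → Fin n → ℚ
      weight u v = E p (∂ (combine u v) packing)

      -- The arc xy is the one being added, z is the apex of a triangle on it, and `σ`, `τ` are the
      -- forced states of yz and zx.
      Correlated : Bool → Bool → Fin n → Fin n → Fin n → Set
      Correlated σ τ x y z = η ≤ correlation 0≤p p≤1 packing {η} {ε} η≤ 0<P σ τ (combine x y) (combine y z , combine z x)

      correlated? : ∀ σ τ x y z → Dec (Correlated σ τ x y z)
      correlated? σ τ x y z = η ≤? correlation 0≤p p≤1 packing {η} {ε} η≤ 0<P σ τ (combine x y) (combine y z , combine z x)

      -- Excluding the two ends of the arc makes the pairs (yz, zx) proper and disjoint for
      -- different z, as `bessel` demands; the apex of a genuine triangle is never excluded.
      correlated : Bool → Bool → Fin n → Fin n → Fin n → Bool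
      correlated σ τ x y z = not ⌊ z ≟ x ⌋ ∧ (not ⌊ z ≟ y ⌋ ∧ ⌊ correlated? σ τ x y z ⌋)

      correlated-true : ∀ σ τ x y z → correlated σ τ x y z ≡ true → z ≢ x × z ≢ y × Correlated σ τ x y z
      correlated-true σ τ x y z eq with z ≟ x | z ≟ y | correlated? σ τ x y z
      ... | no z≢x | no z≢y | yes c = z≢x , z≢y , c

      correlated-intro : ∀ σ τ x y z → z ≢ x → z ≢ y → Correlated σ τ x y z → correlated σ τ x y z ≡ true
      correlated-intro σ τ x y z z≢x z≢y c with z ≟ x | z ≟ y | correlated? σ τ x y z
      ... | yes e | _     | _     = ⊥-elim (z≢x e)
      ... | no _  | yes e | _     = ⊥-elim (z≢y e)
      ... | no _  | no _  | no ¬c = ⊥-elim (¬c c)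
      ... | no _  | no _  | yes _ = refl

      combine≢ : ∀ {u v x y : Fin n} → ¬ (u ≡ x × v ≡ y) → combine u v ≢ combine x y
      combine≢ {u} {v} {x} {y} ne e = ne (combine-injective u v x y e)

      -- For distinct apexes z the pairs (yz, zx) share no arc, so Bessel's inequality bounds their
      -- number by 1/η² = s².
      correlated-few : ∀ σ τ x y → ∑ (λ z → bit (correlated σ τ x y z)) ℕ.≤ s ℕ.* s
      correlated-few σ τ x y = subst (ℕ._≤ s ℕ.* s) (trans (length-map pair zs) (length-support g)) (fromℕ-cancel (begin
        fromℕ ℓ                                     ≡⟨ *-identityˡ (fromℕ ℓ) ⟨
        1ℚ * fromℕ ℓ                                ≡⟨ cong (_* fromℕ ℓ) (cong₂ _*_ sη≡1 sη≡1) ⟨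
        fromℕ s * η * (fromℕ s * η) * fromℕ ℓ       ≡⟨ ring (fromℕ s) η (fromℕ ℓ) ⟩
        fromℕ s * fromℕ s * (η * η * fromℕ ℓ)       ≤⟨ *-monoˡ (0≤* (0≤fromℕ s) (0≤fromℕ s))
          (bessel 0≤p p≤1 σ τ {∂ (combine x y) packing} {η} (0≤∂packing (combine x y)) (∂packing≤1 (combine x y)) 0≤η
            (map pair zs) disjoint proper corr) ⟩
        fromℕ s * fromℕ s * 1ℚ                      ≡⟨ *-identityʳ (fromℕ s * fromℕ s) ⟩
        fromℕ s * fromℕ s                           ≡⟨ fromℕ-* s s ⟨
        fromℕ (s ℕ.* s)                             ∎))
        where
        open ≤-Reasoning
        g : Fin n → Bool
        g = correlated σ τ x y
        zs : List (Fin n)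
        zs = support g
        pair : Fin n → Fin (n ℕ.* n) × Fin (n ℕ.* n)
        pair z = combine y z , combine z x
        ℓ : ℕ
        ℓ = length (map pair zs)
        ring : ∀ s η l → s * η * (s * η) * l ≡ s * s * (η * η * l)
        ring = solve-∀ ℚ-ring
        facts : All (λ z → z ≢ x × z ≢ y × Correlated σ τ x y z) zs
        facts = All.map (λ {z} → correlated-true σ τ x y z) (support-true g)
        corr : All (λ e → η ≤ E p (λ S → ∂ (combine x y) packing S * deviation p σ τ e S)) (map pair zs)
        corr = Allₚ.map⁺ (All.map (λ f → proj₂ (proj₂ f)) facts)
        proper : All Proper (map pair zs)
        proper = Allₚ.map⁺ (All.map (λ { (z≢x , z≢y , _) → combine≢ (λ { (_ , z≡x) → z≢x z≡x }) }) facts)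
        disjoint-pairs : ∀ {zs} → All (λ z → z ≢ x × z ≢ y × Correlated σ τ x y z) zs → AllPairs _≢_ zs → AllPairs (λ z z′ → Disjoint (pair z) (pair z′)) zs
        disjoint-pairs [] [] = []
        disjoint-pairs {z ∷ _} ((z≢x , z≢y , _) ∷ fs) (z≢s ∷ u) = All.zipWith
          (λ { ((z′≢x , z′≢y , _) , z≢z′) →
            (combine≢ (λ { (_ , e) → z≢z′ e }) , combine≢ (λ { (_ , z≡x) → z≢x z≡x }))
            , (combine≢ (λ { (z≡y , _) → z≢y z≡y }) , combine≢ (λ { (e , _) → z≢z′ e })) })
          (fs , z≢s) ∷ disjoint-pairs fs u
        disjoint : AllPairs Disjoint (map pair zs)
        disjoint = AllPairsₚ.map⁺ (disjoint-pairs facts (support-unique g))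

      -- The arcs enter in the order ab, bc, ca: when ab is added the other two are absent, when bc
      -- is added ca is absent and ab present, and when ca is added both others are present. These
      -- are the three patterns of signs.
      correlated-triangle : ∀ {a b c} → Arc D a b → Arc D b c → Arc D c a →
        ¬ (1ℚ ≤ (weight a b + ε) + ((weight b c + ε) + (weight c a + ε))) →
        1 ℕ.≤ bit (correlated false false a b c) ℕ.+ (bit (correlated false true b c a) ℕ.+ bit (correlated true true c a b))
      correlated-triangle {a} {b} {c} ab bc ca light
        with correlated false false a b c in eq₁ | correlated false true b c a in eq₂ | correlated true true c a b in eq₃
      ... | true  | _     | _     = ℕ.s≤s ℕ.z≤n
      ... | false | true  | _     = ℕ.s≤s ℕ.z≤n
      ... | false | false | true  = ℕ.s≤s ℕ.z≤n
      ... | false | false | false = ⊥-elim (light (triangle-weight 0≤p p≤1 packing {η} {ε} η≤ 0<P (combine a b) (combine b c) (combine c a)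
        (combine≢ (λ { (a≡b , _) → arc≢ ab a≡b })) (combine≢ (λ { (b≡c , _) → arc≢ bc b≡c })) (combine≢ (λ { (c≡a , _) → arc≢ ca c≡a }))
        (packing-gain ab bc ca)
        (λ h → contra eq₁ (correlated-intro false false a b c (λ e → arc≢ ca e) (λ e → arc≢ bc (sym e)) h))
        (λ h → contra eq₂ (correlated-intro false true b c a (λ e → arc≢ ab e) (λ e → arc≢ ca (sym e)) h))
        (λ h → contra eq₃ (correlated-intro true true c a b (λ e → arc≢ bc e) (λ e → arc≢ ab (sym e)) h))))
        where
        contra : ∀ {x} → x ≡ false → x ≡ true → ⊥
        contra refl ()

      -- Each light triangle is charged to one of its arcs, and in each of the three roles an arc is
      -- charged at most s² times.
      few-light-triangles : (G : Fin n → Fin n → Bool) →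
        (∀ {a b c} → G a b ≡ true → G b c ≡ true → G c a ≡ true → Arc D a b × Arc D b c × Arc D c a
          × ¬ (1ℚ ≤ (weight a b + ε) + ((weight b c + ε) + (weight c a + ε)))) →
        ∑ (triangles G) ℕ.≤ 3 ℕ.* (s ℕ.* s) ℕ.* (n ℕ.* n)
      few-light-triangles G light = begin
        ∑ (λ a → ∑ (λ b → ∑ (λ c → bit (G a b) ℕ.* bit (G c a) ℕ.* bit (G b c))))
          ≤⟨ ∑-mono (λ a → ∑∑-mono (bound a)) ⟩
        ∑ (λ a → ∑ (λ b → ∑ (λ c → f₁ a b c ℕ.+ (f₂ b c a ℕ.+ f₃ c a b))))
          ≡⟨ trans (∑-cong (λ a → trans (∑∑-+ (f₁ a) (λ b c → f₂ b c a ℕ.+ f₃ c a b))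
               (cong (∑ (λ b → ∑ (f₁ a b)) ℕ.+_) (∑∑-+ (λ b c → f₂ b c a) (λ b c → f₃ c a b)))))
               (trans (∑-+ (λ a → ∑ (λ b → ∑ (f₁ a b))) _) (cong (∑ (λ a → ∑ (λ b → ∑ (f₁ a b))) ℕ.+_)
                 (∑-+ (λ a → ∑ (λ b → ∑ (λ c → f₂ b c a))) (λ a → ∑ (λ b → ∑ (λ c → f₃ c a b)))))) ⟩
        ∑ (λ a → ∑ (λ b → ∑ (f₁ a b))) ℕ.+ (∑ (λ a → ∑ (λ b → ∑ (λ c → f₂ b c a))) ℕ.+ ∑ (λ a → ∑ (λ b → ∑ (λ c → f₃ c a b))))
          -- The sums are reordered so that the apex is innermost, where `correlated-few` applies.
          ≡⟨ cong (∑ (λ a → ∑ (λ b → ∑ (f₁ a b))) ℕ.+_) (cong₂ ℕ._+_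
               (trans (∑-swap (λ a b → ∑ (λ c → f₂ b c a))) (∑-cong (λ b → ∑-swap (λ a c → f₂ b c a))))
               (trans (∑-cong (λ a → ∑-swap (λ b c → f₃ c a b))) (∑-swap (λ a c → ∑ (f₃ c a))))) ⟩
        ∑ (λ a → ∑ (λ b → ∑ (f₁ a b))) ℕ.+ (∑ (λ b → ∑ (λ c → ∑ (f₂ b c))) ℕ.+ ∑ (λ c → ∑ (λ a → ∑ (f₃ c a))))
          ≤⟨ ℕₚ.+-mono-≤ (each false false) (ℕₚ.+-mono-≤ (each false true) (each true true)) ⟩
        n ℕ.* (n ℕ.* (s ℕ.* s)) ℕ.+ (n ℕ.* (n ℕ.* (s ℕ.* s)) ℕ.+ n ℕ.* (n ℕ.* (s ℕ.* s)))
          ≡⟨ ring n (s ℕ.* s) ⟩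
        3 ℕ.* (s ℕ.* s) ℕ.* (n ℕ.* n) ∎
        where
        open ℕₚ.≤-Reasoning
        f₁ f₂ f₃ : Fin n → Fin n → Fin n → ℕ
        f₁ x y z = bit (correlated false false x y z)
        f₂ x y z = bit (correlated false true x y z)
        f₃ x y z = bit (correlated true true x y z)
        bound : ∀ a b c → bit (G a b) ℕ.* bit (G c a) ℕ.* bit (G b c) ℕ.≤ f₁ a b c ℕ.+ (f₂ b c a ℕ.+ f₃ c a b)
        bound a b c with G a b in ab | G c a in ca | G b c in bc
        ... | false | _     | _     = ℕ.z≤n
        ... | true  | false | _     = ℕ.z≤n
        ... | true  | true  | false = ℕ.z≤n
        ... | true  | true  | true  with light ab bc ca
        ...   | ab′ , bc′ , ca′ , lt = correlated-triangle ab′ bc′ ca′ lt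
        each : ∀ σ τ → ∑ (λ x → ∑ (λ y → ∑ (λ z → bit (correlated σ τ x y z)))) ℕ.≤ n ℕ.* (n ℕ.* (s ℕ.* s))
        each σ τ = ℕₚ.≤-trans (∑∑-mono (correlated-few σ τ))
          (ℕₚ.≤-reflexive (trans (∑-cong {n} (λ _ → ∑-const n (s ℕ.* s))) (∑-const n (n ℕ.* (s ℕ.* s)))))
        ring : ∀ n c → n ℕ.* (n ℕ.* c) ℕ.+ (n ℕ.* (n ℕ.* c) ℕ.+ n ℕ.* (n ℕ.* c)) ≡ 3 ℕ.* c ℕ.* (n ℕ.* n)
        ring = solveℕ-∀

  -- Rounding the weights by random labels.

  fromℕ-∑ : ∀ {n} (f : Fin n → ℕ) → fromℕ (∑ f) ≡ ∑ℚ (λ i → fromℕ (f i))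
  fromℕ-∑ {zero}  f = fromℕ-0
  fromℕ-∑ {suc n} f = trans (fromℕ-+ (f zero) (∑ (f ∘ suc))) (cong (λ x → fromℕ (f zero) + x) (fromℕ-∑ (f ∘ suc)))

  ∑ℚ-++ : ∀ m {n} (f : Fin (m ℕ.+ n) → ℚ) → ∑ℚ f ≡ ∑ℚ (λ i → f (i ↑ˡ n)) + ∑ℚ (λ j → f (m ↑ʳ j))
  ∑ℚ-++ zero    f = sym (+-identityˡ (∑ℚ f))
  ∑ℚ-++ (suc m) {n} f = trans (cong (λ x → f zero + x) (∑ℚ-++ m (f ∘ suc)))
    (sym (+-assoc (f zero) (∑ℚ (λ i → f (suc i ↑ˡ n))) (∑ℚ (λ j → f (suc m ↑ʳ j)))))

  ∑ℚ-combine : ∀ m {n} (f : Fin (m ℕ.* n) → ℚ) → ∑ℚ f ≡ ∑ℚ (λ i → ∑ℚ (λ j → f (combine {m} {n} i j)))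
  ∑ℚ-combine zero    f = refl
  ∑ℚ-combine (suc m) {n} f = trans (∑ℚ-++ n f)
    (cong (λ x → ∑ℚ (λ j → f (j ↑ˡ (m ℕ.* n))) + x) (∑ℚ-combine m (λ i → f (n ↑ʳ i))))

  ⌊⌋-exists : ∀ k {x} → 0ℚ ≤ x → x < fromℕ (suc k) → ∃ λ ℓ → fromℕ ℓ ≤ x × x < fromℕ (suc ℓ)
  ⌊⌋-exists zero    {x} 0≤x x< = 0 , subst (_≤ x) (sym fromℕ-0) 0≤x , x<
  ⌊⌋-exists (suc k) {x} 0≤x x< with x <? fromℕ (suc k)
  ... | yes x<k = ⌊⌋-exists k 0≤x x<k
  ... | no  x≮k = suc k , ≮⇒≥ x≮k , x<

  fromℕ-< : ∀ n → fromℕ n < fromℕ (suc n)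
  fromℕ-< n = subst (fromℕ n <_) (sym (fromℕ-suc n)) (subst (_< 1ℚ + fromℕ n) (+-identityˡ (fromℕ n))
    (+-monoˡ-< (fromℕ n) (positive⁻¹ 1ℚ)))

  0<fromℕ : ∀ n .{{_ : NonZero n}} → 0ℚ < fromℕ n
  0<fromℕ (suc n) = ≤-<-trans (0≤fromℕ n) (fromℕ-< n)

  abstract
    reciprocal : ∀ n .{{_ : NonZero n}} → ∃ λ x → 0ℚ < x × fromℕ n * x ≡ 1ℚ
    reciprocal n = (1/ fromℕ n) {{nz}} , positive⁻¹ _ {{1/pos⇒pos (fromℕ n) {{positive (0<fromℕ n)}}}}
      , *-inverseʳ (fromℕ n) {{nz}}
      where
      nz : Rational.NonZero (fromℕ n)
      nz = >-nonZero (0<fromℕ n)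

  ∧-trueˡ : ∀ x {y} → x ∧ y ≡ true → x ≡ true
  ∧-trueˡ true _ = refl

  ∨-true : ∀ x y → x ∨ y ≡ true → x ≡ true ⊎ y ≡ true
  ∨-true true  y _  = inj₁ refl
  ∨-true false y eq = inj₂ eq

  true-or-false : ∀ x → x ≡ true ⊎ x ≡ false
  true-or-false true  = inj₁ refl
  true-or-false false = inj₂ refl

  module Rounding {n : ℕ} (D : Digraph n) (w : Fin n → Fin n → ℚ) (0≤w : ∀ u v → 0ℚ ≤ w u v) (w≤1 : ∀ u v → w u v ≤ 1ℚ) where

    K : ℚ
    K = fromℕ 184

    abstract
      level-exists : ∀ u v → ∃ λ ℓ → fromℕ ℓ ≤ K * w u v × K * w u v < fromℕ (suc ℓ)
      level-exists u v = ⌊⌋-exists 184 (0≤* (0≤fromℕ 184) (0≤w u v))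
        (≤-<-trans (subst (K * w u v ≤_) (*-identityʳ K) (*-monoˡ (0≤fromℕ 184) (w≤1 u v))) (fromℕ-< 184))

    level : Fin n → Fin n → ℕ
    level u v = proj₁ (level-exists u v)

    abstract
      labelling : ∃ λ (l : Vec (Fin 11) n) →
        11 ℕ.* 11 ℕ.* ∑ (λ u → ∑ (λ v → bit (adj D u v) ℕ.* bit (cut (level u v) (lookup l u) (lookup l v))))
        ℕ.≤ ∑ (λ u → ∑ (λ v → ∑ (λ x → ∑ (λ y → bit (adj D u v) ℕ.* bit (cut (level u v) x y)))))
      labelling = ∃-labelling 11 (λ u v x y → bit (adj D u v) ℕ.* bit (cut (level u v) x y))
        (λ u x y → cong (λ b → bit b ℕ.* bit (cut (level u u) x y)) (loopless D u))

    label : Fin n → Fin 11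
    label = lookup (proj₁ labelling)

    removed kept : Fin n → Fin n → Bool
    removed u v = adj D u v ∧ cut (level u v) (label u) (label v)
    kept u v = adj D u v ∧ not (cut (level u v) (label u) (label v))

    -- Averages `cuts≤` over the 121 pairs of labels; 9559 = 79 · 121.
    removed≤levels : 9559 ℕ.* ∑ (λ u → ∑ (λ v → bit (removed u v))) ℕ.≤ 93 ℕ.* ∑ (λ u → ∑ (level u))
    removed≤levels = chain 79 11 93 refl (proj₂ labelling) cuts≤
      where
      open ℕₚ.≤-Reasoning
      r : ℕ
      r = ∑ (λ u → ∑ (λ v → bit (adj D u v) ℕ.* bit (cut (level u v) (label u) (label v))))
      cost : ℕ
      cost = ∑ (λ u → ∑ (λ v → ∑ (λ x → ∑ (λ y → bit (adj D u v) ℕ.* bit (cut (level u v) x y)))))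
      bit-*-≤ : ∀ b x → bit b ℕ.* x ℕ.≤ x
      bit-*-≤ true  x = ℕₚ.≤-reflexive (ℕₚ.*-identityˡ x)
      bit-*-≤ false x = ℕ.z≤n
      -- The numerals enter as variables, which keeps their products symbolic.
      chain : ∀ a m b {c} → a ℕ.* (m ℕ.* m) ≡ c → m ℕ.* m ℕ.* r ℕ.≤ cost → (∀ ℓ → a ℕ.* cuts ℓ ℕ.≤ b ℕ.* ℓ) →
        c ℕ.* ∑ (λ u → ∑ (λ v → bit (removed u v))) ℕ.≤ b ℕ.* ∑ (λ u → ∑ (level u))
      chain a m b refl average bound = begin
        a ℕ.* (m ℕ.* m) ℕ.* ∑ (λ u → ∑ (λ v → bit (removed u v)))
          ≡⟨ cong (a ℕ.* (m ℕ.* m) ℕ.*_) (∑∑-cong (λ u v → bit-∧ (adj D u v) (cut (level u v) (label u) (label v)))) ⟩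
        a ℕ.* (m ℕ.* m) ℕ.* r               ≡⟨ ℕₚ.*-assoc a (m ℕ.* m) r ⟩
        a ℕ.* (m ℕ.* m ℕ.* r)               ≤⟨ ℕₚ.*-monoʳ-≤ a average ⟩
        a ℕ.* cost                          ≤⟨ ℕₚ.*-monoʳ-≤ a (∑∑-mono (λ u v → ∑∑-mono (λ x y → bit-*-≤ (adj D u v) (bit (cut (level u v) x y))))) ⟩
        a ℕ.* ∑ (λ u → ∑ (λ v → cuts (level u v)))    ≡⟨ *-∑∑ a (λ u v → cuts (level u v)) ⟩
        ∑ (λ u → ∑ (λ v → a ℕ.* cuts (level u v)))    ≤⟨ ∑∑-mono (λ u v → bound (level u v)) ⟩
        ∑ (λ u → ∑ (λ v → b ℕ.* level u v))           ≡⟨ *-∑∑ b level ⟨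
        b ℕ.* ∑ (λ u → ∑ (level u))                   ∎

    levels≤ : fromℕ (∑ (λ u → ∑ (level u))) ≤ K * ∑ℚ (λ u → ∑ℚ (w u))
    levels≤ = begin
      fromℕ (∑ (λ u → ∑ (level u)))              ≡⟨ trans (fromℕ-∑ (λ u → ∑ (level u))) (∑ℚ-cong (λ u → fromℕ-∑ (level u))) ⟩
      ∑ℚ (λ u → ∑ℚ (λ v → fromℕ (level u v)))    ≤⟨ ∑ℚ-mono (λ u → ∑ℚ-mono (λ v → proj₁ (proj₂ (level-exists u v)))) ⟩
      ∑ℚ (λ u → ∑ℚ (λ v → K * w u v))            ≡⟨ trans (∑ℚ-distribˡ K (λ u → ∑ℚ (w u))) (∑ℚ-cong (λ u → ∑ℚ-distribˡ K (w u))) ⟨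
      K * ∑ℚ (λ u → ∑ℚ (w u))                    ∎
      where open ≤-Reasoning

    -- The factor 17112 = 93 · 184 contains the unit of the levels; the loss of the rounding is
    -- 17112/9559, below 1.7902.
    removed≤weights : fromℕ (9559 ℕ.* ∑ (λ u → ∑ (λ v → bit (removed u v)))) ≤ fromℕ 17112 * ∑ℚ (λ u → ∑ℚ (w u))
    removed≤weights = begin
      fromℕ (9559 ℕ.* ∑ (λ u → ∑ (λ v → bit (removed u v))))   ≤⟨ fromℕ-mono removed≤levels ⟩
      fromℕ (93 ℕ.* ∑ (λ u → ∑ (level u)))                     ≡⟨ fromℕ-* 93 (∑ (λ u → ∑ (level u))) ⟩
      fromℕ 93 * fromℕ (∑ (λ u → ∑ (level u)))                 ≤⟨ *-monoˡ (0≤fromℕ 93) levels≤ ⟩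
      fromℕ 93 * (K * ∑ℚ (λ u → ∑ℚ (w u)))                     ≡⟨ *-assoc (fromℕ 93) K (∑ℚ (λ u → ∑ℚ (w u))) ⟨
      fromℕ 93 * K * ∑ℚ (λ u → ∑ℚ (w u))                       ≡⟨ cong (_* ∑ℚ (λ u → ∑ℚ (w u))) (fromℕ-* 93 184) ⟨
      fromℕ 17112 * ∑ℚ (λ u → ∑ℚ (w u))                        ∎
      where open ≤-Reasoning

    kept-elim : ∀ u v → kept u v ≡ true → Arc D u v × level u v ℕ.+ 6 ℕ.* toℕ (label v) ℕ.< 61 ℕ.+ 6 ℕ.* toℕ (label u)
    kept-elim u v eq with adj D u v | 61 ℕ.+ 6 ℕ.* toℕ (label u) ℕ.≤ᵇ level u v ℕ.+ 6 ℕ.* toℕ (label v) in eq′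
    ... | true | false = refl , ℕₚ.≰⇒> (λ le → subst T eq′ (ℕₚ.≤⇒≤ᵇ le))

    removed-intro : ∀ {u v} → Arc D u v → removed u v ≡ false → kept u v ≡ true
    removed-intro {u} {v} uv eq with adj D u v
    removed-intro {u} {v} refl eq | true = cong not eq

    -- The labels cancel around the triangle. The three strict inequalities for kept arcs supply one
    -- unit each, exactly what rounding down to levels may have lost, so 184 times the weight is
    -- below 183. The last unit is 3 · 184 ε = 1.
    kept-light : ∀ {a b c ε} → fromℕ 552 * ε ≡ 1ℚ → kept a b ≡ true → kept b c ≡ true → kept c a ≡ true →
      ¬ (1ℚ ≤ (w a b + ε) + ((w b c + ε) + (w c a + ε)))
    kept-light {a} {b} {c} {ε} 552ε≡1 ab bc ca heavy = <-irrefl refl (begin-strict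
      K                                                         ≡⟨ *-identityʳ K ⟨
      K * 1ℚ                                                    ≤⟨ *-monoˡ (0≤fromℕ 184) heavy ⟩
      K * ((w a b + ε) + ((w b c + ε) + (w c a + ε)))           ≡⟨ ring K ε (w a b) (w b c) (w c a) ⟩
      K * w a b + (K * w b c + K * w c a) + (K + (K + K)) * ε   ≡⟨ cong (λ x → K * w a b + (K * w b c + K * w c a) + x) 3Kε ⟩
      K * w a b + (K * w b c + K * w c a) + 1ℚ                  <⟨ +-monoˡ-< 1ℚ (+-mono-< (up a b) (+-mono-< (up b c) (up c a))) ⟩
      fromℕ (suc x) + (fromℕ (suc y) + fromℕ (suc z)) + 1ℚ      ≡⟨ collect ⟨
      fromℕ (suc x ℕ.+ (suc y ℕ.+ suc z) ℕ.+ 1)                 ≤⟨ fromℕ-mono sum≤ ⟩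
      K                                                         ∎)
      where
      open ≤-Reasoning
      x y z : ℕ
      x = level a b
      y = level b c
      z = level c a
      up : ∀ u v → K * w u v < fromℕ (suc (level u v))
      up u v = proj₂ (proj₂ (level-exists u v))
      ring : ∀ K ε x y z → K * ((x + ε) + ((y + ε) + (z + ε))) ≡ K * x + (K * y + K * z) + (K + (K + K)) * ε
      ring = solve-∀ ℚ-ring
      3Kε : (K + (K + K)) * ε ≡ 1ℚ
      3Kε = trans (cong (_* ε) (sym (trans (fromℕ-+ 184 368) (cong (λ x → K + x) (fromℕ-+ 184 184))))) 552ε≡1
      collect : fromℕ (suc x ℕ.+ (suc y ℕ.+ suc z) ℕ.+ 1) ≡ fromℕ (suc x) + (fromℕ (suc y) + fromℕ (suc z)) + 1ℚ
      collect = trans (fromℕ-+ (suc x ℕ.+ (suc y ℕ.+ suc z)) 1) (cong₂ _+_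
        (trans (fromℕ-+ (suc x) (suc y ℕ.+ suc z)) (cong (λ q → fromℕ (suc x) + q) (fromℕ-+ (suc y) (suc z)))) fromℕ-1)
      sum≤ : suc x ℕ.+ (suc y ℕ.+ suc z) ℕ.+ 1 ℕ.≤ 184
      sum≤ = ℕₚ.+-monoˡ-≤ 1 (ℕₚ.+-cancelʳ-≤ s _ 183 (subst₂ ℕ._≤_ (lhs x y z p q r) (rhs p q r)
        (ℕₚ.+-mono-≤ (proj₂ (kept-elim a b ab)) (ℕₚ.+-mono-≤ (proj₂ (kept-elim b c bc)) (proj₂ (kept-elim c a ca))))))
        where
        p q r s : ℕ
        p = toℕ (label a)
        q = toℕ (label b)
        r = toℕ (label c)
        s = 6 ℕ.* p ℕ.+ (6 ℕ.* q ℕ.+ 6 ℕ.* r)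
        lhs : ∀ x y z p q r → (1 ℕ.+ (x ℕ.+ 6 ℕ.* q)) ℕ.+ ((1 ℕ.+ (y ℕ.+ 6 ℕ.* r)) ℕ.+ (1 ℕ.+ (z ℕ.+ 6 ℕ.* p)))
          ≡ (1 ℕ.+ x) ℕ.+ ((1 ℕ.+ y) ℕ.+ (1 ℕ.+ z)) ℕ.+ (6 ℕ.* p ℕ.+ (6 ℕ.* q ℕ.+ 6 ℕ.* r))
        lhs = solveℕ-∀
        rhs : ∀ p q r → (61 ℕ.+ 6 ℕ.* p) ℕ.+ ((61 ℕ.+ 6 ℕ.* q) ℕ.+ (61 ℕ.+ 6 ℕ.* r)) ≡ 183 ℕ.+ (6 ℕ.* p ℕ.+ (6 ℕ.* q ℕ.+ 6 ℕ.* r))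
        rhs = solveℕ-∀

    module Union (R₂ : Fin n → Fin n → Bool) (R₂⊆kept : ∀ {u v} → R₂ u v ≡ true → kept u v ≡ true)
      (R₂-hits : ∀ {a b c} → kept a b ≡ true → kept b c ≡ true → kept c a ≡ true →
        R₂ a b ≡ true ⊎ R₂ b c ≡ true ⊎ R₂ c a ≡ true) where

      R : Fin n → Fin n → Bool
      R u v = removed u v ∨ R₂ u v

      R-arc : ∀ {u v} → R u v ≡ true → Arc D u v
      R-arc {u} {v} r = either (∧-trueˡ (adj D u v)) (λ r₂ → proj₁ (kept-elim u v (R₂⊆kept r₂))) (∨-true (removed u v) (R₂ u v) r)

      R-hits : ∀ {a b c} → Arc D a b → Arc D b c → Arc D c a → R a b ≡ true ⊎ R b c ≡ true ⊎ R c a ≡ true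
      R-hits {a} {b} {c} ab bc ca =
        either (λ r → inj₁ (in-removed a b r)) (λ kab →
        either (λ r → inj₂ (inj₁ (in-removed b c r))) (λ kbc →
        either (λ r → inj₂ (inj₂ (in-removed c a r))) (λ kca →
          Sum.map (in-R₂ a b) (Sum.map (in-R₂ b c) (in-R₂ c a)) (R₂-hits kab kbc kca))
        (removed-or-kept c a ca)) (removed-or-kept b c bc)) (removed-or-kept a b ab)
        where
        in-removed : ∀ u v → removed u v ≡ true → R u v ≡ true
        in-removed u v r = cong (_∨ R₂ u v) r
        in-R₂ : ∀ u v → R₂ u v ≡ true → R u v ≡ true
        in-R₂ u v r = trans (cong (removed u v ∨_) r) (∨-zeroʳ (removed u v))
        removed-or-kept : ∀ u v → Arc D u v → removed u v ≡ true ⊎ kept u v ≡ true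
        removed-or-kept u v uv = either inj₁ (λ e → inj₂ (removed-intro uv e)) (true-or-false (removed u v))

  -- Covers listed from a set of arcs.

  concatFin : ∀ {A : Set} {m} → (Fin m → List A) → List A
  concatFin {m = zero}  F = []
  concatFin {m = suc m} F = F zero ++ concatFin (F ∘ suc)

  length-concatFin : ∀ {A : Set} {m} (F : Fin m → List A) → length (concatFin F) ≡ ∑ (λ i → length (F i))
  length-concatFin {m = zero}  F = refl
  length-concatFin {m = suc m} F = trans (length-++ (F zero)) (cong (length (F zero) ℕ.+_) (length-concatFin (F ∘ suc)))

  concatFin-∈ : ∀ {A : Set} {m} (F : Fin m → List A) i {x} → x ∈ F i → x ∈ concatFin F
  concatFin-∈ F zero    x∈ = ∈-++⁺ˡ x∈
  concatFin-∈ F (suc i) x∈ = ∈-++⁺ʳ (F zero) (concatFin-∈ (F ∘ suc) i x∈)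

  concatFin-All : ∀ {A : Set} {P : A → Set} {m} (F : Fin m → List A) → (∀ i → All P (F i)) → All P (concatFin F)
  concatFin-All {m = zero}  F all = []
  concatFin-All {m = suc m} F all = Allₚ.++⁺ (all zero) (concatFin-All (F ∘ suc) (all ∘ suc))

  arcList : ∀ {n} → (Fin n → Fin n → Bool) → List (Fin n × Fin n)
  arcList R = concatFin (λ u → List.map (u ,_) (support (R u)))

  length-arcList : ∀ {n} (R : Fin n → Fin n → Bool) → length (arcList R) ≡ ∑ (λ u → ∑ (λ v → bit (R u v)))
  length-arcList R = trans (length-concatFin (λ u → List.map (u ,_) (support (R u))))
    (∑-cong (λ u → trans (length-map (u ,_) (support (R u))) (length-support (R u))))

  arcList-cover : ∀ {n} (D : Digraph n) (R : Fin n → Fin n → Bool) → (∀ {u v} → R u v ≡ true → Arc D u v) →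
    (∀ {a b c} → Arc D a b → Arc D b c → Arc D c a → R a b ≡ true ⊎ R b c ≡ true ⊎ R c a ≡ true) →
    Cover D (∑ (λ u → ∑ (λ v → bit (R u v))))
  arcList-cover D R sub hits = subst (Cover D) (length-arcList R) (List.lookup (arcList R) , arcs , hit)
    where
    ∈-arcList : ∀ {u v} → R u v ≡ true → (u , v) ∈ arcList R
    ∈-arcList {u} {v} uv = concatFin-∈ _ u (∈-map⁺ (u ,_) (support-complete (R u) v uv))
    all-arcs : All (λ e → Arc D (proj₁ e) (proj₂ e)) (arcList R)
    all-arcs = concatFin-All _ (λ u → Allₚ.map⁺ (All.map sub (support-true (R u))))
    arcs : ∀ i → Arc D (proj₁ (List.lookup (arcList R) i)) (proj₂ (List.lookup (arcList R) i))
    arcs i = All.lookup all-arcs (∈-lookup i)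
    at : ∀ {e es} → (e∈ : e ∈ arcList R) → e ∈ es → List.lookup (arcList R) (Any.index e∈) ∈ es
    at e∈ e∈es = subst (_∈ _) (lookup-index e∈) e∈es
    hit : ∀ t → ∃ λ i → List.lookup (arcList R) i ∈ arcsOf t
    hit t with hits (Triangle.ab t) (Triangle.bc t) (Triangle.ca t)
    ... | inj₁ r        = _ , at (∈-arcList r) (here refl)
    ... | inj₂ (inj₁ r) = _ , at (∈-arcList r) (there (here refl))
    ... | inj₂ (inj₂ r) = _ , at (∈-arcList r) (there (there (here refl)))

  -- Choice of the probability and of the parameters.

  abstract
    -- The interval [α, 1 - α] is cut into c (N² + 1) steps of length h = α/(N² + 1), which fits
    -- since cα = 1 - 2α. The errors h² N² of all steps add up to cα · αN²/(N² + 1) ≤ 1; this is the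
    -- 1 added to `ν`.
    good-probability : ∀ {N} c .{{_ : NonZero c}} {α ν} → 0ℚ < α → fromℕ c * α + (α + α) ≡ 1ℚ →
      (f : Vec Bool N → ℚ) → (∀ v S → 0ℚ ≤ ∂ v f S) → (∀ v S → ∂ v f S ≤ 1ℚ) → (∀ S → 0ℚ ≤ f S) → (∀ S → f S ≤ ν) →
      ∃ λ p → α ≤ p × p + α ≤ 1ℚ × fromℕ c * α * ∑ℚ (λ v → E p (∂ v f)) ≤ ν + 1ℚ
    good-probability {N} c {α} {ν} 0<α cα+2α≡1 f 0≤∂ ∂≤1 0≤f f≤ν =
      p , ≤-by-slack (fromℕ j * h) (0≤* (0≤fromℕ j) 0≤h) refl , p+α≤1 , result
      where
      s : ℕ
      s = suc (N ℕ.* N)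
      β h C : ℚ
      β = proj₁ (reciprocal s)
      h = α * β
      C = fromℕ c * α
      0≤α : 0ℚ ≤ α
      0≤α = <⇒≤ 0<α
      0≤β : 0ℚ ≤ β
      0≤β = <⇒≤ (proj₁ (proj₂ (reciprocal s)))
      sβ≡1 : fromℕ s * β ≡ 1ℚ
      sβ≡1 = proj₂ (proj₂ (reciprocal s))
      0≤h : 0ℚ ≤ h
      0≤h = 0≤* 0≤α 0≤β
      0≤C : 0ℚ ≤ C
      0≤C = 0≤* (0≤fromℕ c) 0≤α
      k : ℕ
      k = ℕ.pred (c ℕ.* s)
      k≡ : suc k ≡ c ℕ.* s
      k≡ = ℕₚ.suc-pred (c ℕ.* s) {{ℕₚ.m*n≢0 c s}}
      fk≡ : fromℕ (suc k) ≡ fromℕ c * fromℕ s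
      fk≡ = trans (cong fromℕ k≡) (fromℕ-* c s)
      kh≡ : fromℕ (suc k) * h ≡ C
      kh≡ = trans (cong (_* h) fk≡) (trans (ring (fromℕ c) (fromℕ s) α β) (trans (cong (λ x → fromℕ c * α * x) sβ≡1) (*-identityʳ C)))
        where
        ring : ∀ c s α β → c * s * (α * β) ≡ c * α * (s * β)
        ring = solve-∀ ℚ-ring
      α+C≤1 : α + C ≤ 1ℚ
      α+C≤1 = ≤-by-slack α 0≤α (trans (sym cα+2α≡1) (ring C α))
        where
        ring : ∀ C α → C + (α + α) ≡ α + C + α
        ring = solve-∀ ℚ-ring
      C≤1 : C ≤ 1ℚ
      C≤1 = ≤-by-slack (α + α) (0≤+ 0≤α 0≤α) (sym cα+2α≡1)
      α≤1 : α ≤ 1ℚ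
      α≤1 = ≤-trans (≤-by-slack C 0≤C refl) α+C≤1
      M : ℚ
      M = fromℕ N * fromℕ N
      0≤M : 0ℚ ≤ M
      0≤M = 0≤* (0≤fromℕ N) (0≤fromℕ N)
      Mβ≤1 : M * β ≤ 1ℚ
      Mβ≤1 = subst (M * β ≤_) sβ≡1 (*-monoʳ-≤-nonNeg β {{nonNegative 0≤β}}
        (subst (_≤ fromℕ s) (fromℕ-* N N) (fromℕ-mono (ℕₚ.n≤1+n (N ℕ.* N)))))
      error≤1 : C * (α * (M * β)) ≤ 1ℚ
      error≤1 = *-mono-nonNeg 0≤C C≤1 (0≤* 0≤α (0≤* 0≤M 0≤β)) (*-mono-nonNeg 0≤α α≤1 (0≤* 0≤M 0≤β) Mβ≤1)
      W : ℚ → ℚ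
      W p = ∑ℚ (λ v → E p (∂ v f))
      chosen : ∃ λ j → j ℕ.< suc k × E α f + fromℕ (suc k) * (h * W (α + fromℕ j * h) - h * h * M) ≤ E (α + fromℕ (suc k) * h) f
      chosen = ∃-small-derivative k 0≤α 0≤h (subst (λ x → α + x ≤ 1ℚ) (sym kh≡) α+C≤1) f 0≤∂ ∂≤1
      j : ℕ
      j = proj₁ chosen
      j<k : j ℕ.< suc k
      j<k = proj₁ (proj₂ chosen)
      p : ℚ
      p = α + fromℕ j * h
      p+α≤1 : p + α ≤ 1ℚ
      p+α≤1 = ≤-trans (+-monoˡ-≤ α (+-monoʳ-≤ α (≤-trans (*-monoʳ-≤-nonNeg h {{nonNegative 0≤h}} (fromℕ-mono (ℕₚ.<⇒≤ j<k))) (≤-reflexive kh≡))))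
        (≤-reflexive (trans (r C α) cα+2α≡1))
        where
        r : ∀ C α → α + C + α ≡ C + (α + α)
        r = solve-∀ ℚ-ring
      reached : ℚ
      reached = E α f + fromℕ (suc k) * (h * W p - h * h * M)
      reached≤ν : reached ≤ ν
      reached≤ν = ≤-trans (proj₂ (proj₂ chosen)) (E-≤ (0≤+ 0≤α (0≤* (0≤fromℕ (suc k)) 0≤h)) (subst (λ x → α + x ≤ 1ℚ) (sym kh≡) α+C≤1) f≤ν)
      reached≡ : fromℕ (suc k) * (h * W p - h * h * M) ≡ C * W p - C * (α * (M * β))
      reached≡ = trans (r₁ (fromℕ (suc k)) h (W p) M) (trans (cong (λ x → x * W p - x * (h * M)) kh≡) (r₂ C α β (W p) M))
        where
        r₁ : ∀ k h w m → k * (h * w - h * h * m) ≡ k * h * w - k * h * (h * m)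
        r₁ = solve-∀ ℚ-ring
        r₂ : ∀ C α β w m → C * w - C * (α * β * m) ≡ C * w - C * (α * (m * β))
        r₂ = solve-∀ ℚ-ring
      ring : ∀ ν C α β M W e → ν + 1ℚ ≡ C * W + ((ν - (e + (C * W - C * (α * (M * β))))) + (1ℚ - C * (α * (M * β))) + e)
      ring = solve-∀ ℚ-ring
      result : C * W p ≤ ν + 1ℚ
      result = ≤-by-slack ((ν - reached) + (1ℚ - C * (α * (M * β))) + E α f) (0≤+ (0≤+ (slack reached≤ν) (slack error≤1)) (E-nonNeg 0≤α α≤1 0≤f))
        (trans (ring ν C α β M (W p) (E α f))
          (cong (λ x → C * W p + ((ν - (E α f + x)) + (1ℚ - C * (α * (M * β))) + E α f)) (sym reached≡)))

  -- Combines the rounding factor b/a with the loss d/c from the choice of p. All constants are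
  -- variables, so `consts` is the only numerical fact.
  rescale : ∀ a b c d .{{_ : NonZero (c ℕ.* a)}} {α W x ν₁} → 0ℚ < α → fromℕ d * α ≡ 1ℚ → 5 ℕ.* (d ℕ.* b) ℕ.≤ 9 ℕ.* (c ℕ.* a) →
    fromℕ (a ℕ.* x) ≤ fromℕ b * W → fromℕ c * α * W ≤ fromℕ ν₁ → 5 ℕ.* x ℕ.≤ 9 ℕ.* ν₁
  rescale a b c d {α} {W} {x} {ν₁} 0<α dα≡1 consts x≤ W≤ = ℕₚ.*-cancelˡ-≤ (c ℕ.* a) (begin
    c ℕ.* a ℕ.* (5 ℕ.* x)          ≡⟨ ring₁ a c x ⟩
    5 ℕ.* (c ℕ.* (a ℕ.* x))        ≤⟨ ℕₚ.*-monoʳ-≤ 5 (fromℕ-cancel bound) ⟩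
    5 ℕ.* (d ℕ.* (b ℕ.* ν₁))       ≡⟨ ring₂ b d ν₁ ⟩
    5 ℕ.* (d ℕ.* b) ℕ.* ν₁         ≤⟨ ℕₚ.*-monoˡ-≤ ν₁ consts ⟩
    9 ℕ.* (c ℕ.* a) ℕ.* ν₁         ≡⟨ ring₃ a c ν₁ ⟩
    c ℕ.* a ℕ.* (9 ℕ.* ν₁)         ∎)
    where
    open ℕₚ.≤-Reasoning
    ring₁ : ∀ a c x → c ℕ.* a ℕ.* (5 ℕ.* x) ≡ 5 ℕ.* (c ℕ.* (a ℕ.* x))
    ring₁ = solveℕ-∀
    ring₂ : ∀ b d x → 5 ℕ.* (d ℕ.* (b ℕ.* x)) ≡ 5 ℕ.* (d ℕ.* b) ℕ.* x
    ring₂ = solveℕ-∀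
    ring₃ : ∀ a c x → 9 ℕ.* (c ℕ.* a) ℕ.* x ≡ c ℕ.* a ℕ.* (9 ℕ.* x)
    ring₃ = solveℕ-∀
    bound : fromℕ (c ℕ.* (a ℕ.* x)) ≤ fromℕ (d ℕ.* (b ℕ.* ν₁))
    bound = ≤-trans (≤-trans (≤-reflexive lhs) (*-monoˡ (0≤fromℕ d)
      (≤-trans (*-monoˡ (0≤* (0≤fromℕ c) (<⇒≤ 0<α)) x≤) (≤-trans (≤-reflexive mid) (*-monoˡ (0≤fromℕ b) W≤))))) (≤-reflexive rhs)
      where
      r₁ : ∀ c d α y → d * α * (c * y) ≡ d * (c * α * y)
      r₁ = solve-∀ ℚ-ring
      lhs : fromℕ (c ℕ.* (a ℕ.* x)) ≡ fromℕ d * (fromℕ c * α * fromℕ (a ℕ.* x))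
      lhs = trans (fromℕ-* c (a ℕ.* x)) (trans (sym (*-identityˡ (fromℕ c * fromℕ (a ℕ.* x))))
        (trans (cong (λ y → y * (fromℕ c * fromℕ (a ℕ.* x))) (sym dα≡1)) (r₁ (fromℕ c) (fromℕ d) α (fromℕ (a ℕ.* x)))))
      r₂ : ∀ c α b W → c * α * (b * W) ≡ b * (c * α * W)
      r₂ = solve-∀ ℚ-ring
      mid : fromℕ c * α * (fromℕ b * W) ≡ fromℕ b * (fromℕ c * α * W)
      mid = r₂ (fromℕ c) α (fromℕ b) W
      rhs : fromℕ d * (fromℕ b * fromℕ ν₁) ≡ fromℕ (d ℕ.* (b ℕ.* ν₁))
      rhs = sym (trans (fromℕ-* d (b ℕ.* ν₁)) (cong (fromℕ d *_) (fromℕ-* b ν₁)))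

  -- Probabilities are taken in [α, 1 - α], a triangle is light if its weight is below 1 - 3 ε, and α² ε = 1 / s
  -- is the threshold for a noticeable correlation.
  record Parameters : Set where
    field
      α ε  : ℚ
      s    : ℕ
      0<α  : 0ℚ < α
      0<ε  : 0ℚ < ε
      400α : fromℕ 400 * α ≡ 1ℚ
      552ε : fromℕ 552 * ε ≡ 1ℚ
      sα²ε : fromℕ s * (α * α * ε) ≡ 1ℚ

  parameters : Parameters
  parameters = record
    { α = proj₁ (reciprocal 400) ; ε = proj₁ (reciprocal 552) ; s = 400 ℕ.* 400 ℕ.* 552
    ; 0<α = proj₁ (proj₂ (reciprocal 400)) ; 0<ε = proj₁ (proj₂ (reciprocal 552))
    ; 400α = proj₂ (proj₂ (reciprocal 400)) ; 552ε = proj₂ (proj₂ (reciprocal 552))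
    ; sα²ε = product 400 552 (proj₂ (proj₂ (reciprocal 400))) (proj₂ (proj₂ (reciprocal 552))) }
    where
    product : ∀ d e {α ε} → fromℕ d * α ≡ 1ℚ → fromℕ e * ε ≡ 1ℚ → fromℕ (d ℕ.* d ℕ.* e) * (α * α * ε) ≡ 1ℚ
    product d e {α} {ε} dα eε = trans (cong (_* (α * α * ε)) (trans (fromℕ-* (d ℕ.* d) e) (cong (_* fromℕ e) (fromℕ-* d d))))
      (trans (ring (fromℕ d) (fromℕ e) α ε) (trans (cong₂ (λ x y → x * x * y) dα eε) refl))
      where
      ring : ∀ d e α ε → d * d * e * (α * α * ε) ≡ (d * α) * (d * α) * (e * ε)
      ring = solve-∀ ℚ-ring

  -- The cover for given parameters: rounding followed by triangle removal.

  module _ (parameters : Parameters) where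

    open Parameters parameters

    module AtProbability {n : ℕ} (D : Digraph n) {p : ℚ} (α≤p : α ≤ p) (p+α≤1 : p + α ≤ 1ℚ) where

      0≤α : 0ℚ ≤ α
      0≤α = <⇒≤ 0<α
      0≤ε : 0ℚ ≤ ε
      0≤ε = <⇒≤ 0<ε
      0≤p : 0ℚ ≤ p
      0≤p = ≤-trans 0≤α α≤p
      p≤1 : p ≤ 1ℚ
      p≤1 = ≤-trans (≤-by-slack α 0≤α refl) p+α≤1

      α≤π : ∀ b → α ≤ π p b
      α≤π true  = α≤p
      α≤π false = ≤-by-slack (1ℚ - (p + α)) (slack p+α≤1) (ring p α)
        where
        ring : ∀ p α → 1ℚ - p ≡ α + (1ℚ - (p + α))
        ring = solve-∀ ℚ-ring

      α²≤P : ∀ σ τ → α * α ≤ π p σ * π p τ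
      α²≤P σ τ = *-mono-nonNeg 0≤α (α≤π σ) 0≤α (α≤π τ)

      0<P : ∀ σ τ → 0ℚ < π p σ * π p τ
      0<P σ τ = <-≤-trans (positive⁻¹ (α * α) {{pos*pos⇒pos α {{positive 0<α}} α {{positive 0<α}}}}) (α²≤P σ τ)

      w : Fin n → Fin n → ℚ
      w u v = E p (∂ (combine u v) (packing D))

      open Rounding D w (λ u v → E-nonNeg 0≤p p≤1 (0≤∂packing D (combine u v)))
        (λ u v → E-≤ 0≤p p≤1 (∂packing≤1 D (combine u v))) public

      kept-few-triangles : ∑ (triangles kept) ℕ.≤ 3 ℕ.* (s ℕ.* s) ℕ.* (n ℕ.* n)
      kept-few-triangles = few-light-triangles D 0≤p p≤1 {α * α * ε} {ε} (0≤* (0≤* 0≤α 0≤α) 0≤ε) {s} sα²ε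
        (λ σ τ → *-monoʳ-≤-nonNeg ε {{nonNegative 0≤ε}} (α²≤P σ τ)) 0<P kept
        (λ {a} {b} {c} ab bc ca → proj₁ (kept-elim a b ab) , proj₁ (kept-elim b c bc) , proj₁ (kept-elim c a ca)
          , kept-light {a} {b} {c} {ε} 552ε ab bc ca)

      removed-few : ∀ {ν} → fromℕ 398 * α * ∑ℚ (λ v → E p (∂ v (packing D))) ≤ fromℕ (suc ν) →
        5 ℕ.* ∑ (λ u → ∑ (λ v → bit (removed u v))) ℕ.≤ 9 ℕ.* suc ν
      removed-few {ν} weights≤ = rescale 9559 17112 398 400 {α} {∑ℚ (λ u → ∑ℚ (w u))} {∑ (λ u → ∑ (λ v → bit (removed u v)))} {suc ν}
        -- The inequality is 34224000 ≤ 34240338: the margin between 1.7902 and 1.8 pays for the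
        -- factor 400/398.
        0<α 400α (ℕₚ.≤ᵇ⇒≤ (5 ℕ.* (400 ℕ.* 17112)) (9 ℕ.* (398 ℕ.* 9559)) _) removed≤weights
        (subst (λ x → fromℕ 398 * α * x ≤ fromℕ (suc ν)) (∑ℚ-combine n (λ v → E p (∂ v (packing D)))) weights≤)

      -- Rounding contributes at most 9 (ν + 1)/5 arcs and the removal lemma at most 7n²/t; the
      -- conclusion is multiplied by 5t.
      cover-with : ∀ {t ν} → fromℕ 398 * α * ∑ℚ (λ v → E p (∂ v (packing D))) ≤ fromℕ (suc ν) →
        TriangleCover kept t (7 ℕ.* (n ℕ.* n)) →
        ∃ λ κ → Cover D κ × t ℕ.* (5 ℕ.* κ) ℕ.≤ t ℕ.* (9 ℕ.* suc ν) ℕ.+ 35 ℕ.* (n ℕ.* n)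
      cover-with {t} {ν} weights≤ (R₂ , R₂⊆ , R₂-few , R₂-hits) =
        ∑ (λ u → ∑ (λ v → bit (R u v))) , arcList-cover D R R-arc R-hits , combined t {9 ℕ.* suc ν} {n ℕ.* n} (removed-few weights≤) R₂-few
        where
        open Union R₂ (λ {u} {v} → R₂⊆ {u} {v}) (λ {a} {b} {c} → R₂-hits {a} {b} {c})
        combined : ∀ t {x y} → 5 ℕ.* ∑ (λ u → ∑ (λ v → bit (removed u v))) ℕ.≤ x → t ℕ.* ∑ (λ u → ∑ (λ v → bit (R₂ u v))) ℕ.≤ 7 ℕ.* y →
          t ℕ.* (5 ℕ.* ∑ (λ u → ∑ (λ v → bit (R u v)))) ℕ.≤ t ℕ.* x ℕ.+ 35 ℕ.* y
        combined t {x} {y} few₁ few₂ = begin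
          t ℕ.* (5 ℕ.* ∑ (λ u → ∑ (λ v → bit (R u v))))
            ≤⟨ ℕₚ.*-monoʳ-≤ t (ℕₚ.*-monoʳ-≤ 5 (ℕₚ.≤-trans (∑∑-mono (λ u v → bit-∨ (removed u v) (R₂ u v)))
                 (ℕₚ.≤-reflexive (∑∑-+ (λ u v → bit (removed u v)) (λ u v → bit (R₂ u v)))))) ⟩
          t ℕ.* (5 ℕ.* (r₁ ℕ.+ r₂))                   ≡⟨ ring₁ t r₁ r₂ ⟩
          t ℕ.* (5 ℕ.* r₁) ℕ.+ 5 ℕ.* (t ℕ.* r₂)       ≤⟨ ℕₚ.+-mono-≤ (ℕₚ.*-monoʳ-≤ t few₁) (ℕₚ.*-monoʳ-≤ 5 few₂) ⟩
          t ℕ.* x ℕ.+ 5 ℕ.* (7 ℕ.* y)                 ≡⟨ ring₂ t x y ⟩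
          t ℕ.* x ℕ.+ 35 ℕ.* y                        ∎
          where
          open ℕₚ.≤-Reasoning
          r₁ r₂ : ℕ
          r₁ = ∑ (λ u → ∑ (λ v → bit (removed u v)))
          r₂ = ∑ (λ u → ∑ (λ v → bit (R₂ u v)))
          ring₁ : ∀ t x y → t ℕ.* (5 ℕ.* (x ℕ.+ y)) ≡ t ℕ.* (5 ℕ.* x) ℕ.+ 5 ℕ.* (t ℕ.* y)
          ring₁ = solveℕ-∀
          ring₂ : ∀ t x y → t ℕ.* x ℕ.+ 5 ℕ.* (7 ℕ.* y) ≡ t ℕ.* x ℕ.+ 35 ℕ.* y
          ring₂ = solveℕ-∀

    398α : fromℕ 398 * α + (α + α) ≡ 1ℚ
    398α = trans (ring (fromℕ 398) α) (trans (cong (_* α) (sym (trans (fromℕ-+ 398 2)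
      (cong (λ x → fromℕ 398 + x) (trans (fromℕ-+ 1 1) (cong₂ _+_ fromℕ-1 fromℕ-1)))))) 400α)
      where
      ring : ∀ c α → c * α + (α + α) ≡ (c + (1ℚ + 1ℚ)) * α
      ring = solve-∀ ℚ-ring

    small-cover : ∀ t → ∃ λ n₀ → ∀ {n} → n₀ ℕ.≤ n → (D : Digraph n) → ∀ {ν} → (∀ k → Packing D k → k ℕ.≤ ν) →
      ∃ λ κ → Cover D κ × t ℕ.* (5 ℕ.* κ) ℕ.≤ t ℕ.* (9 ℕ.* suc ν) ℕ.+ 35 ℕ.* (n ℕ.* n)
    small-cover t = n₀ , cover
      where
      n₀ : ℕ
      n₀ = proj₁ (triangle-removal t (3 ℕ.* (s ℕ.* s)))
      cover : ∀ {n} → n₀ ℕ.≤ n → (D : Digraph n) → ∀ {ν} → (∀ k → Packing D k → k ℕ.≤ ν) →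
        ∃ λ κ → Cover D κ × t ℕ.* (5 ℕ.* κ) ℕ.≤ t ℕ.* (9 ℕ.* suc ν) ℕ.+ 35 ℕ.* (n ℕ.* n)
      cover {n} n₀≤n D {ν} ν-max = at-probability
        (good-probability 398 {α} {fromℕ ν} 0<α 398α (packing D) (0≤∂packing D) (∂packing≤1 D)
          (λ S → 0≤fromℕ (maxPacking D (allTriangles D) (toSet D S)))
          (λ S → ≤-trans (packing≤ D S) (fromℕ-mono (ν-max (maxPacking D (allTriangles D) (λ _ → true)) (packing-attained D)))))
        where
        at-probability : (∃ λ p → α ≤ p × p + α ≤ 1ℚ × fromℕ 398 * α * ∑ℚ (λ v → E p (∂ v (packing D))) ≤ fromℕ ν + 1ℚ) →
          ∃ λ κ → Cover D κ × t ℕ.* (5 ℕ.* κ) ℕ.≤ t ℕ.* (9 ℕ.* suc ν) ℕ.+ 35 ℕ.* (n ℕ.* n)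
        at-probability (p , α≤p , p+α≤1 , weights≤) = cover-with {t} {ν}
          (≤-trans weights≤ (≤-reflexive (trans (+-comm (fromℕ ν) 1ℚ) (sym (fromℕ-suc ν)))))
          (proj₂ (triangle-removal t (3 ℕ.* (s ℕ.* s))) n₀≤n kept kept-few-triangles)
          where open AtProbability D α≤p p+α≤1

  -- From natural numbers to the rational inequality with δ.

  archimedean : ∀ δ → Positive δ → ∃ λ k → 1ℚ ≤ fromℕ (suc k) * δ
  -- The denominator of δ will do: multiplied by it, δ becomes its numerator, which is at least 1.
  archimedean δ@(mkℚ (+ suc m) k _) _ = k , subst (λ x → 1ℚ ≤ x * δ) (sym (fromℕ≡ℕ→ℚ (suc k)))
    (toℚᵘ-cancel-≤ (ℚᵘₚ.≤-trans (ℚᵘ.*≤* (ℤ.+≤+ le)) (ℚᵘₚ.≤-reflexive (ℚᵘₚ.≃-sym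
      (ℚᵘₚ.≃-trans (toℚᵘ-homo-* (ℕ→ℚ (suc k)) δ) (ℚᵘₚ.*-cong (toℚᵘ-fromℚᵘ (ℚᵘ.mkℚᵘ (+ suc k) 0)) (ℚᵘₚ.≃-refl {toℚᵘ δ})))))))
    where
    le : 1 ℕ.* suc (k ℕ.+ 0) ℕ.≤ suc k ℕ.* suc m ℕ.* 1
    le = ℕₚ.≤-trans (ℕₚ.≤-reflexive (trans (ℕₚ.*-identityˡ (suc (k ℕ.+ 0))) (cong suc (ℕₚ.+-identityʳ k))))
      (ℕₚ.≤-trans (ℕₚ.m≤m*n (suc k) (suc m)) (ℕₚ.≤-reflexive (sym (ℕₚ.*-identityʳ (suc k ℕ.* suc m)))))

  -- The error terms 126 d + 35 n² of t = 14 d are at most 70 n².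
  error-budget : ∀ d {n κ ν} → 4 ℕ.* d ℕ.≤ n → 14 ℕ.* d ℕ.* (5 ℕ.* κ) ℕ.≤ 14 ℕ.* d ℕ.* (9 ℕ.* suc ν) ℕ.+ 35 ℕ.* (n ℕ.* n) →
    d ℕ.* (5 ℕ.* κ) ℕ.≤ d ℕ.* (9 ℕ.* ν) ℕ.+ 5 ℕ.* (n ℕ.* n)
  error-budget d {n} {κ} {ν} 4d≤n bound = ℕₚ.*-cancelˡ-≤ 14 (begin
    14 ℕ.* (d ℕ.* (5 ℕ.* κ))                                ≡⟨ ℕₚ.*-assoc 14 d (5 ℕ.* κ) ⟨
    14 ℕ.* d ℕ.* (5 ℕ.* κ)                                  ≤⟨ bound ⟩
    -- Raises 126 d to 140 d = 35 · 4d, which 4d ≤ n ≤ n² turns into a second 35n².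
    14 ℕ.* d ℕ.* (9 ℕ.* suc ν) ℕ.+ 35 ℕ.* (n ℕ.* n)         ≤⟨ ℕₚ.m≤m+n _ (14 ℕ.* d) ⟩
    14 ℕ.* d ℕ.* (9 ℕ.* suc ν) ℕ.+ 35 ℕ.* (n ℕ.* n) ℕ.+ 14 ℕ.* d  ≡⟨ ring₁ d ν (n ℕ.* n) ⟩
    14 ℕ.* (d ℕ.* (9 ℕ.* ν)) ℕ.+ 35 ℕ.* (n ℕ.* n) ℕ.+ 35 ℕ.* (4 ℕ.* d)
      ≤⟨ ℕₚ.+-monoʳ-≤ (14 ℕ.* (d ℕ.* (9 ℕ.* ν)) ℕ.+ 35 ℕ.* (n ℕ.* n)) (ℕₚ.*-monoʳ-≤ 35 (ℕₚ.≤-trans 4d≤n (n≤n*n n))) ⟩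
    14 ℕ.* (d ℕ.* (9 ℕ.* ν)) ℕ.+ 35 ℕ.* (n ℕ.* n) ℕ.+ 35 ℕ.* (n ℕ.* n)  ≡⟨ ring₂ d ν (n ℕ.* n) ⟩
    14 ℕ.* (d ℕ.* (9 ℕ.* ν) ℕ.+ 5 ℕ.* (n ℕ.* n))            ∎)
    where
    open ℕₚ.≤-Reasoning
    n≤n*n : ∀ n → n ℕ.≤ n ℕ.* n
    n≤n*n zero      = ℕ.z≤n
    n≤n*n n@(suc _) = ℕₚ.m≤m*n n n
    ring₁ : ∀ d ν q → 14 ℕ.* d ℕ.* (9 ℕ.* (1 ℕ.+ ν)) ℕ.+ 35 ℕ.* q ℕ.+ 14 ℕ.* d ≡ 14 ℕ.* (d ℕ.* (9 ℕ.* ν)) ℕ.+ 35 ℕ.* q ℕ.+ 35 ℕ.* (4 ℕ.* d)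
    ring₁ = solveℕ-∀
    ring₂ : ∀ d ν q → 14 ℕ.* (d ℕ.* (9 ℕ.* ν)) ℕ.+ 35 ℕ.* q ℕ.+ 35 ℕ.* q ≡ 14 ℕ.* (d ℕ.* (9 ℕ.* ν) ℕ.+ 5 ℕ.* q)
    ring₂ = solveℕ-∀

  divide : ∀ k {δ τ κ ν n} → τ ℕ.≤ κ → 1ℚ ≤ fromℕ (suc k) * δ → suc k ℕ.* (5 ℕ.* κ) ℕ.≤ suc k ℕ.* (9 ℕ.* ν) ℕ.+ 5 ℕ.* (n ℕ.* n) →
    fromℕ τ ≤ ((+ 9) / 5) * fromℕ ν + δ * (fromℕ n * fromℕ n)
  divide k {δ} {τ} {κ} {ν} {n} τ≤κ 1≤dδ bound =
    *-cancelˡ-≤-pos d {{positive (0<fromℕ (suc k))}} (*-cancelˡ-≤-pos five {{positive (0<fromℕ 5)}} (begin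
      five * (d * fromℕ τ)                             ≤⟨ *-monoˡ (0≤fromℕ 5) (*-monoˡ (0≤fromℕ (suc k)) (fromℕ-mono τ≤κ)) ⟩
      five * (d * fromℕ κ)                             ≡⟨ swap five d (fromℕ κ) ⟩
      d * (five * fromℕ κ)                             ≡⟨ trans (fromℕ-* (suc k) (5 ℕ.* κ)) (cong (d *_) (fromℕ-* 5 κ)) ⟨
      fromℕ (suc k ℕ.* (5 ℕ.* κ))                      ≤⟨ fromℕ-mono bound ⟩
      fromℕ (suc k ℕ.* (9 ℕ.* ν) ℕ.+ 5 ℕ.* (n ℕ.* n))  ≡⟨ cast ⟩
      d * (fromℕ 9 * fromℕ ν) + five * n²              ≤⟨ +-monoʳ-≤ (d * (fromℕ 9 * fromℕ ν)) (*-monoˡ (0≤fromℕ 5) n²≤) ⟩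
      d * (fromℕ 9 * fromℕ ν) + five * (d * δ * n²)    ≡⟨ cong (λ x → d * (x * fromℕ ν) + five * (d * δ * n²)) nine ⟩
      d * (five * 9/5 * fromℕ ν) + five * (d * δ * n²) ≡⟨ ring d five 9/5 (fromℕ ν) δ n² ⟩
      five * (d * (9/5 * fromℕ ν + δ * n²))            ∎))
    where
    open ≤-Reasoning
    d five 9/5 n² : ℚ
    d = fromℕ (suc k)
    five = fromℕ 5
    9/5 = (+ 9) / 5
    n² = fromℕ n * fromℕ n
    swap : ∀ x y z → x * (y * z) ≡ y * (x * z)
    swap = solve-∀ ℚ-ring
    ring : ∀ d f g ν δ q → d * (f * g * ν) + f * (d * δ * q) ≡ f * (d * (g * ν + δ * q))
    ring = solve-∀ ℚ-ring
    nine : fromℕ 9 ≡ five * 9/5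
    nine = trans (fromℕ≡ℕ→ℚ 9) (sym (cong (_* 9/5) (fromℕ≡ℕ→ℚ 5)))
    n²≤ : n² ≤ d * δ * n²
    n²≤ = subst (_≤ d * δ * n²) (*-identityˡ n²)
      (*-monoʳ-≤-nonNeg n² {{nonNegative (0≤* (0≤fromℕ n) (0≤fromℕ n))}} 1≤dδ)
    cast : fromℕ (suc k ℕ.* (9 ℕ.* ν) ℕ.+ 5 ℕ.* (n ℕ.* n)) ≡ d * (fromℕ 9 * fromℕ ν) + five * n²
    cast = trans (fromℕ-+ (suc k ℕ.* (9 ℕ.* ν)) (5 ℕ.* (n ℕ.* n))) (cong₂ _+_
      (trans (fromℕ-* (suc k) (9 ℕ.* ν)) (cong (d *_) (fromℕ-* 9 ν)))
      (trans (fromℕ-* 5 (n ℕ.* n)) (cong (five *_) (fromℕ-* n n))))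

open Digraphs using (archimedean; small-cover; parameters; divide; error-budget)
open Expectation using (fromℕ≡ℕ→ℚ)

open import Defs
import Data.Nat as ℕ
import Data.Nat.Properties as ℕₚ
open import Data.Nat using (ℕ; suc; _≥_)
open import Data.Rational using (ℚ; Positive; _≤_; _+_; _*_; _/_)
open import Data.Integer using (+_)

theorem2 : ∀ (δ : ℚ) → Positive δ →
    ∃ λ (n₀ : ℕ) → ∀ (n : ℕ) → n ≥ n₀ → ∀ (D : Digraph n) (τ ν : ℕ) →
    IsTau D τ → IsNu D ν →
    ℕ→ℚ τ ≤ ((+ 9) / 5) * ℕ→ℚ ν + δ * (ℕ→ℚ n * ℕ→ℚ n)
-- The first bound on n serves the removal lemma with t = 14d, the second absorbs the excess of ν +
-- 1 over ν.
theorem2 δ 0<δ = n₁ ℕ.⊔ 4 ℕ.* d , bound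
  where
  k d n₁ : ℕ
  k = proj₁ (archimedean δ 0<δ)
  d = suc k
  n₁ = proj₁ (small-cover parameters (14 ℕ.* d))
  bound : ∀ n → n ≥ n₁ ℕ.⊔ 4 ℕ.* d → ∀ (D : Digraph n) (τ ν : ℕ) → IsTau D τ → IsNu D ν →
    ℕ→ℚ τ ≤ ((+ 9) / 5) * ℕ→ℚ ν + δ * (ℕ→ℚ n * ℕ→ℚ n)
  bound n n≥ D τ ν (_ , τ-min) (_ , ν-max) = conclude
    (proj₂ (small-cover parameters (14 ℕ.* d)) (ℕₚ.≤-trans (ℕₚ.m≤m⊔n n₁ (4 ℕ.* d)) n≥) D ν-max)
    where
    conclude : (∃ λ κ → Cover D κ × 14 ℕ.* d ℕ.* (5 ℕ.* κ) ℕ.≤ 14 ℕ.* d ℕ.* (9 ℕ.* suc ν) ℕ.+ 35 ℕ.* (n ℕ.* n)) →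
      ℕ→ℚ τ ≤ ((+ 9) / 5) * ℕ→ℚ ν + δ * (ℕ→ℚ n * ℕ→ℚ n)
    conclude (κ , cover , small) = subst₂ _≤_ (fromℕ≡ℕ→ℚ τ)
      (cong₂ (λ x y → ((+ 9) / 5) * x + δ * (y * y)) (fromℕ≡ℕ→ℚ ν) (fromℕ≡ℕ→ℚ n))
      (divide k {δ} {τ} {κ} {ν} {n} (τ-min κ cover) (proj₂ (archimedean δ 0<δ))
        (error-budget d {n} {κ} {ν} (ℕₚ.≤-trans (ℕₚ.m≤n⊔m n₁ (4 ℕ.* d)) n≥) small))
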